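{- Let $m,n\ge 2$ be integers and let \[ \mathcal{W}_{m,n}(\mathbb{Z};H)=\{A_1\cdots A_m : A_1,\ldots,A_m\in\mathcal{M}_n(\mathbb{Z};H)\}. \] Then, as $H\to\infty$, \[ H^{n^2+mn-n+o(1)}\le \#\mathcal{W}_{m,n}(\mathbb{Z};H). \] If moreover $m\ge 6$, then $\#\mathcal{W}_{m,n}(\mathbb{Z};H)=o(H^{mn^2})$ as $H\to\infty$.
   Context: For positive integers $n,H$, $\mathcal{M}_n(\mathbb{Z};H)$ denotes the set of $n\times n$ integer matrices all of whose entries have absolute value at most $H$. A bound $H^{a+o(1)}\le X$ means: for every $\varepsilon>0$, $X\ge H^{a-\varepsilon}$ for all sufficiently large $H$. $U(H)=o(V(H))$ means $U(H)/V(H)\to 0$ as $H\to\infty$. -}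

module Defs where

open import Data.Nat as ℕ using (ℕ; zero; suc)
open import Data.Integer as ℤ using (ℤ; +_)
open import Data.Fin using (Fin)
open import Data.Vec using (Vec; []; _∷_; lookup; tabulate; foldr)
open import Data.Vec.Properties using (≡-dec)
open import Data.List as List using (List; []; _∷_; map; concatMap; upTo; length; deduplicate)

Mat : ℕ → Set
Mat n = Vec (Vec ℤ n) n

_≟M_ : ∀ {n} (A B : Mat n) → _
_≟M_ = ≡-dec (≡-dec ℤ._≟_)

_·_ : ∀ {n} → Mat n → Mat n → Mat n
_·_ {n} A B = tabulate λ i → tabulate λ j →
  foldr (λ _ → ℤ) ℤ._+_ (+ 0) (tabulate λ k → lookup (lookup A i) k ℤ.* lookup (lookup B k) j)

identity : ∀ n → Mat n
identity n = tabulate λ i → tabulate λ j → δ i j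
  where
  δ : ∀ {k} → Fin k → Fin k → ℤ
  δ Fin.zero Fin.zero = + 1
  δ (Fin.suc i) (Fin.suc j) = δ i j
  δ _ _ = + 0

range : ℕ → List ℤ
range H = map (λ k → (+ k) ℤ.- (+ H)) (upTo (suc (H ℕ.+ H)))

allVecs : ∀ {A : Set} (n : ℕ) → List A → List (Vec A n)
allVecs zero xs = [] ∷ []
allVecs (suc n) xs = concatMap (λ x → map (x ∷_) (allVecs n xs)) xs

M : (n H : ℕ) → List (Mat n)
M n H = allVecs n (allVecs n (range H))

products : (m n H : ℕ) → List (Mat n)
products zero n H = identity n ∷ []
products (suc m) n H = concatMap (λ A → map (A ·_) (products m n H)) (M n H)

#W : (m n H : ℕ) → ℕ
#W m n H = length (deduplicate _≟M_ (products m n H))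

{-# OPTIONS --safe #-}
module Submission where

-- Lower bound.  Multiply an arbitrary A by m - 1 diagonal matrices, all entries being taken from
-- the numbers 1 + i Q ≤ H with Q = (2 ^ k)!, a positive proportion of [1, H].  These have no prime
-- factor below 2 ^ k, so products x of them have at most x ^ (1/k) divisors.  Every diagonal entry
-- divides the product of the first row of the resulting matrix, and the matrix together with the
-- diagonals determines A; hence a product arises in only H ^ o(1) ways.
--
-- Upper bound.  For a finite set of primes p, let π be the proportion of singular matrices mod p,
-- 1/p ≤ π ≤ 2/p.  A uniform matrix is singular mod p with probability π, but a product of m ≥ 6
-- uniform matrices with probability 1 - (1 - π)ᵐ ≈ m π.  The function g = ∏ g_p, with g_p = 2 on
-- singular and g_p = (1 - π)² on regular matrices, has mean ∏ (1 - π + O(π²)) over uniform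
-- matrices, while 1/g has such a mean over products.  As Σ 1/p diverges both means become
-- arbitrarily small.  By Markov, few matrices X of size O(Hᵐ) have g(X) ≥ 1 and few m-tuples have
-- a product with g < 1; by the Chinese remainder theorem it suffices to count modulo each p.

-- The values 2 and (1 - π)² balance two demands. With value a on singular and (1 - π)^b on regular
-- matrices, the mean over uniform matrices is 1 - (b + 1 - a) π to first order, and the mean of the
-- inverse over products of m matrices is 1 - (m - m/a - b) π. For a = b = 2 the savings are π and
-- (m/2 - 2) π, and the latter reaches π at m = 6. Both means are needed because the box of height
-- (n H)^m holds, up to a constant factor, as many matrices as there are m-tuples: neither volume is
-- o(H^(m n²)), so each product has to be rare in one of the two counts. The volumes are bounded by
-- C H^(m n²) with C depending on m and n only; hence the saving K can be fixed first, then the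
-- primes, and H last. In the lower bound the entries of A are restricted like those of the
-- diagonals, because the divisors that matter are those of the product of a whole row, which must
-- be nonzero and free of small primes.

open import Defs
open import Data.Nat using (ℕ; zero; suc; _+_; _*_; _∸_; _^_; _≤_; _<_; z≤n; s≤s; z<s;  _/_; _%_; _!; _⊔_; ≢-nonZero⁻¹; >-nonZero; nonTrivial⇒n>1)
open import Data.Nat.Properties
open import Data.Nat.Divisibility using (_∣_; divides; _∣?_; ∣-trans; ∣⇒≤; m∣m*n; n∣m*n; ∣m+n∣m⇒∣n; ∣m⇒∣m*n; ∣n⇒∣m*n; ∣1⇒≡1; *-cancelʳ-∣; m≤n⇒m!∣n!)
open import Data.Nat.Primality using (Prime; prime?; euclidsLemma; prime⇒nonZero; prime⇒nonTrivial; ¬prime[1]; prime⇒irreducible)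
open import Data.Nat.Primality.Factorisation using (factorise)
open import Data.Nat.Coprimality using (Coprime; coprime-divisor)
open import Data.Nat.Induction using (<-wellFounded; Acc; acc)
open import Data.Nat.ListAction using (product)
open import Data.Nat.DivMod using (m/n*n≤m; m*n/n≡m; /-monoˡ-≤; m≡m%n+[m/n]*n; m%n<n)
open import Data.Nat.Tactic.RingSolver using (solve-∀)
open import Data.Integer as ℤ using (ℤ; -[1+_]; ∣_∣) renaming (+_ to pos)
import Data.Integer.Properties as ℤP
import Data.Integer.DivMod as ℤD
import Data.Integer.Divisibility.Signed as ℤ∣
import Data.Integer.Tactic.RingSolver as ℤR
open import Data.Fin using (Fin; zero; suc)
open import Data.Vec as Vec using (Vec; []; _∷_; lookup; tabulate; replicate; zipWith)
open import Data.Vec.Properties as VecP using (lookup∘tabulate; tabulate∘lookup; tabulate-∘; tabulate-cong; ∷-injective; ≡-dec)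
open import Data.Vec.Relation.Unary.All as VAll using ([]; _∷_) renaming (All to VecAll)
open import Data.Vec.Relation.Unary.Any using (here; there) renaming (Any to VecAny)
open import Data.Vec.Relation.Binary.Pointwise.Inductive as PW using (Pointwise; []; _∷_)
open import Data.List using (List; []; _∷_; _++_; map; concatMap; upTo; length; deduplicate; filter; take; cartesianProductWith)
open import Data.List.Properties using (length-map; length-++; length-upTo; length-take; take-all)
import Data.List.Properties as ListP
open import Data.List.Membership.Propositional using (_∈_; find; lose)
open import Data.List.Membership.Propositional.Properties
open import Data.List.Relation.Unary.Any as Any using (Any; here; there; any?)
open import Data.List.Relation.Unary.All as All using (All; []; _∷_)
import Data.Vec.Relation.Unary.All.Properties as VAllP
open import Data.List.Relation.Unary.AllPairs using ([]; _∷_)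
open import Data.List.Relation.Unary.Unique.Propositional using (Unique)
import Data.List.Relation.Unary.Unique.Propositional.Properties as UniqueP
import Data.List.Relation.Unary.Unique.DecPropositional.Properties as UniqueDP
open import Data.Product using (∃; ∃₂; _×_; _,_; proj₁; proj₂; map₂)
open import Data.Sum using (_⊎_; inj₁; inj₂; [_,_]′)
open import Data.Empty using (⊥-elim)
open import Function using (_∘_; id)
open import Relation.Nullary using (¬_; Dec; yes; no; contradiction; ¬?)
open import Relation.Nullary.Decidable using (_×-dec_)
open import Relation.Unary using (Decidable)
open import Relation.Binary using (DecidableEquality)
open import Relation.Binary.PropositionalEquality using (_≡_; _≢_; refl; sym; trans; cong; cong₂; subst; subst₂; module ≡-Reasoning)

-- Sums, products and counting over lists

private
  variable
    A B C : Set

^-distribʳ-* : ∀ e a b → (a * b) ^ e ≡ a ^ e * b ^ e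
^-distribʳ-* zero a b = refl
^-distribʳ-* (suc e) a b = trans (cong (a * b *_) (^-distribʳ-* e a b)) (shuffle a b _ _)
  where
  shuffle : ∀ a b c d → a * b * (c * d) ≡ a * c * (b * d)
  shuffle = solve-∀

∑ : List A → (A → ℕ) → ℕ
∑ [] f = 0
∑ (x ∷ xs) f = f x + ∑ xs f

∏ : List A → (A → ℕ) → ℕ
∏ [] f = 1
∏ (x ∷ xs) f = f x * ∏ xs f

∑-mono : ∀ (xs : List A) {f g : A → ℕ} → (∀ {x} → x ∈ xs → f x ≤ g x) → ∑ xs f ≤ ∑ xs g
∑-mono [] f≤g = z≤n
∑-mono (x ∷ xs) f≤g = +-mono-≤ (f≤g (here refl)) (∑-mono xs (f≤g ∘ there))

∑-cong : ∀ (xs : List A) {f g : A → ℕ} → (∀ {x} → x ∈ xs → f x ≡ g x) → ∑ xs f ≡ ∑ xs g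
∑-cong [] f≡g = refl
∑-cong (x ∷ xs) f≡g = cong₂ _+_ (f≡g (here refl)) (∑-cong xs (f≡g ∘ there))

∑-++ : ∀ (xs ys : List A) (f : A → ℕ) → ∑ (xs ++ ys) f ≡ ∑ xs f + ∑ ys f
∑-++ [] ys f = refl
∑-++ (x ∷ xs) ys f = trans (cong (f x +_) (∑-++ xs ys f)) (sym (+-assoc (f x) _ _))

∑-map : ∀ (h : A → B) xs (f : B → ℕ) → ∑ (map h xs) f ≡ ∑ xs (f ∘ h)
∑-map h [] f = refl
∑-map h (x ∷ xs) f = cong (f (h x) +_) (∑-map h xs f)

∑-concatMap : ∀ (h : A → List B) xs (f : B → ℕ) → ∑ (concatMap h xs) f ≡ ∑ xs (λ x → ∑ (h x) f)
∑-concatMap h [] f = refl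
∑-concatMap h (x ∷ xs) f =
  trans (∑-++ (h x) (concatMap h xs) f) (cong (∑ (h x) f +_) (∑-concatMap h xs f))

∑-pairs : ∀ (h : A → B → C) xs ys (f : C → ℕ) →
  ∑ (concatMap (λ x → map (h x) ys) xs) f ≡ ∑ xs (λ x → ∑ ys (λ y → f (h x y)))
∑-pairs h xs ys f =
  trans (∑-concatMap (λ x → map (h x) ys) xs f) (∑-cong xs (λ {x} _ → ∑-map (h x) ys f))

∑-*ˡ : ∀ c (xs : List A) (f : A → ℕ) → ∑ xs (λ x → c * f x) ≡ c * ∑ xs f
∑-*ˡ c [] f = sym (*-zeroʳ c)
∑-*ˡ c (x ∷ xs) f = trans (cong (c * f x +_) (∑-*ˡ c xs f)) (sym (*-distribˡ-+ c (f x) _))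

∑-*ʳ : ∀ c (xs : List A) (f : A → ℕ) → ∑ xs (λ x → f x * c) ≡ ∑ xs f * c
∑-*ʳ c [] f = refl
∑-*ʳ c (x ∷ xs) f = trans (cong (f x * c +_) (∑-*ʳ c xs f)) (sym (*-distribʳ-+ c (f x) _))

∑-+ : ∀ (xs : List A) (f g : A → ℕ) → ∑ xs (λ x → f x + g x) ≡ ∑ xs f + ∑ xs g
∑-+ [] f g = refl
∑-+ (x ∷ xs) f g = trans (cong (f x + g x +_) (∑-+ xs f g)) (shuffle (f x) (g x) _ _)
  where
  shuffle : ∀ a b c d → a + b + (c + d) ≡ a + c + (b + d)
  shuffle = solve-∀

∑-const : ∀ (xs : List A) c → ∑ xs (λ _ → c) ≡ length xs * c
∑-const [] c = refl
∑-const (x ∷ xs) c = cong (c +_) (∑-const xs c)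

∑-1 : ∀ (xs : List A) → ∑ xs (λ _ → 1) ≡ length xs
∑-1 xs = trans (∑-const xs 1) (*-identityʳ _)

∑-swap : ∀ (xs : List A) (ys : List B) (f : A → B → ℕ) →
  ∑ xs (λ x → ∑ ys (f x)) ≡ ∑ ys (λ y → ∑ xs (λ x → f x y))
∑-swap [] ys f = sym (trans (∑-const ys 0) (*-zeroʳ (length ys)))
∑-swap (x ∷ xs) ys f =
  trans (cong (∑ ys (f x) +_) (∑-swap xs ys f)) (sym (∑-+ ys (f x) _))

∑-∈ : ∀ {xs : List A} {x} (f : A → ℕ) → x ∈ xs → f x ≤ ∑ xs f
∑-∈ f (here refl) = m≤m+n _ _
∑-∈ f (there x∈xs) = ≤-trans (∑-∈ f x∈xs) (m≤n+m _ _)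

∏-mono : ∀ (xs : List A) {f g : A → ℕ} → (∀ {x} → x ∈ xs → f x ≤ g x) → ∏ xs f ≤ ∏ xs g
∏-mono [] f≤g = ≤-refl
∏-mono (x ∷ xs) f≤g = *-mono-≤ (f≤g (here refl)) (∏-mono xs (f≤g ∘ there))

∏-cong : ∀ (xs : List A) {f g : A → ℕ} → (∀ {x} → x ∈ xs → f x ≡ g x) → ∏ xs f ≡ ∏ xs g
∏-cong [] f≡g = refl
∏-cong (x ∷ xs) f≡g = cong₂ _*_ (f≡g (here refl)) (∏-cong xs (f≡g ∘ there))

∏-* : ∀ (xs : List A) (f g : A → ℕ) → ∏ xs (λ x → f x * g x) ≡ ∏ xs f * ∏ xs g
∏-* [] f g = refl
∏-* (x ∷ xs) f g = trans (cong (f x * g x *_) (∏-* xs f g)) (shuffle (f x) (g x) _ _)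
  where
  shuffle : ∀ a b c d → a * b * (c * d) ≡ a * c * (b * d)
  shuffle = solve-∀

∏-^ : ∀ (xs : List A) (f : A → ℕ) e → ∏ xs (λ x → f x ^ e) ≡ ∏ xs f ^ e
∏-^ [] f e = sym (^-zeroˡ e)
∏-^ (x ∷ xs) f e = trans (cong (f x ^ e *_) (∏-^ xs f e)) (sym (^-distribʳ-* e (f x) _))

∏-++ : ∀ (xs ys : List A) (f : A → ℕ) → ∏ (xs ++ ys) f ≡ ∏ xs f * ∏ ys f
∏-++ [] ys f = sym (+-identityʳ _)
∏-++ (x ∷ xs) ys f = trans (cong (f x *_) (∏-++ xs ys f)) (sym (*-assoc (f x) _ _))

∏-pos : ∀ (xs : List A) {f : A → ℕ} → (∀ {x} → x ∈ xs → 0 < f x) → 0 < ∏ xs f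
∏-pos [] 0<f = z<s
∏-pos (x ∷ xs) 0<f = *-mono-< (0<f (here refl)) (∏-pos xs (0<f ∘ there))

𝟙 : ∀ {P : Set} → Dec P → ℕ
𝟙 (yes _) = 1
𝟙 (no _) = 0

𝟙-mono : ∀ {P Q : Set} (P? : Dec P) (Q? : Dec Q) → (P → Q) → 𝟙 P? ≤ 𝟙 Q?
𝟙-mono (no _) _ P⇒Q = z≤n
𝟙-mono (yes p) (yes q) P⇒Q = ≤-refl
𝟙-mono (yes p) (no ¬q) P⇒Q = contradiction (P⇒Q p) ¬q

𝟙-cong : ∀ {P Q : Set} (P? : Dec P) (Q? : Dec Q) → (P → Q) → (Q → P) → 𝟙 P? ≡ 𝟙 Q?
𝟙-cong P? Q? P⇒Q Q⇒P = ≤-antisym (𝟙-mono P? Q? P⇒Q) (𝟙-mono Q? P? Q⇒P)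

𝟙-≤1 : ∀ {P : Set} (P? : Dec P) → 𝟙 P? ≤ 1
𝟙-≤1 (yes _) = ≤-refl
𝟙-≤1 (no _) = z≤n

𝟙-yes : ∀ {P : Set} (P? : Dec P) → P → 𝟙 P? ≡ 1
𝟙-yes (yes _) p = refl
𝟙-yes (no ¬p) p = contradiction p ¬p

# : ∀ {P : A → Set} → Decidable P → List A → ℕ
# P? xs = ∑ xs (λ x → 𝟙 (P? x))

length-filter-# : ∀ {P : A → Set} (P? : Decidable P) xs → length (filter P? xs) ≡ # P? xs
length-filter-# P? [] = refl
length-filter-# P? (x ∷ xs) with P? x
... | yes _ = cong suc (length-filter-# P? xs)
... | no _ = length-filter-# P? xs

-- Removing an occurrence by its position avoids decidable equality; `h` is arbitrary so that
-- lengths and weighted sums are both covered.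
remove : ∀ (h : A → ℕ) {ys : List A} {y} → y ∈ ys →
  ∃ λ ys′ → ∑ ys h ≡ h y + ∑ ys′ h × (∀ {z} → z ∈ ys → z ≢ y → z ∈ ys′)
remove h {_ ∷ ys} (here refl) =
  ys , refl , λ { (here z≡y) z≢y → contradiction z≡y z≢y ; (there z∈) _ → z∈ }
remove h {x ∷ ys} {y} (there y∈) with ys′ , split , keep ← remove h y∈ =
  x ∷ ys′ , trans (cong (h x +_) split) (shuffle (h x) (h y) _) ,
  λ { (here z≡x) _ → here z≡x ; (there z∈) z≢y → there (keep z∈ z≢y) }
  where
  shuffle : ∀ a b c → a + (b + c) ≡ b + (a + c)
  shuffle = solve-∀

remove-length : ∀ {ys : List A} {y} → y ∈ ys →
  ∃ λ ys′ → length ys ≡ suc (length ys′) × (∀ {z} → z ∈ ys → z ≢ y → z ∈ ys′)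
remove-length {ys = ys} y∈ with ys′ , split , keep ← remove (λ _ → 1) y∈ =
  ys′ , trans (sym (∑-1 ys)) (trans split (cong suc (∑-1 ys′))) , keep

-- Each image is struck off `ys` once used, and injectivity guarantees that the later images are
-- still there. The sieve needs the version with a weight `h`.
∑-injection : ∀ (f : A → B) (h : B → ℕ) {xs ys} → Unique xs →
  (∀ {x x′} → x ∈ xs → x′ ∈ xs → f x ≡ f x′ → x ≡ x′) →
  (∀ {x} → x ∈ xs → f x ∈ ys) → ∑ xs (h ∘ f) ≤ ∑ ys h
∑-injection f h {[]} _ _ _ = z≤n
∑-injection f h {x ∷ xs} {ys} (x≢ ∷ uniq) inj sub =
  let ys′ , split , keep = remove h (sub (here refl))
  in begin
    h (f x) + ∑ xs (h ∘ f)  ≤⟨ +-monoʳ-≤ (h (f x)) (∑-injection f h {ys = ys′} uniq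
                                 (λ p q → inj (there p) (there q))
                                 (λ x′∈ → keep (sub (there x′∈))
                                   (λ eq → All.lookup x≢ x′∈ (sym (inj (there x′∈) (here refl) eq))))) ⟩
    h (f x) + ∑ ys′ h       ≡⟨ split ⟨
    ∑ ys h                  ∎
  where open ≤-Reasoning

length-injection : ∀ (f : A → B) {xs ys} → Unique xs →
  (∀ {x x′} → x ∈ xs → x′ ∈ xs → f x ≡ f x′ → x ≡ x′) →
  (∀ {x} → x ∈ xs → f x ∈ ys) → length xs ≤ length ys
length-injection f {xs} {ys} uniq inj sub =
  subst₂ _≤_ (∑-1 xs) (∑-1 ys) (∑-injection f (λ _ → 1) uniq inj sub)

length-⊆ : ∀ {xs ys : List A} → Unique xs → (∀ {x} → x ∈ xs → x ∈ ys) → length xs ≤ length ys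
length-⊆ uniq = length-injection id uniq (λ _ _ → id)

pigeonhole : DecidableEquality B → ∀ (f : A → B) {xs ys} → Unique xs →
  (∀ {x} → x ∈ xs → f x ∈ ys) → length ys < length xs →
  ∃₂ λ x x′ → x ∈ xs × x′ ∈ xs × x ≢ x′ × f x ≡ f x′
pigeonhole _≟B_ f {x ∷ xs} {ys} (x≢ ∷ uniq) sub lt with any? (λ x′ → f x ≟B f x′) xs
... | yes coll =
  let x′ , x′∈ , eq = find coll in x , x′ , here refl , there x′∈ , All.lookup x≢ x′∈ , eq
... | no ¬coll =
  let ys′ , len , keep = remove-length (sub (here refl))
      y , y′ , y∈ , y′∈ , y≢y′ , eq = pigeonhole _≟B_ f {xs} {ys′} uniq
        (λ x′∈ → keep (sub (there x′∈)) (λ eq → ¬coll (lose x′∈ (sym eq))))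
        (≤-pred (subst (_< suc (length xs)) len lt))
  in y , y′ , there y∈ , there y′∈ , y≢y′ , eq

-- If `y` were missed, `f` would inject `xs` into a list that is shorter by one. This replaces
-- Bézout for inverses modulo p and determinants for regular matrices.
injective⇒surjective : DecidableEquality A → ∀ (f : A → A) {xs} → Unique xs →
  (∀ {x x′} → x ∈ xs → x′ ∈ xs → f x ≡ f x′ → x ≡ x′) →
  (∀ {x} → x ∈ xs → f x ∈ xs) → ∀ {y} → y ∈ xs → ∃ λ x → x ∈ xs × f x ≡ y
injective⇒surjective _≟A_ f {xs} uniq inj sub {y} y∈ with any? (λ x → f x ≟A y) xs
... | yes hit = find hit
... | no miss =
  let xs′ , len , keep = remove-length y∈
  in contradiction
    (length-injection f uniq inj (λ x∈ → keep (sub x∈) (λ eq → miss (lose x∈ eq))))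
    (<⇒≱ (≤-reflexive (sym len)))

concatMap-map : ∀ (f : A → B → C) xs ys →
  concatMap (λ x → map (f x) ys) xs ≡ cartesianProductWith f xs ys
concatMap-map f [] ys = refl
concatMap-map f (x ∷ xs) ys = cong (map (f x) ys ++_) (concatMap-map f xs ys)

∈-pairs⁺ : ∀ (f : A → B → C) {xs ys x y} → x ∈ xs → y ∈ ys →
  f x y ∈ concatMap (λ x → map (f x) ys) xs
∈-pairs⁺ f {xs} {ys} x∈ y∈ =
  subst (f _ _ ∈_) (sym (concatMap-map f xs ys)) (∈-cartesianProductWith⁺ f x∈ y∈)

∈-pairs⁻ : ∀ (f : A → B → C) xs ys {z} → z ∈ concatMap (λ x → map (f x) ys) xs →
  ∃₂ λ x y → x ∈ xs × y ∈ ys × z ≡ f x y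
∈-pairs⁻ f xs ys {z} z∈ =
  ∈-cartesianProductWith⁻ f xs ys (subst (z ∈_) (concatMap-map f xs ys) z∈)

length-pairs : ∀ (f : A → B → C) xs ys →
  length (concatMap (λ x → map (f x) ys) xs) ≡ length xs * length ys
length-pairs f xs ys = begin
  length (concatMap (λ x → map (f x) ys) xs)       ≡⟨ ∑-1 (concatMap (λ x → map (f x) ys) xs) ⟨
  ∑ (concatMap (λ x → map (f x) ys) xs) (λ _ → 1)  ≡⟨ ∑-pairs f xs ys _ ⟩
  ∑ xs (λ _ → ∑ ys (λ _ → 1))                      ≡⟨ ∑-const xs _ ⟩
  length xs * ∑ ys (λ _ → 1)                       ≡⟨ cong (length xs *_) (∑-1 ys) ⟩
  length xs * length ys                            ∎
  where open ≡-Reasoning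

∑-allVecs : ∀ n (xs : List A) (f : Vec A (suc n) → ℕ) →
  ∑ (allVecs (suc n) xs) f ≡ ∑ xs (λ x → ∑ (allVecs n xs) (λ v → f (x ∷ v)))
∑-allVecs n xs f = ∑-pairs _∷_ xs (allVecs n xs) f

length-allVecs : ∀ n (xs : List A) → length (allVecs n xs) ≡ length xs ^ n
length-allVecs zero xs = refl
length-allVecs (suc n) xs =
  trans (length-pairs _∷_ xs (allVecs n xs)) (cong (length xs *_) (length-allVecs n xs))

∈-allVecs⁺ : ∀ {n} {xs : List A} {v : Vec A n} → VecAll (_∈ xs) v → v ∈ allVecs n xs
∈-allVecs⁺ [] = here refl
∈-allVecs⁺ (x∈ ∷ v∈) = ∈-pairs⁺ _∷_ x∈ (∈-allVecs⁺ v∈)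

∈-allVecs⁻ : ∀ {n} {xs : List A} {v : Vec A n} → v ∈ allVecs n xs → VecAll (_∈ xs) v
∈-allVecs⁻ {v = []} _ = []
∈-allVecs⁻ {n = suc n} {xs = xs} {v = x ∷ v} v∈
  with _ , _ , x∈ , v′∈ , refl ← ∈-pairs⁻ _∷_ xs (allVecs n xs) v∈ = x∈ ∷ ∈-allVecs⁻ v′∈

allVecs-unique : ∀ n {xs : List A} → Unique xs → Unique (allVecs n xs)
allVecs-unique zero uniq = [] ∷ []
allVecs-unique (suc n) {xs} uniq =
  subst Unique (sym (concatMap-map _∷_ xs (allVecs n xs)))
    (UniqueP.cartesianProductWith⁺ _∷_ ∷-injective uniq (allVecs-unique n uniq))

-- Divergence of the sum of the reciprocals of the primes

primeDivisor : ∀ {x} → 1 < x → ∃ λ p → Prime p × p ∣ x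
primeDivisor {x@(suc _)} 1<x with factorise x
... | record { factors = []    ; isFactorisation = eq } = contradiction (sym eq) (<⇒≢ 1<x)
... | record { factors = p ∷ ps ; isFactorisation = eq ; factorsPrime = isPrime ∷ _ } =
  p , isPrime , divides (product ps) (trans eq (*-comm p (product ps)))

prime-pos : ∀ {p} → Prime p → 0 < p
prime-pos isPrime = n≢0⇒n>0 (≢-nonZero⁻¹ _ {{prime⇒nonZero isPrime}})

Smooth : ℕ → ℕ → Set
Smooth k x = ∀ {p} → Prime p → p ∣ x → p ≤ k

smooth-pred : ∀ {k x} → ¬ (Prime (suc k) × suc k ∣ x) → Smooth (suc k) x → Smooth k x
smooth-pred ¬top smooth {p} isPrime p∣x with m≤n⇒m<n∨m≡n (smooth isPrime p∣x)
... | inj₁ p<1+k = ≤-pred p<1+k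
... | inj₂ refl = contradiction (isPrime , p∣x) ¬top

subsetProducts : ℕ → List ℕ
subsetProducts zero = 1 ∷ []
subsetProducts (suc k) = subsetProducts k ++ map (suc k *_) (subsetProducts k)

length-subsetProducts : ∀ k → length (subsetProducts k) ≡ 2 ^ k
length-subsetProducts zero = refl
length-subsetProducts (suc k) = begin
  length (subsetProducts k ++ map (suc k *_) (subsetProducts k))         ≡⟨ length-++ (subsetProducts k) ⟩
  length (subsetProducts k) + length (map (suc k *_) (subsetProducts k)) ≡⟨ cong₂ _+_ (length-subsetProducts k)
                                                                              (trans (length-map _ (subsetProducts k)) (length-subsetProducts k)) ⟩
  2 ^ k + 2 ^ k                                                          ≡⟨ cong (2 ^ k +_) (+-identityʳ (2 ^ k)) ⟨
  2 ^ suc k                                                              ∎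
  where open ≡-Reasoning

factor-pos : ∀ {a b} → 0 < a * b → 0 < a
factor-pos {suc a} _ = z<s

-- Strip `suc k` from `x` when it is prime: a square of it moves into `b`, a single factor into `a`,
-- and what remains is `k`-smooth. Removing squares may repeat, hence the well-founded recursion
-- inside the induction on `k`.
smooth⇒subset*square : ∀ k x → 0 < x → Smooth k x →
  ∃₂ λ a b → a ∈ subsetProducts k × x ≡ a * (b * b)
smooth⇒subset*square zero x 0<x smooth with m≤n⇒m<n∨m≡n 0<x
... | inj₂ refl = 1 , 1 , here refl , refl
... | inj₁ 1<x =
  let p , isPrime , p∣x = primeDivisor 1<x
  in contradiction (smooth isPrime p∣x) (<⇒≱ (prime-pos isPrime))
smooth⇒subset*square (suc k) x 0<x smooth = go x (<-wellFounded x) 0<x smooth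
  where
  q = suc k
  descend : ∀ {x} → 0 < x → Smooth q x → ¬ (Prime q × q ∣ x) →
    ∃₂ λ a b → a ∈ subsetProducts k × x ≡ a * (b * b)
  descend 0<x smooth ¬top = smooth⇒subset*square k _ 0<x (smooth-pred ¬top smooth)

  rearrange₁ : ∀ a b q → a * (b * b) * q * q ≡ a * (q * b * (q * b))
  rearrange₁ = solve-∀
  rearrange₂ : ∀ a b q → a * (b * b) * q ≡ q * a * (b * b)
  rearrange₂ = solve-∀

  go : ∀ x → Acc _<_ x → 0 < x → Smooth q x → ∃₂ λ a b → a ∈ subsetProducts q × x ≡ a * (b * b)
  go x (acc rec) 0<x smooth with prime? q
  ... | no ¬prime =
    let a , b , a∈ , eq = descend 0<x smooth (¬prime ∘ proj₁) in a , b , ∈-++⁺ˡ a∈ , eq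
  ... | yes isPrime with q ∣? x
  ...   | no ¬q∣x =
    let a , b , a∈ , eq = descend 0<x smooth (¬q∣x ∘ proj₂) in a , b , ∈-++⁺ˡ a∈ , eq
  ...   | yes (divides y refl) with q ∣? y
  ...     | no ¬q∣y =
    let a , b , a∈ , eq = descend {y} (factor-pos 0<x) (λ pr p∣y → smooth pr (∣m⇒∣m*n q p∣y)) (¬q∣y ∘ proj₂)
    in q * a , b , ∈-++⁺ʳ (subsetProducts k) (∈-map⁺ (q *_) a∈) ,
       trans (cong (_* q) eq) (rearrange₂ a b q)
  ...     | yes (divides z refl) =
    let 0<z = factor-pos {z} (factor-pos {z * q} 0<x)
        1<q = nonTrivial⇒n>1 q {{prime⇒nonTrivial isPrime}}
        z<x = ≤-trans (m<m*n z q {{>-nonZero 0<z}} 1<q) (m≤m*n (z * q) q)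
        a , b , a∈ , eq = go z (rec z<x) 0<z (λ pr p∣z → smooth pr (∣m⇒∣m*n q (∣m⇒∣m*n q p∣z)))
    in a , q * b , a∈ , trans (cong (λ t → t * q * q) eq) (rearrange₁ a b q)

-- With junk value 0 at divisor 0.
_÷_ : ℕ → ℕ → ℕ
N ÷ zero = 0
N ÷ suc p = N / suc p

÷-*-≤ : ∀ N p → (N ÷ p) * p ≤ N
÷-*-≤ N zero = z≤n
÷-*-≤ N (suc p) = m/n*n≤m N (suc p)

≤-÷ : ∀ {j N p} → 0 < p → j * p ≤ N → j ≤ N ÷ p
≤-÷ {j} {N} {suc p} _ le = subst (_≤ N / suc p) (m*n/n≡m j (suc p)) (/-monoˡ-≤ (suc p) le)

[1⋯_] : ℕ → List ℕ
[1⋯ N ] = map suc (upTo N)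

∈-[1⋯]⁺ : ∀ {N x} → 0 < x → x ≤ N → x ∈ [1⋯ N ]
∈-[1⋯]⁺ {x = suc x} _ x<N = ∈-map⁺ suc (∈-upTo⁺ x<N)

∈-[1⋯]⁻ : ∀ {N x} → x ∈ [1⋯ N ] → 0 < x × x ≤ N
∈-[1⋯]⁻ x∈ with y , y∈ , refl ← ∈-map⁻ suc x∈ = z<s , ∈-upTo⁻ y∈

length-[1⋯] : ∀ N → length [1⋯ N ] ≡ N
length-[1⋯] N = trans (length-map suc (upTo N)) (length-upTo N)

[1⋯]-unique : ∀ N → Unique [1⋯ N ]
[1⋯]-unique N = UniqueP.map⁺ suc-injective (UniqueP.upTo⁺ N)

blockPrime? : ∀ k → Decidable (λ p → Prime p × k < p)
blockPrime? k p = prime? p ×-dec (k <? p)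

block : ℕ → List ℕ
block k = filter (blockPrime? k) [1⋯ 4 ^ suc k ]

4^n≡2^n*2^n : ∀ n → 4 ^ n ≡ 2 ^ n * 2 ^ n
4^n≡2^n*2^n n = ^-distribʳ-* n 2 2

-- Erdős: up to N = 4 ^ suc k at most 2 ^ k * 2 ^ suc k = N / 2 numbers have all their prime
-- factors ≤ k, being the product of a squarefree number and a square.
erdős : ∀ k → let N = 4 ^ suc k in N ≤ 2 * ∑ (block k) (N ÷_)
erdős k = +-cancelˡ-≤ N _ _ (begin
    N + N                                     ≡⟨ cong (N +_) (+-identityʳ N) ⟨
    2 * N                                     ≤⟨ *-monoʳ-≤ 2 cover ⟩
    2 * (2 ^ k * 2 ^ suc k + s)               ≡⟨ *-distribˡ-+ 2 (2 ^ k * 2 ^ suc k) s ⟩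
    2 * (2 ^ k * 2 ^ suc k) + 2 * s           ≡⟨ cong (_+ 2 * s) (*-assoc 2 (2 ^ k) (2 ^ suc k)) ⟨
    2 ^ suc k * 2 ^ suc k + 2 * s             ≡⟨ cong (_+ 2 * s) (4^n≡2^n*2^n (suc k)) ⟨
    N + 2 * s                                 ∎)
  where
  open ≤-Reasoning
  N = 4 ^ suc k
  s = ∑ (block k) (N ÷_)

  smooths multiples : List ℕ
  smooths = concatMap (λ a → map (λ b → a * (b * b)) [1⋯ 2 ^ suc k ]) (subsetProducts k)
  multiples = concatMap (λ p → map (_* p) [1⋯ N ÷ p ]) (block k)

  length-multiples : ∀ ps → length (concatMap (λ p → map (_* p) [1⋯ N ÷ p ]) ps) ≡ ∑ ps (N ÷_)
  length-multiples [] = refl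
  length-multiples (p ∷ ps) =
    trans (length-++ (map (_* p) [1⋯ N ÷ p ])) (cong₂ _+_
      (trans (length-map (_* p) [1⋯ N ÷ p ]) (length-[1⋯] (N ÷ p))) (length-multiples ps))

  covered : ∀ {x} → x ∈ [1⋯ N ] → x ∈ smooths ++ multiples
  covered {x} x∈ with ∈-[1⋯]⁻ x∈ | any? (_∣? x) (block k)
  ... | 0<x , x≤N | yes hit with find hit
  ...   | p , p∈ , divides j refl = ∈-++⁺ʳ smooths (∈-concatMap⁺ _ (lose p∈ (∈-map⁺ (_* p) {x = j}
          (∈-[1⋯]⁺ (factor-pos {j} 0<x)
            (≤-÷ (prime-pos (proj₁ (proj₂ (∈-filter⁻ (blockPrime? k) {xs = [1⋯ N ]} p∈)))) x≤N)))))
  covered {x} x∈ | 0<x , x≤N | no miss =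
    let a , b , a∈ , eq = smooth⇒subset*square k x 0<x smooth
        0<ab² = subst (0 <_) eq 0<x
        0<b² = factor-pos {b * b} {a} (subst (0 <_) (*-comm a (b * b)) 0<ab²)
        b²≤N = ≤-trans (m≤n*m (b * b) a {{>-nonZero (factor-pos {a} 0<ab²)}}) (subst (_≤ N) eq x≤N)
    in ∈-++⁺ˡ (subst (_∈ smooths) (sym eq)
         (∈-pairs⁺ (λ a b → a * (b * b)) a∈ (∈-[1⋯]⁺ (factor-pos {b} 0<b²) (root b b²≤N))))
    where
    smooth : Smooth k x
    smooth {p} isPrime p∣x with p ≤? k
    ... | yes p≤k = p≤k
    ... | no p≰k = contradiction
      (lose (∈-filter⁺ (blockPrime? k)
              (∈-[1⋯]⁺ (prime-pos isPrime) (≤-trans (∣⇒≤ {{>-nonZero 0<x}} p∣x) x≤N))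
              (isPrime , ≰⇒> p≰k)) p∣x)
      miss
    root : ∀ b → b * b ≤ N → b ≤ 2 ^ suc k
    root b le with b ≤? 2 ^ suc k
    ... | yes b≤ = b≤
    ... | no b≰ = contradiction le (<⇒≱ (subst (_< b * b) (sym (4^n≡2^n*2^n (suc k)))
                    (*-mono-< (≰⇒> b≰) (≰⇒> b≰))))

  cover : N ≤ 2 ^ k * 2 ^ suc k + s
  cover = begin
    N                                    ≡⟨ length-[1⋯] N ⟨
    length [1⋯ N ]                       ≤⟨ length-⊆ ([1⋯]-unique N) covered ⟩
    length (smooths ++ multiples)        ≡⟨ length-++ smooths ⟩
    length smooths + length multiples    ≡⟨ cong₂ _+_
      (trans (length-pairs (λ a b → a * (b * b)) (subsetProducts k) [1⋯ 2 ^ suc k ])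
             (cong₂ _*_ (length-subsetProducts k) (length-[1⋯] (2 ^ suc k))))
      (length-multiples (block k)) ⟩
    2 ^ k * 2 ^ suc k + s                ∎

-- Divided out, this is ∏ (1 - 1/(4p)) · (1 + ∑ f p / (4N)) ≤ 1. Each prime is handled by (1 - x)(1
-- + u + x′) ≤ 1 + u for x′ ≤ x, with x = 1/(4p) and x′ = f p / (4N).
∏-4p-1 : ∀ N ps (f : ℕ → ℕ) → (∀ p → f p * p ≤ N) →
  ∏ ps (λ p → 4 * p ∸ 1) * (4 * N + ∑ ps f) ≤ ∏ ps (4 *_) * (4 * N)
∏-4p-1 N [] f f≤ = ≤-reflexive (cong (1 *_) (+-identityʳ (4 * N)))
∏-4p-1 N (p ∷ ps) f f≤ = begin
  (4 * p ∸ 1) * P * (4 * N + (f p + s))    ≡⟨ shuffle₁ (4 * p ∸ 1) P (4 * N) (f p) s ⟩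
  P * ((4 * p ∸ 1) * (4 * N + s + f p))    ≤⟨ *-monoʳ-≤ P (step (4 * p) refl) ⟩
  P * (4 * p * (4 * N + s))                ≡⟨ shuffle₂ P (4 * p) (4 * N + s) ⟩
  4 * p * (P * (4 * N + s))                ≤⟨ *-monoʳ-≤ (4 * p) (∏-4p-1 N ps f f≤) ⟩
  4 * p * (∏ ps (4 *_) * (4 * N))          ≡⟨ *-assoc (4 * p) (∏ ps (4 *_)) (4 * N) ⟨
  4 * p * ∏ ps (4 *_) * (4 * N)            ∎
  where
  open ≤-Reasoning
  P = ∏ ps (λ p → 4 * p ∸ 1)
  s = ∑ ps f
  shuffle₁ : ∀ c P M a s → c * P * (M + (a + s)) ≡ P * (c * (M + s + a))
  shuffle₁ = solve-∀
  shuffle₂ : ∀ P c M → P * (c * M) ≡ c * (P * M)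
  shuffle₂ = solve-∀
  step : ∀ d → d ≡ 4 * p → (d ∸ 1) * (4 * N + s + f p) ≤ d * (4 * N + s)
  step zero _ = z≤n
  step (suc c) eq = begin
    c * (4 * N + s + f p)           ≡⟨ *-distribˡ-+ c (4 * N + s) (f p) ⟩
    c * (4 * N + s) + c * f p       ≤⟨ +-monoʳ-≤ (c * (4 * N + s)) (begin
      c * f p                         ≤⟨ *-monoˡ-≤ (f p) (n≤1+n c) ⟩
      suc c * f p                     ≡⟨ cong (_* f p) eq ⟩
      4 * p * f p                     ≡⟨ *-assoc 4 p (f p) ⟩
      4 * (p * f p)                   ≡⟨ cong (4 *_) (*-comm p (f p)) ⟩
      4 * (f p * p)                   ≤⟨ *-monoʳ-≤ 4 (f≤ p) ⟩
      4 * N                           ≤⟨ m≤m+n (4 * N) s ⟩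
      4 * N + s                       ∎) ⟩
    c * (4 * N + s) + (4 * N + s)   ≡⟨ +-comm (c * (4 * N + s)) (4 * N + s) ⟩
    suc c * (4 * N + s)             ∎

-- By `erdős` the sum over the block is at least N/2, so its product of 1 - 1/(4p) is at most 4N /
-- (4N + N/2) = 8/9.
block-∏ : ∀ k → 9 * ∏ (block k) (λ p → 4 * p ∸ 1) ≤ 8 * ∏ (block k) (4 *_)
block-∏ k = *-cancelʳ-≤ (9 * P) (8 * P′) N {{>-nonZero (m^n>0 4 (suc k))}} (begin
  9 * P * N                     ≡⟨ shuffle₁ P N ⟩
  P * (8 * N + N)               ≤⟨ *-monoʳ-≤ P (+-monoʳ-≤ (8 * N) (erdős k)) ⟩
  P * (8 * N + 2 * s)           ≡⟨ shuffle₂ P N s ⟩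
  2 * (P * (4 * N + s))         ≤⟨ *-monoʳ-≤ 2 (∏-4p-1 N (block k) (N ÷_) (÷-*-≤ N)) ⟩
  2 * (P′ * (4 * N))            ≡⟨ shuffle₃ P′ N ⟩
  8 * P′ * N                    ∎)
  where
  open ≤-Reasoning
  N = 4 ^ suc k
  P = ∏ (block k) (λ p → 4 * p ∸ 1)
  P′ = ∏ (block k) (4 *_)
  s = ∑ (block k) (N ÷_)
  shuffle₁ : ∀ P N → 9 * P * N ≡ P * (8 * N + N)
  shuffle₁ = solve-∀
  shuffle₂ : ∀ P N s → P * (8 * N + 2 * s) ≡ 2 * (P * (4 * N + s))
  shuffle₂ = solve-∀
  shuffle₃ : ∀ P N → 2 * (P * (4 * N)) ≡ 8 * P * N
  shuffle₃ = solve-∀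

-- `block L` ends at 4 ^ suc L and the other blocks use primes beyond that point, so they are
-- disjoint and the factors 8/9 multiply.
blocks : ∀ j L → ∃ λ ps → Unique ps × (∀ {p} → p ∈ ps → Prime p × L < p) ×
  9 ^ j * ∏ ps (λ p → 4 * p ∸ 1) ≤ 8 ^ j * ∏ ps (4 *_)
blocks zero L = [] , [] , (λ ()) , ≤-refl
blocks (suc j) L with ps , uniq , big , le ← blocks j (4 ^ suc L) =
  block L ++ ps ,
  UniqueP.++⁺ (UniqueP.filter⁺ (blockPrime? L) ([1⋯]-unique (4 ^ suc L))) uniq
    (λ (p∈block , p∈ps) → <⇒≱ (proj₂ (big p∈ps)) (block-≤ p∈block)) ,
  (λ p∈ → [ (λ p∈block → proj₂ (∈-filter⁻ (blockPrime? L) {xs = [1⋯ 4 ^ suc L ]} p∈block))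
          , (λ p∈ps → map₂ (<-trans L<) (big p∈ps)) ]′ (∈-++⁻ (block L) p∈)) ,
  (begin
    9 ^ suc j * ∏ (block L ++ ps) (λ p → 4 * p ∸ 1)      ≡⟨ cong (9 ^ suc j *_) (∏-++ (block L) ps _) ⟩
    9 ^ suc j * (∏ (block L) (λ p → 4 * p ∸ 1) * P)      ≡⟨ shuffle 9 (9 ^ j) (∏ (block L) (λ p → 4 * p ∸ 1)) P ⟩
    9 * ∏ (block L) (λ p → 4 * p ∸ 1) * (9 ^ j * P)      ≤⟨ *-mono-≤ (block-∏ L) le ⟩
    8 * ∏ (block L) (4 *_) * (8 ^ j * ∏ ps (4 *_))       ≡⟨ shuffle 8 (8 ^ j) (∏ (block L) (4 *_)) (∏ ps (4 *_)) ⟨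
    8 ^ suc j * (∏ (block L) (4 *_) * ∏ ps (4 *_))       ≡⟨ cong (8 ^ suc j *_) (∏-++ (block L) ps _) ⟨
    8 ^ suc j * ∏ (block L ++ ps) (4 *_)                 ∎)
  where
  open ≤-Reasoning
  P = ∏ ps (λ p → 4 * p ∸ 1)
  shuffle : ∀ c d a b → c * d * (a * b) ≡ c * a * (d * b)
  shuffle = solve-∀
  block-≤ : ∀ {p} → p ∈ block L → p ≤ 4 ^ suc L
  block-≤ p∈ = proj₂ (∈-[1⋯]⁻ (proj₁ (∈-filter⁻ (blockPrime? L) p∈)))
  n<4^n : ∀ n → n < 4 ^ n
  n<4^n zero = z<s
  n<4^n (suc n) = ≤-trans (+-monoˡ-≤ (suc n) (m^n>0 4 n)) (+-mono-≤ (≤-refl {4 ^ n})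
    (≤-trans (n<4^n n) (m≤m+n (4 ^ n) _)))
  L< : L < 4 ^ suc L
  L< = <-trans (n<1+n L) (n<4^n (suc L))

-- Bernoulli's inequality for (1 + 1/8) ^ j. At j = 8 K it shows that 8 K blocks together save a
-- factor K.
bernoulli : ∀ j → 8 ^ j * (8 + j) ≤ 8 * 9 ^ j
bernoulli zero = ≤-refl
bernoulli (suc j) = begin
  8 * 8 ^ j * (8 + suc j)           ≤⟨ m≤m+n _ (8 ^ j * j) ⟩
  8 * 8 ^ j * (8 + suc j) + 8 ^ j * j ≡⟨ shuffle₁ (8 ^ j) j ⟩
  9 * (8 ^ j * (8 + j))             ≤⟨ *-monoʳ-≤ 9 (bernoulli j) ⟩
  9 * (8 * 9 ^ j)                   ≡⟨ shuffle₂ (9 ^ j) ⟩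
  8 * (9 * 9 ^ j)                   ∎
  where
  open ≤-Reasoning
  shuffle₁ : ∀ a j → 8 * a * (8 + suc j) + a * j ≡ 9 * (a * (8 + j))
  shuffle₁ = solve-∀
  shuffle₂ : ∀ a → 9 * (8 * a) ≡ 8 * (9 * a)
  shuffle₂ = solve-∀

-- A form of Σ 1/p = ∞.
manyPrimes : ∀ K L → ∃ λ ps → Unique ps × (∀ {p} → p ∈ ps → Prime p × L < p) ×
  K * ∏ ps (λ p → 4 * p ∸ 1) ≤ ∏ ps (4 *_)
manyPrimes K L with ps , uniq , big , le ← blocks (8 * K) L =
  ps , uniq , big , *-cancelˡ-≤ (8 ^ (8 * K)) {{>-nonZero (m^n>0 8 (8 * K))}} (begin
    8 ^ (8 * K) * (K * P)         ≡⟨ *-assoc (8 ^ (8 * K)) K P ⟨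
    8 ^ (8 * K) * K * P           ≤⟨ *-monoˡ-≤ P K8≤9 ⟩
    9 ^ (8 * K) * P               ≤⟨ le ⟩
    8 ^ (8 * K) * ∏ ps (4 *_)     ∎)
  where
  open ≤-Reasoning
  P = ∏ ps (λ p → 4 * p ∸ 1)
  shuffle : ∀ a K → 8 * (a * K) ≡ a * (8 * K)
  shuffle = solve-∀
  K8≤9 : 8 ^ (8 * K) * K ≤ 9 ^ (8 * K)
  K8≤9 = *-cancelˡ-≤ 8 (begin
    8 * (8 ^ (8 * K) * K)         ≡⟨ shuffle (8 ^ (8 * K)) K ⟩
    8 ^ (8 * K) * (8 * K)         ≤⟨ *-monoʳ-≤ (8 ^ (8 * K)) (m≤n+m (8 * K) 8) ⟩
    8 ^ (8 * K) * (8 + 8 * K)     ≤⟨ bernoulli (8 * K) ⟩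
    8 * 9 ^ (8 * K)               ∎)

-- Arithmetic and linear algebra modulo p

infix 4 _∣ᶻ_

_∣ᶻ_ : ℕ → ℤ → Set
p ∣ᶻ x = pos p ℤ∣.∣ x

_∣ᶻ?_ : ∀ p x → Dec (p ∣ᶻ x)
p ∣ᶻ? x = pos p ℤ∣.∣? x

∣ᶻ-0 : ∀ p → p ∣ᶻ pos 0
∣ᶻ-0 p = ℤ∣.divides (pos 0) refl

∣ᶻ-resp : ∀ {p x y} → x ≡ y → p ∣ᶻ x → p ∣ᶻ y
∣ᶻ-resp refl p∣x = p∣x

∣ᶻ-small : ∀ {p z} → p ∣ᶻ z → ∣ z ∣ < p → z ≡ pos 0
∣ᶻ-small {p} {z} p∣z z<p with ∣ z ∣ in eq | ℤ∣.∣⇒∣ᵤ p∣z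
... | zero | _ = ℤP.∣i∣≡0⇒i≡0 eq
... | suc a | p∣a = contradiction (∣⇒≤ p∣a) (<⇒≱ z<p)

euclidᶻ : ∀ {p} → Prime p → ∀ x y → p ∣ᶻ x ℤ.* y → p ∣ᶻ x ⊎ p ∣ᶻ y
euclidᶻ {p} isPrime x y p∣xy
  with euclidsLemma ∣ x ∣ ∣ y ∣ isPrime (subst (p ∣_) (ℤP.abs-* x y) (ℤ∣.∣⇒∣ᵤ p∣xy))
... | inj₁ p∣x = inj₁ (ℤ∣.∣ᵤ⇒∣ p∣x)
... | inj₂ p∣y = inj₂ (ℤ∣.∣ᵤ⇒∣ p∣y)

infix 4 _≈[_]_ _≋[_]_

_≈[_]_ : ℤ → ℕ → ℤ → Set
x ≈[ p ] y = p ∣ᶻ (x ℤ.- y)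

≈-refl : ∀ {p} x → x ≈[ p ] x
≈-refl {p} x = ∣ᶻ-resp (sym (ℤP.+-inverseʳ x)) (∣ᶻ-0 p)

≈-sym : ∀ {p} x y → x ≈[ p ] y → y ≈[ p ] x
≈-sym x y p∣ = ∣ᶻ-resp (flip-sub x y) (ℤ∣.∣m⇒∣-m p∣)
  where
  flip-sub : ∀ x y → ℤ.- (x ℤ.- y) ≡ y ℤ.- x
  flip-sub = ℤR.solve-∀

≈-trans : ∀ {p} x y z → x ≈[ p ] y → y ≈[ p ] z → x ≈[ p ] z
≈-trans x y z p∣ p∣′ = ∣ᶻ-resp (telescope x y z) (ℤ∣.∣m∣n⇒∣m+n p∣ p∣′)
  where
  telescope : ∀ x y z → (x ℤ.- y) ℤ.+ (y ℤ.- z) ≡ x ℤ.- z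
  telescope = ℤR.solve-∀

≈-+ : ∀ {p} x x′ y y′ → x ≈[ p ] x′ → y ≈[ p ] y′ → x ℤ.+ y ≈[ p ] x′ ℤ.+ y′
≈-+ x x′ y y′ p∣ p∣′ = ∣ᶻ-resp (regroup x x′ y y′) (ℤ∣.∣m∣n⇒∣m+n p∣ p∣′)
  where
  regroup : ∀ x x′ y y′ → (x ℤ.- x′) ℤ.+ (y ℤ.- y′) ≡ (x ℤ.+ y) ℤ.- (x′ ℤ.+ y′)
  regroup = ℤR.solve-∀

≈-* : ∀ {p} x x′ y y′ → x ≈[ p ] x′ → y ≈[ p ] y′ → x ℤ.* y ≈[ p ] x′ ℤ.* y′
≈-* x x′ y y′ p∣ p∣′ =
  ∣ᶻ-resp (regroup x x′ y y′) (ℤ∣.∣m∣n⇒∣m+n (ℤ∣.∣n⇒∣m*n x p∣′) (ℤ∣.∣m⇒∣m*n y′ p∣))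
  where
  regroup : ∀ x x′ y y′ → x ℤ.* (y ℤ.- y′) ℤ.+ (x ℤ.- x′) ℤ.* y′ ≡ x ℤ.* y ℤ.- x′ ℤ.* y′
  regroup = ℤR.solve-∀

∣ᶻ-≈ : ∀ {p} x y → x ≈[ p ] y → p ∣ᶻ x → p ∣ᶻ y
∣ᶻ-≈ x y p∣x-y p∣x = ∣ᶻ-resp (cancel x y) (ℤ∣.∣m∣n⇒∣m-n p∣x p∣x-y)
  where
  cancel : ∀ x y → x ℤ.- (x ℤ.- y) ≡ y
  cancel = ℤR.solve-∀

-- At modulus 0 the residue is the number itself and the quotient is 0.
rem : ℕ → ℤ → ℤ
rem zero x = x
rem (suc p) x = pos (x ℤD.%ℕ suc p)

quo : ℕ → ℤ → ℤ
quo zero x = pos 0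
quo (suc p) x = x ℤD./ℕ suc p

rem+quo : ∀ p x → x ≡ rem p x ℤ.+ quo p x ℤ.* pos p
rem+quo zero x = sym (ℤP.+-identityʳ x)
rem+quo (suc p) x = ℤD.a≡a%ℕn+[a/ℕn]*n x (suc p)

rem-≈ : ∀ p x → x ≈[ p ] rem p x
rem-≈ p x = ℤ∣.divides (quo p x)
  (trans (cong (ℤ._- rem p x) (rem+quo p x)) (cancel (rem p x) (quo p x ℤ.* pos p)))
  where
  cancel : ∀ r t → (r ℤ.+ t) ℤ.- r ≡ t
  cancel = ℤR.solve-∀

rem-≡⇒≈ : ∀ {p} x y → rem p x ≡ rem p y → x ≈[ p ] y
rem-≡⇒≈ {p} x y eq = ≈-trans x (rem p x) y (rem-≈ p x)
  (subst (_≈[ p ] y) (sym eq) (≈-sym y (rem p y) (rem-≈ p y)))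

residues : ℕ → List ℤ
residues p = map pos (upTo p)

residues-unique : ∀ p → Unique (residues p)
residues-unique p = UniqueP.map⁺ ℤP.+-injective (UniqueP.upTo⁺ p)

length-residues : ∀ p → length (residues p) ≡ p
length-residues p = trans (length-map pos (upTo p)) (length-upTo p)

rem∈residues : ∀ {p} → 0 < p → ∀ x → rem p x ∈ residues p
rem∈residues {suc p} _ x = ∈-map⁺ pos (∈-upTo⁺ (ℤD.n%ℕd<d x (suc p)))

residues-small : ∀ {p x y} → x ∈ residues p → y ∈ residues p → ∣ x ℤ.- y ∣ < p
residues-small x∈ y∈ with a , a∈ , refl ← ∈-map⁻ pos x∈ | b , b∈ , refl ← ∈-map⁻ pos y∈ =
  ≤-<-trans (subst (λ z → ∣ z ∣ ≤ a ⊔ b) (sym (ℤP.m-n≡m⊖n a b)) (ℤP.∣m⊝n∣≤m⊔n a b))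
    (⊔-pres-<m (∈-upTo⁻ a∈) (∈-upTo⁻ b∈))

residues-≈⇒≡ : ∀ {p x y} → x ∈ residues p → y ∈ residues p → x ≈[ p ] y → x ≡ y
residues-≈⇒≡ {x = x} {y} x∈ y∈ x≈y =
  ℤP.i-j≡0⇒i≡j x y (∣ᶻ-small x≈y (residues-small x∈ y∈))

module _ {p : ℕ} (isPrime : Prime p) where

  private
    0<p : 0 < p
    0<p = prime-pos isPrime

  linear-unique : ∀ w → ¬ p ∣ᶻ w → ∀ {x y} → x ∈ residues p → y ∈ residues p →
    x ℤ.* w ≈[ p ] y ℤ.* w → x ≡ y
  linear-unique w p∤w {x} {y} x∈ y∈ eq =
    [ residues-≈⇒≡ x∈ y∈ , ⊥-elim ∘ p∤w ]′ (euclidᶻ isPrime (x ℤ.- y) w (∣ᶻ-resp (factor x y w) eq))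
    where
    factor : ∀ x y w → x ℤ.* w ℤ.- y ℤ.* w ≡ (x ℤ.- y) ℤ.* w
    factor = ℤR.solve-∀

  abstract
    -- Multiplication by `w` is injective on the residues, hence onto.
    solve-linear : ∀ w → ¬ p ∣ᶻ w → ∀ c → ∃ λ u → u ∈ residues p × u ℤ.* w ≈[ p ] c
    solve-linear w p∤w c = map₂ (λ {u} → map₂ (rem-≡⇒≈ (u ℤ.* w) c))
      (injective⇒surjective ℤ._≟_ (λ u → rem p (u ℤ.* w)) (residues-unique p)
        (λ {x} {y} x∈ y∈ eq → linear-unique w p∤w x∈ y∈ (rem-≡⇒≈ (x ℤ.* w) (y ℤ.* w) eq))
        (λ {u} _ → rem∈residues 0<p (u ℤ.* w)) (rem∈residues 0<p c))

  p∤1 : ¬ p ∣ᶻ pos 1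
  p∤1 p∣1 = ¬prime[1] (subst Prime (∣1⇒≡1 (ℤ∣.∣⇒∣ᵤ p∣1)) isPrime)

-- Vectors modulo p, and matrix multiplication row by row

_≋[_]_ : ∀ {n} → Vec ℤ n → ℕ → Vec ℤ n → Set
u ≋[ p ] v = Pointwise (_≈[ p ]_) u v

dot : ∀ {n} → Vec ℤ n → Vec ℤ n → ℤ
dot [] [] = pos 0
dot (x ∷ u) (y ∷ v) = x ℤ.* y ℤ.+ dot u v

dot-≋ : ∀ {p n} {a a′ v v′ : Vec ℤ n} → a ≋[ p ] a′ → v ≋[ p ] v′ → dot a v ≈[ p ] dot a′ v′
dot-≋ [] [] = ≈-refl (pos 0)
dot-≋ {a = x ∷ _} {x′ ∷ _} {y ∷ _} {y′ ∷ _} (x≈ ∷ a≋) (y≈ ∷ v≋) =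
  ≈-+ (x ℤ.* y) (x′ ℤ.* y′) _ _ (≈-* x x′ y y′ x≈ y≈) (dot-≋ a≋ v≋)

dot-zeroʳ : ∀ {p n} (a : Vec ℤ n) {v} → VecAll (p ∣ᶻ_) v → p ∣ᶻ dot a v
dot-zeroʳ {p} [] [] = ∣ᶻ-0 p
dot-zeroʳ (x ∷ a) (p∣y ∷ p∣v) = ℤ∣.∣m∣n⇒∣m+n (ℤ∣.∣n⇒∣m*n x p∣y) (dot-zeroʳ a p∣v)

dot-sub : ∀ {n} (a u v : Vec ℤ n) → dot a (zipWith ℤ._-_ u v) ≡ dot a u ℤ.- dot a v
dot-sub [] [] [] = refl
dot-sub (x ∷ a) (y ∷ u) (z ∷ v) =
  trans (cong (λ t → x ℤ.* (y ℤ.- z) ℤ.+ t) (dot-sub a u v)) (regroup x y z (dot a u) (dot a v))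
  where
  regroup : ∀ x y z s t →
    x ℤ.* (y ℤ.- z) ℤ.+ (s ℤ.- t) ≡ (x ℤ.* y ℤ.+ s) ℤ.- (x ℤ.* z ℤ.+ t)
  regroup = ℤR.solve-∀

dot-scale : ∀ {n} c (a v : Vec ℤ n) → dot a (Vec.map (c ℤ.*_) v) ≡ c ℤ.* dot a v
dot-scale c [] [] = sym (ℤP.*-zeroʳ c)
dot-scale c (x ∷ a) (y ∷ v) =
  trans (cong (λ t → x ℤ.* (c ℤ.* y) ℤ.+ t) (dot-scale c a v)) (regroup c x y (dot a v))
  where
  regroup : ∀ c x y s → x ℤ.* (c ℤ.* y) ℤ.+ c ℤ.* s ≡ c ℤ.* (x ℤ.* y ℤ.+ s)
  regroup = ℤR.solve-∀

_∙_ : ∀ {k n} → Vec (Vec ℤ n) k → Vec ℤ n → Vec ℤ k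
X ∙ v = Vec.map (λ r → dot r v) X

-- Row vector times matrix, by recursion on the rows of `B`; `·≡map` ties it to the tabulated matrix
-- product.
_⊛_ : ∀ {k n} → Vec ℤ k → Vec (Vec ℤ n) k → Vec ℤ n
[] ⊛ [] = replicate _ (pos 0)
(x ∷ a) ⊛ (b ∷ B) = zipWith (λ y z → x ℤ.* y ℤ.+ z) b (a ⊛ B)

-- Associativity (aB)v = a(Bv), through which the kernel of a product is compared with those of its
-- factors.
dot-⊛ : ∀ {k n} (a : Vec ℤ k) (B : Vec (Vec ℤ n) k) v → dot (a ⊛ B) v ≡ dot a (B ∙ v)
dot-⊛ [] [] v = dot-replicate v
  where
  dot-replicate : ∀ {n} (v : Vec ℤ n) → dot (replicate n (pos 0)) v ≡ pos 0
  dot-replicate [] = refl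
  dot-replicate (y ∷ v) = trans (ℤP.+-identityˡ _) (dot-replicate v)
dot-⊛ (x ∷ a) (b ∷ B) v = trans (dot-combine x b (a ⊛ B) v) (cong (λ t → x ℤ.* dot b v ℤ.+ t) (dot-⊛ a B v))
  where
  regroup : ∀ x y z w s t →
    (x ℤ.* y ℤ.+ z) ℤ.* w ℤ.+ (x ℤ.* s ℤ.+ t) ≡ x ℤ.* (y ℤ.* w ℤ.+ s) ℤ.+ (z ℤ.* w ℤ.+ t)
  regroup = ℤR.solve-∀
  dot-combine : ∀ {n} x (b c v : Vec ℤ n) →
    dot (zipWith (λ y z → x ℤ.* y ℤ.+ z) b c) v ≡ x ℤ.* dot b v ℤ.+ dot c v
  dot-combine x [] [] [] = sym (trans (ℤP.+-identityʳ _) (ℤP.*-zeroʳ x))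
  dot-combine x (y ∷ b) (z ∷ c) (w ∷ v) =
    trans (cong (λ t → (x ℤ.* y ℤ.+ z) ℤ.* w ℤ.+ t) (dot-combine x b c v)) (regroup x y z w (dot b v) (dot c v))

row-product : ∀ {k n} (a : Vec ℤ k) (B : Vec (Vec ℤ n) k) →
  tabulate (λ j → Vec.foldr (λ _ → ℤ) ℤ._+_ (pos 0)
    (tabulate λ i → lookup a i ℤ.* lookup (lookup B i) j)) ≡ a ⊛ B
row-product [] [] = tabulate-const _
  where
  tabulate-const : ∀ n → tabulate {n = n} (λ _ → pos 0) ≡ replicate n (pos 0)
  tabulate-const zero = refl
  tabulate-const (suc n) = cong (pos 0 ∷_) (tabulate-const n)
row-product (x ∷ a) (b ∷ B) =
  trans (tabulate-zip b _) (cong (zipWith (λ y z → x ℤ.* y ℤ.+ z) b) (row-product a B))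
  where
  tabulate-zip : ∀ {n} (b : Vec ℤ n) (f : Fin n → ℤ) →
    tabulate (λ j → x ℤ.* lookup b j ℤ.+ f j) ≡ zipWith (λ y z → x ℤ.* y ℤ.+ z) b (tabulate f)
  tabulate-zip [] f = refl
  tabulate-zip (y ∷ b) f = cong (_ ∷_) (tabulate-zip b (f ∘ suc))

·≡map : ∀ {n} (A B : Mat n) → A · B ≡ Vec.map (_⊛ B) A
·≡map A B = begin
  A · B                                  ≡⟨ tabulate-cong (λ i → row-product (lookup A i) B) ⟩
  tabulate (λ i → lookup A i ⊛ B)        ≡⟨ tabulate-∘ (_⊛ B) (lookup A) ⟩
  Vec.map (_⊛ B) (tabulate (lookup A))   ≡⟨ cong (Vec.map (_⊛ B)) (tabulate∘lookup A) ⟩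
  Vec.map (_⊛ B) A                       ∎
  where open ≡-Reasoning

-- Matrices singular modulo p

Nonzero : ℕ → ∀ {n} → Vec ℤ n → Set
Nonzero p = VecAny (λ x → ¬ p ∣ᶻ x)

zero⊎nonzero : ∀ p {n} (v : Vec ℤ n) → VecAll (p ∣ᶻ_) v ⊎ Nonzero p v
zero⊎nonzero p [] = inj₁ []
zero⊎nonzero p (x ∷ v) with p ∣ᶻ? x | zero⊎nonzero p v
... | no p∤x | _ = inj₂ (here p∤x)
... | yes p∣x | inj₁ p∣v = inj₁ (p∣x ∷ p∣v)
... | yes p∣x | inj₂ nz = inj₂ (there nz)

zero⇒¬nonzero : ∀ {p n} {v : Vec ℤ n} → VecAll (p ∣ᶻ_) v → ¬ Nonzero p v
zero⇒¬nonzero (p∣x ∷ _) (here p∤x) = p∤x p∣x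
zero⇒¬nonzero (_ ∷ p∣v) (there nz) = zero⇒¬nonzero p∣v nz

rows : ℕ → ∀ n → List (Vec ℤ n)
rows p n = allVecs n (residues p)

rows-unique : ∀ p n → Unique (rows p n)
rows-unique p n = allVecs-unique n (residues-unique p)

map-rem∈rows : ∀ {p} → 0 < p → ∀ {n} (v : Vec ℤ n) → Vec.map (rem p) v ∈ rows p n
map-rem∈rows {p} 0<p v = ∈-allVecs⁺ (go v)
  where
  go : ∀ {n} (v : Vec ℤ n) → VecAll (_∈ residues p) (Vec.map (rem p) v)
  go [] = []
  go (x ∷ v) = rem∈residues 0<p x ∷ go v

-- One representative, with first nonzero entry 1, of every line of (ℤ/p)ⁿ.
normalised : ℕ → ∀ n → List (Vec ℤ n)
normalised p zero = []
normalised p (suc n) = map (pos 1 ∷_) (rows p n) ++ map (pos 0 ∷_) (normalised p n)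

length-rows : ∀ p n → length (rows p n) ≡ p ^ n
length-rows p n = trans (length-allVecs n (residues p)) (cong (_^ n) (length-residues p))

-- The exact number is 1 + p + ... + p^n, and for p ≥ 2 the terms below p^n add up to at most p^n.
length-normalised : ∀ {p} → 2 ≤ p → ∀ n → length (normalised p (suc n)) ≤ 2 * p ^ n
length-normalised {p} 2≤p n = begin
  length (normalised p (suc n))       ≡⟨ length-++ (map (pos 1 ∷_) (rows p n)) ⟩
  length (map (pos 1 ∷_) (rows p n)) + length (map (pos 0 ∷_) (normalised p n))
                                      ≡⟨ cong₂ _+_ (trans (length-map _ (rows p n)) (length-rows p n))
                                           (length-map _ (normalised p n)) ⟩
  p ^ n + length (normalised p n)     ≤⟨ +-monoʳ-≤ (p ^ n) (rest n) ⟩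
  p ^ n + p ^ n                       ≡⟨ cong (p ^ n +_) (+-identityʳ (p ^ n)) ⟨
  2 * p ^ n                           ∎
  where
  open ≤-Reasoning
  rest : ∀ n → length (normalised p n) ≤ p ^ n
  rest zero = z≤n
  rest (suc n) = ≤-trans (length-normalised 2≤p n) (*-monoˡ-≤ (p ^ n) 2≤p)

module _ {p : ℕ} (isPrime : Prime p) where

  normalised-nonzero : ∀ {n v} → v ∈ normalised p n → Nonzero p v
  normalised-nonzero {suc n} v∈ with ∈-++⁻ (map (pos 1 ∷_) (rows p n)) v∈
  ... | inj₁ v∈₁ with _ , _ , refl ← ∈-map⁻ (pos 1 ∷_) v∈₁ = here (p∤1 isPrime)
  ... | inj₂ v∈₀ with _ , w∈ , refl ← ∈-map⁻ (pos 0 ∷_) v∈₀ = there (normalised-nonzero w∈)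

  -- Scale by an inverse of the first entry that p does not divide; the entries before it vanish
  -- modulo p and become 0.
  normalise : ∀ {n} {w : Vec ℤ n} → Nonzero p w →
    ∃₂ λ v c → v ∈ normalised p n × v ≋[ p ] Vec.map (c ℤ.*_) w
  normalise {suc n} {x ∷ w} nz with p ∣ᶻ? x
  ... | no p∤x with c , _ , cx≈1 ← solve-linear isPrime x p∤x (pos 1) =
    pos 1 ∷ Vec.map (rem p) (Vec.map (c ℤ.*_) w) , c ,
    ∈-++⁺ˡ (∈-map⁺ (pos 1 ∷_) (map-rem∈rows (prime-pos isPrime) (Vec.map (c ℤ.*_) w))) ,
    ≈-sym (c ℤ.* x) (pos 1) cx≈1 ∷ all-≈ (Vec.map (c ℤ.*_) w)
    where
    all-≈ : ∀ {k} (u : Vec ℤ k) → Vec.map (rem p) u ≋[ p ] u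
    all-≈ [] = []
    all-≈ (y ∷ u) = ≈-sym y (rem p y) (rem-≈ p y) ∷ all-≈ u
  normalise {suc n} {x ∷ w} (here p∤x) | yes p∣x = contradiction p∣x p∤x
  normalise {suc n} {x ∷ w} (there nz) | yes p∣x with v , c , v∈ , v≋ ← normalise nz =
    pos 0 ∷ v , c , ∈-++⁺ʳ (map (pos 1 ∷_) (rows p n)) (∈-map⁺ (pos 0 ∷_) v∈) ,
    ≈-sym (c ℤ.* x) (pos 0) (∣ᶻ-resp (sym (ℤP.+-identityʳ (c ℤ.* x))) (ℤ∣.∣n⇒∣m*n c p∣x)) ∷ v≋

Kills : ℕ → ∀ {k n} → Vec (Vec ℤ n) k → Vec ℤ n → Set
Kills p X v = VecAll (λ r → p ∣ᶻ dot r v) X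

kills? : ∀ p {k n} (X : Vec (Vec ℤ n) k) v → Dec (Kills p X v)
kills? p X v = VAll.all? (λ r → p ∣ᶻ? dot r v) X

-- Singularity is defined by kernel vectors rather than determinants. Only one vector per line is
-- searched, so that a union bound over at most 2 p^(n-1) vectors gives the proportion 2/p.
Singular : ℕ → ∀ {k n} → Vec (Vec ℤ n) k → Set
Singular p {n = n} X = Any (Kills p X) (normalised p n)

singular? : ∀ p {k n} (X : Vec (Vec ℤ n) k) → Dec (Singular p X)
singular? p {n = n} X = any? (kills? p X) (normalised p n)

≋-refl : ∀ {p n} (v : Vec ℤ n) → v ≋[ p ] v
≋-refl [] = []
≋-refl (x ∷ v) = ≈-refl x ∷ ≋-refl v

kernel⇒singular : ∀ {p} → Prime p → ∀ {k n} {X : Vec (Vec ℤ n) k} {w} →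
  Nonzero p w → Kills p X w → Singular p X
kernel⇒singular {p} isPrime {w = w} nz kills with v , c , v∈ , v≋ ← normalise isPrime nz =
  lose v∈ (VAll.map (λ {r} p∣ → ∣ᶻ-≈ (dot r (Vec.map (c ℤ.*_) w)) (dot r v)
    (≈-sym (dot r v) _ (dot-≋ (≋-refl r) v≋))
    (∣ᶻ-resp (sym (dot-scale c r w)) (ℤ∣.∣n⇒∣m*n c p∣))) kills)

map-rem-≋ : ∀ {p n} (u v : Vec ℤ n) → Vec.map (rem p) u ≡ Vec.map (rem p) v → u ≋[ p ] v
map-rem-≋ [] [] _ = []
map-rem-≋ (x ∷ u) (y ∷ v) eq with eq₁ , eq₂ ← ∷-injective eq = rem-≡⇒≈ x y eq₁ ∷ map-rem-≋ u v eq₂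

sub-nonzero : ∀ {p n} {u v : Vec ℤ n} → u ∈ rows p n → v ∈ rows p n → u ≢ v →
  Nonzero p (zipWith ℤ._-_ u v)
sub-nonzero u∈ v∈ u≢v = go (∈-allVecs⁻ u∈) (∈-allVecs⁻ v∈) u≢v
  where
  go : ∀ {p n} {u v : Vec ℤ n} → VecAll (_∈ residues p) u → VecAll (_∈ residues p) v → u ≢ v →
    Nonzero p (zipWith ℤ._-_ u v)
  go [] [] u≢v = contradiction refl u≢v
  go {p} {u = x ∷ u} {y ∷ v} (x∈ ∷ u∈) (y∈ ∷ v∈) u≢v with p ∣ᶻ? (x ℤ.- y)
  ... | no p∤ = here p∤
  ... | yes p∣ = there (go u∈ v∈ (λ u≡v → u≢v (cong₂ _∷_ (residues-≈⇒≡ x∈ y∈ p∣) u≡v)))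

sub-kills : ∀ {p k n} (X : Vec (Vec ℤ n) k) u v →
  Vec.map (rem p) (X ∙ u) ≡ Vec.map (rem p) (X ∙ v) → Kills p X (zipWith ℤ._-_ u v)
sub-kills {p} X u v eq = go X (map-rem-≋ (X ∙ u) (X ∙ v) eq)
  where
  go : ∀ {k} (X : Vec (Vec ℤ _) k) → (X ∙ u) ≋[ p ] (X ∙ v) → Kills p X (zipWith ℤ._-_ u v)
  go [] [] = []
  go (r ∷ X) (r≈ ∷ X≋) = ∣ᶻ-resp (sym (dot-sub r u v)) r≈ ∷ go X X≋

-- The p^(n+1) reduced vectors have at most p^n images modulo p; the difference of two with the same
-- image lies in the kernel.
wide⇒kernel : ∀ {p} → 2 ≤ p → ∀ {n} (X : Vec (Vec ℤ (suc n)) n) →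
  ∃ λ w → Nonzero p w × Kills p X w
wide⇒kernel {p} 2≤p {n} X
  with u , v , u∈ , v∈ , u≢v , eq ← pigeonhole (≡-dec ℤ._≟_) (λ v → Vec.map (rem p) (X ∙ v))
    (rows-unique p (suc n)) (λ {v} _ → map-rem∈rows (<⇒≤ 2≤p) (X ∙ v))
    (subst₂ _<_ (sym (length-rows p n)) (sym (length-rows p (suc n)))
      (^-monoʳ-< p 2≤p (n<1+n n))) =
  zipWith ℤ._-_ u v , sub-nonzero u∈ v∈ u≢v , sub-kills X u v eq

kills-· : ∀ {p n} {A B : Mat n} {v} → Kills p A (B ∙ v) → Kills p (A · B) v
kills-· {p} {A = A} {B} {v} kills = subst (λ X → Kills p X v) (sym (·≡map A B)) (go kills)
  where
  go : ∀ {k} {A : Vec (Vec ℤ _) k} → Kills p A (B ∙ v) → Kills p (Vec.map (_⊛ B) A) v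
  go [] = []
  go {A = a ∷ _} (p∣ ∷ kills) = ∣ᶻ-resp (sym (dot-⊛ a B v)) p∣ ∷ go kills

kills⇒zero : ∀ {p k n} {X : Vec (Vec ℤ n) k} {v} → Kills p X v → VecAll (p ∣ᶻ_) (X ∙ v)
kills⇒zero [] = []
kills⇒zero (p∣ ∷ kills) = p∣ ∷ kills⇒zero kills

all-dot-zero : ∀ {p k n} (X : Vec (Vec ℤ n) k) {v} → VecAll (p ∣ᶻ_) v → Kills p X v
all-dot-zero [] p∣v = []
all-dot-zero (r ∷ X) p∣v = dot-zeroʳ r p∣v ∷ all-dot-zero X p∣v

singular-·ʳ : ∀ {p n} (A : Mat n) {B} → Singular p B → Singular p (A · B)
singular-·ʳ {p} A {B} = Any.map (λ {v} kills → kills-· {A = A} {B} (all-dot-zero A (kills⇒zero kills)))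

-- On the finite set of reduced vectors a regular matrix is injective, since two vectors with equal
-- images would differ by a kernel vector; so it is onto.
regular⇒surjective : ∀ {p} → Prime p → ∀ {n} (B : Mat n) → ¬ Singular p B →
  ∀ w → ∃ λ v → (B ∙ v) ≋[ p ] w
regular⇒surjective {p} isPrime {n} B regular w =
  let v , _ , eq = injective⇒surjective (≡-dec ℤ._≟_) (λ v → Vec.map (rem p) (B ∙ v))
        (rows-unique p n) injective (λ {v} _ → map-rem∈rows (prime-pos isPrime) (B ∙ v))
        (map-rem∈rows (prime-pos isPrime) w)
  in v , map-rem-≋ (B ∙ v) w eq
  where
  injective : ∀ {u v} → u ∈ rows p n → v ∈ rows p n →
    Vec.map (rem p) (B ∙ u) ≡ Vec.map (rem p) (B ∙ v) → u ≡ v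
  injective {u} {v} u∈ v∈ eq with ≡-dec ℤ._≟_ u v
  ... | yes u≡v = u≡v
  ... | no u≢v = contradiction
    (kernel⇒singular isPrime (sub-nonzero u∈ v∈ u≢v) (sub-kills B u v eq)) regular

zero-≋ : ∀ {p k} {u w : Vec ℤ k} → u ≋[ p ] w → VecAll (p ∣ᶻ_) u → VecAll (p ∣ᶻ_) w
zero-≋ [] [] = []
zero-≋ {u = x ∷ _} {y ∷ _} (x≈y ∷ u≋w) (p∣x ∷ p∣u) = ∣ᶻ-≈ x y x≈y p∣x ∷ zero-≋ u≋w p∣u

-- If B is nonsingular, a kernel vector of A lifts along B.
singular-·ˡ : ∀ {p} → Prime p → ∀ {n} {A : Mat n} B → Singular p A → Singular p (A · B)
singular-·ˡ {p} isPrime {n} {A} B singA with singular? p B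
... | yes singB = singular-·ʳ A singB
... | no regB with w , w∈ , killsA ← find singA
              with v , Bv≋w ← regular⇒surjective isPrime B regB w
              with zero⊎nonzero p v
...   | inj₁ p∣v = contradiction (normalised-nonzero isPrime w∈)
  (zero⇒¬nonzero (zero-≋ Bv≋w (kills⇒zero (all-dot-zero B p∣v))))
...   | inj₂ nz = kernel⇒singular isPrime nz (kills-· {A = A} {B} (VAll.map
  (λ {r} → ∣ᶻ-≈ (dot r w) (dot r (B ∙ v)) (≈-sym (dot r (B ∙ v)) (dot r w) (dot-≋ (≋-refl r) Bv≋w)))
  killsA))

_≋M[_]_ : ∀ {k n} → Vec (Vec ℤ n) k → ℕ → Vec (Vec ℤ n) k → Set
X ≋M[ p ] Y = Pointwise (_≋[ p ]_) X Y

singular-≋ : ∀ {p k n} {X Y : Vec (Vec ℤ n) k} → X ≋M[ p ] Y → Singular p X → Singular p Y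
singular-≋ {p} X≋Y = Any.map (go X≋Y)
  where
  go : ∀ {k n} {X Y : Vec (Vec ℤ n) k} → X ≋M[ p ] Y → ∀ {v} → Kills p X v → Kills p Y v
  go [] [] = []
  go {X = r ∷ _} {r′ ∷ _} (r≋ ∷ X≋) {v} (p∣ ∷ kills) =
    ∣ᶻ-≈ (dot r v) (dot r′ v) (dot-≋ r≋ (≋-refl v)) p∣ ∷ go X≋ kills

⊛-≋ : ∀ {p k n} {a a′ : Vec ℤ k} {B B′ : Vec (Vec ℤ n) k} →
  a ≋[ p ] a′ → B ≋M[ p ] B′ → (a ⊛ B) ≋[ p ] (a′ ⊛ B′)
⊛-≋ [] [] = ≋-refl _
⊛-≋ {p} {a = x ∷ _} {x′ ∷ _} (x≈ ∷ a≋) (b≋ ∷ B≋) = go b≋ (⊛-≋ a≋ B≋)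
  where
  go : ∀ {n} {b b′ c c′ : Vec ℤ n} → b ≋[ p ] b′ → c ≋[ p ] c′ →
    zipWith (λ y z → x ℤ.* y ℤ.+ z) b c ≋[ p ] zipWith (λ y z → x′ ℤ.* y ℤ.+ z) b′ c′
  go [] [] = []
  go {b = y ∷ _} {y′ ∷ _} {z ∷ _} {z′ ∷ _} (y≈ ∷ b≋) (z≈ ∷ c≋) =
    ≈-+ (x ℤ.* y) (x′ ℤ.* y′) z z′ (≈-* x x′ y y′ x≈ y≈) z≈ ∷ go b≋ c≋

·-≋ : ∀ {p n} {A A′ B B′ : Mat n} → A ≋M[ p ] A′ → B ≋M[ p ] B′ → (A · B) ≋M[ p ] (A′ · B′)
·-≋ {p} {A = A} {A′} {B} {B′} A≋ B≋ =
  subst₂ (_≋M[ p ]_) (sym (·≡map A B)) (sym (·≡map A′ B′)) (go A≋)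
  where
  go : ∀ {k} {A A′ : Vec (Vec ℤ _) k} → A ≋M[ p ] A′ →
    Vec.map (_⊛ B) A ≋M[ p ] Vec.map (_⊛ B′) A′
  go [] = []
  go (a≋ ∷ A≋) = ⊛-≋ a≋ B≋ ∷ go A≋

∏M : ∀ {n m} → Vec (Mat n) m → Mat n
∏M {n} [] = identity n
∏M (A ∷ As) = A · ∏M As

∏M-≋ : ∀ {p n m} {As Bs : Vec (Mat n) m} → Pointwise (_≋M[ p ]_) As Bs → ∏M As ≋M[ p ] ∏M Bs
∏M-≋ {n = n} [] = ≋M-refl (identity n)
  where
  ≋M-refl : ∀ {p k n} (X : Vec (Vec ℤ n) k) → X ≋M[ p ] X
  ≋M-refl [] = []
  ≋M-refl (r ∷ X) = ≋-refl r ∷ ≋M-refl X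
∏M-≋ {As = A ∷ As} {B ∷ Bs} (A≋ ∷ As≋) = ·-≋ {A = A} {B} {∏M As} {∏M Bs} A≋ (∏M-≋ As≋)

-- Counting singular matrices modulo p

𝟙-× : ∀ {P Q R : Set} (R? : Dec R) (P? : Dec P) (Q? : Dec Q) → (R → P × Q) → 𝟙 R? ≤ 𝟙 P? * 𝟙 Q?
𝟙-× (no _) P? Q? f = z≤n
𝟙-× (yes r) P? Q? f =
  ≤-reflexive (sym (cong₂ _*_ (𝟙-yes P? (proj₁ (f r))) (𝟙-yes Q? (proj₂ (f r)))))

#-complement : ∀ {P : A → Set} (P? : Decidable P) xs → # P? xs + # (λ x → ¬? (P? x)) xs ≡ length xs
#-complement P? xs = begin
  # P? xs + # (λ x → ¬? (P? x)) xs         ≡⟨ ∑-+ xs _ _ ⟨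
  ∑ xs (λ x → 𝟙 (P? x) + 𝟙 (¬? (P? x)))    ≡⟨ ∑-cong xs (λ {x} _ → one (P? x)) ⟩
  ∑ xs (λ _ → 1)                           ≡⟨ ∑-1 xs ⟩
  length xs                                ∎
  where
  open ≡-Reasoning
  one : ∀ {P : Set} (P? : Dec P) → 𝟙 P? + 𝟙 (¬? P?) ≡ 1
  one (yes _) = refl
  one (no _) = refl

#-allVecs : ∀ {P : A → Set} (P? : Decidable P) k xs → # (VAll.all? P?) (allVecs k xs) ≤ # P? xs ^ k
#-allVecs P? zero xs = +-monoˡ-≤ 0 (𝟙-≤1 (VAll.all? P? []))
#-allVecs P? (suc k) xs = begin
  # (VAll.all? P?) (allVecs (suc k) xs)
    ≡⟨ ∑-allVecs k xs _ ⟩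
  ∑ xs (λ x → ∑ (allVecs k xs) (λ v → 𝟙 (VAll.all? P? (x ∷ v))))
    ≤⟨ ∑-mono xs (λ {x} _ → ∑-mono (allVecs k xs) (λ {v} _ →
         𝟙-× (VAll.all? P? (x ∷ v)) (P? x) (VAll.all? P? v) (λ { (px ∷ pv) → px , pv }))) ⟩
  ∑ xs (λ x → ∑ (allVecs k xs) (λ v → 𝟙 (P? x) * 𝟙 (VAll.all? P? v)))
    ≡⟨ ∑-cong xs (λ {x} _ → ∑-*ˡ (𝟙 (P? x)) (allVecs k xs) _) ⟩
  ∑ xs (λ x → 𝟙 (P? x) * # (VAll.all? P?) (allVecs k xs))
    ≡⟨ ∑-*ʳ (# (VAll.all? P?) (allVecs k xs)) xs _ ⟩
  # P? xs * # (VAll.all? P?) (allVecs k xs)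
    ≤⟨ *-monoʳ-≤ (# P? xs) (#-allVecs P? k xs) ⟩
  # P? xs ^ suc k ∎
  where open ≤-Reasoning

onHyperplane? : ∀ p {n} (w : Vec ℤ n) c → Decidable (λ r → p ∣ᶻ (dot r w ℤ.+ c))
onHyperplane? p w c r = p ∣ᶻ? (dot r w ℤ.+ c)

matrices : ℕ → ∀ k n → List (Vec (Vec ℤ n) k)
matrices p k n = allVecs k (rows p n)

#singular #regular : ℕ → ℕ → ℕ
#singular p n = # (singular? p) (matrices p n n)
#regular p n = # (λ X → ¬? (singular? p X)) (matrices p n n)

singular+regular : ∀ p n → #singular p n + #regular p n ≡ (p ^ n) ^ n
singular+regular p n = trans (#-complement (singular? p) (matrices p n n))
  (trans (length-allVecs n (rows p n)) (cong (_^ n) (length-rows p n)))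

module _ {p : ℕ} (isPrime : Prime p) where

  private
    0<p : 0 < p
    0<p = prime-pos isPrime
    2≤p : 2 ≤ p
    2≤p = nonTrivial⇒n>1 p {{prime⇒nonTrivial isPrime}}

  #-linear : ∀ y c → ¬ p ∣ᶻ y → # (λ x → p ∣ᶻ? (x ℤ.* y ℤ.+ c)) (residues p) ≡ 1
  #-linear y c p∤y with u , u∈ , uy≈-c ← solve-linear isPrime y p∤y (ℤ.- c) =
    ≤-antisym
      (subst (_≤ 1) (length-filter-# root? (residues p))
        (length-⊆ {ys = u ∷ []} (UniqueP.filter⁺ root? (residues-unique p)) (λ x∈ → here (unique x∈))))
      (≤-trans (≤-reflexive (sym (𝟙-yes (root? u) (∣ᶻ-resp (minus-neg (u ℤ.* y) c) uy≈-c))))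
        (∑-∈ (λ x → 𝟙 (root? x)) u∈))
    where
    root? : Decidable (λ x → p ∣ᶻ (x ℤ.* y ℤ.+ c))
    root? x = p ∣ᶻ? (x ℤ.* y ℤ.+ c)
    minus-neg : ∀ a c → a ℤ.- ℤ.- c ≡ a ℤ.+ c
    minus-neg = ℤR.solve-∀
    neg-minus : ∀ a c → (a ℤ.+ c) ≡ a ℤ.- ℤ.- c
    neg-minus = ℤR.solve-∀
    unique : ∀ {x} → x ∈ filter root? (residues p) → x ≡ u
    unique {x} x∈ = linear-unique isPrime y p∤y (proj₁ (∈-filter⁻ root? x∈)) u∈
      (≈-trans (x ℤ.* y) (ℤ.- c) (u ℤ.* y)
        (∣ᶻ-resp (neg-minus (x ℤ.* y) c) (proj₂ (∈-filter⁻ root? {xs = residues p} x∈)))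
        (≈-sym (u ℤ.* y) (ℤ.- c) uy≈-c))

  #-hyperplane : ∀ {n} {w : Vec ℤ (suc n)} → Nonzero p w → ∀ c →
    # (onHyperplane? p w c) (rows p (suc n)) ≡ p ^ n
  #-hyperplane {n} {y ∷ w} nz c with zero⊎nonzero p w
  -- The tail of the normal vector vanishes modulo p: the condition determines `x` and leaves the
  -- other coordinates free.
  ... | inj₁ p∣w = begin
    # (onHyperplane? p (y ∷ w) c) (rows p (suc n))
      ≡⟨ ∑-allVecs n (residues p) _ ⟩
    ∑ (residues p) (λ x → ∑ (rows p n) (λ r → 𝟙 (p ∣ᶻ? (x ℤ.* y ℤ.+ dot r w ℤ.+ c))))
      ≡⟨ ∑-cong (residues p) (λ {x} _ → ∑-cong (rows p n) (λ {r} _ → 𝟙-cong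
           (p ∣ᶻ? (x ℤ.* y ℤ.+ dot r w ℤ.+ c)) (p ∣ᶻ? (x ℤ.* y ℤ.+ c))
           (λ p∣ → ℤ∣.∣m+n∣n⇒∣m (∣ᶻ-resp (swap (x ℤ.* y) (dot r w) c) p∣) (dot-zeroʳ r p∣w))
           (λ p∣ → ∣ᶻ-resp (sym (swap (x ℤ.* y) (dot r w) c)) (ℤ∣.∣m∣n⇒∣m+n p∣ (dot-zeroʳ r p∣w))))) ⟩
    ∑ (residues p) (λ x → ∑ (rows p n) (λ _ → 𝟙 (p ∣ᶻ? (x ℤ.* y ℤ.+ c))))
      ≡⟨ ∑-cong (residues p) (λ {x} _ → ∑-const (rows p n) (𝟙 (p ∣ᶻ? (x ℤ.* y ℤ.+ c)))) ⟩
    ∑ (residues p) (λ x → length (rows p n) * 𝟙 (p ∣ᶻ? (x ℤ.* y ℤ.+ c)))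
      ≡⟨ ∑-*ˡ (length (rows p n)) (residues p) _ ⟩
    length (rows p n) * # (λ x → p ∣ᶻ? (x ℤ.* y ℤ.+ c)) (residues p)
      ≡⟨ cong₂ _*_ (length-rows p n) (#-linear y c (p∤y nz)) ⟩
    p ^ n * 1
      ≡⟨ *-identityʳ (p ^ n) ⟩
    p ^ n ∎
    where
    open ≡-Reasoning
    swap : ∀ a b c → a ℤ.+ b ℤ.+ c ≡ (a ℤ.+ c) ℤ.+ b
    swap = ℤR.solve-∀
    p∤y : Nonzero p (y ∷ w) → ¬ p ∣ᶻ y
    p∤y (here p∤y) = p∤y
    p∤y (there nz) = ⊥-elim (zero⇒¬nonzero p∣w nz)
  #-hyperplane {suc n} {y ∷ w} _ c | inj₂ nz = begin
    # (onHyperplane? p (y ∷ w) c) (rows p (suc (suc n)))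
      ≡⟨ ∑-allVecs (suc n) (residues p) _ ⟩
    ∑ (residues p) (λ x → ∑ (rows p (suc n)) (λ r → 𝟙 (p ∣ᶻ? (x ℤ.* y ℤ.+ dot r w ℤ.+ c))))
      -- Once `x` is fixed, the tail lies on an affine hyperplane with constant x y + c. The
      -- induction runs because the lemma carries an arbitrary constant.
      ≡⟨ ∑-cong (residues p) (λ {x} _ → ∑-cong (rows p (suc n)) (λ {r} _ → 𝟙-cong
           (p ∣ᶻ? (x ℤ.* y ℤ.+ dot r w ℤ.+ c)) (onHyperplane? p w (x ℤ.* y ℤ.+ c) r)
           (∣ᶻ-resp (swap (x ℤ.* y) (dot r w) c)) (∣ᶻ-resp (sym (swap (x ℤ.* y) (dot r w) c))))) ⟩
    ∑ (residues p) (λ x → # (onHyperplane? p w (x ℤ.* y ℤ.+ c)) (rows p (suc n)))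
      ≡⟨ ∑-cong (residues p) (λ {x} _ → #-hyperplane nz (x ℤ.* y ℤ.+ c)) ⟩
    ∑ (residues p) (λ _ → p ^ n)
      ≡⟨ ∑-const (residues p) (p ^ n) ⟩
    length (residues p) * p ^ n
      ≡⟨ cong (_* p ^ n) (length-residues p) ⟩
    p ^ suc n ∎
    where
    open ≡-Reasoning
    swap : ∀ a b c → a ℤ.+ b ℤ.+ c ≡ b ℤ.+ (a ℤ.+ c)
    swap = ℤR.solve-∀

  private
    kernel? : ∀ {n} (w r : Vec ℤ n) → Dec (p ∣ᶻ dot r w)
    kernel? w r = p ∣ᶻ? dot r w

    #-kernel : ∀ {n} {w : Vec ℤ (suc n)} → Nonzero p w → # (kernel? w) (rows p (suc n)) ≡ p ^ n
    #-kernel {n} {w} nz = trans (∑-cong (rows p (suc n)) (λ {r} _ → 𝟙-cong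
      (kernel? w r) (onHyperplane? p w (pos 0) r)
      (∣ᶻ-resp (sym (ℤP.+-identityʳ (dot r w)))) (∣ᶻ-resp (ℤP.+-identityʳ (dot r w)))))
      (#-hyperplane nz (pos 0))

  -- The last n rows always have a common kernel vector, and a p-th of all first rows kill it.
  singular-lower : ∀ {n} → 0 < n → (p ^ n) ^ n ≤ p * #singular p n
  singular-lower {suc n} _ = begin
    (p ^ suc n) ^ suc n
      ≡⟨ cong (p ^ suc n *_) (trans (cong (_^ n) (sym (length-rows p (suc n))))
                                    (sym (length-allVecs n (rows p (suc n))))) ⟩
    p * p ^ n * length (matrices p n (suc n))
      ≡⟨ trans (*-assoc p (p ^ n) _) (cong (p *_) (*-comm (p ^ n) _)) ⟩
    p * (length (matrices p n (suc n)) * p ^ n)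
      ≡⟨ cong (p *_) (∑-const (matrices p n (suc n)) (p ^ n)) ⟨
    p * ∑ (matrices p n (suc n)) (λ _ → p ^ n)
      ≤⟨ *-monoʳ-≤ p (∑-mono (matrices p n (suc n)) (λ {R} _ → fibre R)) ⟩
    p * ∑ (matrices p n (suc n)) (λ R → ∑ (rows p (suc n)) (λ r → 𝟙 (singular? p (r ∷ R))))
      ≡⟨ cong (p *_) (∑-swap (matrices p n (suc n)) (rows p (suc n)) (λ R r → 𝟙 (singular? p (r ∷ R)))) ⟩
    p * ∑ (rows p (suc n)) (λ r → ∑ (matrices p n (suc n)) (λ R → 𝟙 (singular? p (r ∷ R))))
      ≡⟨ cong (p *_) (∑-allVecs n (rows p (suc n)) (λ X → 𝟙 (singular? p X))) ⟨
    p * #singular p (suc n) ∎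
    where
    open ≤-Reasoning
    fibre : ∀ (R : Vec (Vec ℤ (suc n)) n) → p ^ n ≤ ∑ (rows p (suc n)) (λ r → 𝟙 (singular? p (r ∷ R)))
    fibre R with w , nz , kills ← wide⇒kernel 2≤p R = begin
      p ^ n                           ≡⟨ #-kernel nz ⟨
      # (kernel? w) (rows p (suc n))  ≤⟨ ∑-mono (rows p (suc n)) (λ {r} _ →
                                           𝟙-mono (kernel? w r) (singular? p (r ∷ R))
                                             (λ p∣ → kernel⇒singular isPrime nz (p∣ ∷ kills))) ⟩
      ∑ (rows p (suc n)) (λ r → 𝟙 (singular? p (r ∷ R))) ∎

  -- Union bound over the normalised kernel vectors: at most 2 p^(n-1) of them, each killed by
  -- (p^(n-1))^n matrices.
  singular-upper : ∀ {n} → 0 < n → p * #singular p n ≤ 2 * (p ^ n) ^ n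
  singular-upper {suc n} _ = begin
    p * #singular p (suc n)
      ≤⟨ *-monoʳ-≤ p (∑-mono Ms (λ {X} _ → union-bound X)) ⟩
    p * ∑ Ms (λ X → ∑ vs (λ v → 𝟙 (kills? p X v)))
      ≡⟨ cong (p *_) (∑-swap Ms vs (λ X v → 𝟙 (kills? p X v))) ⟩
    p * ∑ vs (λ v → # (VAll.all? (kernel? v)) Ms)
      ≤⟨ *-monoʳ-≤ p (∑-mono vs (λ {v} v∈ → ≤-trans (#-allVecs (kernel? v) (suc n) (rows p (suc n)))
           (≤-reflexive (cong (_^ suc n) (#-kernel (normalised-nonzero isPrime v∈)))))) ⟩
    p * ∑ vs (λ _ → (p ^ n) ^ suc n)
      ≡⟨ cong (p *_) (∑-const vs ((p ^ n) ^ suc n)) ⟩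
    p * (length vs * (p ^ n) ^ suc n)
      ≤⟨ *-monoʳ-≤ p (*-monoˡ-≤ ((p ^ n) ^ suc n) (length-normalised 2≤p n)) ⟩
    p * (2 * p ^ n * (p ^ n) ^ suc n)
      ≡⟨ shuffle p (p ^ n) ((p ^ n) ^ suc n) ⟩
    2 * (p ^ suc n * (p ^ n) ^ suc n)
      ≡⟨ cong (2 *_) (^-distribʳ-* (suc n) p (p ^ n)) ⟨
    2 * (p ^ suc n) ^ suc n ∎
    where
    open ≤-Reasoning
    Ms = matrices p (suc n) (suc n)
    vs = normalised p (suc n)
    shuffle : ∀ p a b → p * (2 * a * b) ≡ 2 * (p * a * b)
    shuffle = solve-∀
    union-bound : ∀ (X : Mat (suc n)) → 𝟙 (singular? p X) ≤ ∑ vs (λ v → 𝟙 (kills? p X v))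
    union-bound X with singular? p X
    ... | no _ = z≤n
    ... | yes sing with v , v∈ , kills ← find sing =
      ≤-trans (≤-reflexive (sym (𝟙-yes (kills? p X v) kills))) (∑-∈ (λ v → 𝟙 (kills? p X v)) v∈)

  -- A product is regular only if every factor is. An upper bound is the right side for the sieve,
  -- because 1/g is large on regular products.
  regular-products : ∀ n m →
    # (λ As → ¬? (singular? p (∏M As))) (allVecs m (matrices p n n)) ≤ #regular p n ^ m
  regular-products n zero = +-monoˡ-≤ 0 (𝟙-≤1 (¬? (singular? p (identity n))))
  regular-products n (suc m) = begin
    ∑ (allVecs (suc m) Ms) (λ As → good (∏M As))
      ≡⟨ ∑-allVecs m Ms _ ⟩
    ∑ Ms (λ A → ∑ (allVecs m Ms) (λ As → good (A · ∏M As)))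
      ≤⟨ ∑-mono Ms (λ {A} _ → ∑-mono (allVecs m Ms) (λ {As} _ → 𝟙-×
           (¬? (singular? p (A · ∏M As))) (¬? (singular? p A)) (¬? (singular? p (∏M As)))
           (λ reg → (λ sing → reg (singular-·ˡ isPrime (∏M As) sing)) ,
                    (λ sing → reg (singular-·ʳ A sing))))) ⟩
    ∑ Ms (λ A → ∑ (allVecs m Ms) (λ As → good A * good (∏M As)))
      ≡⟨ ∑-cong Ms (λ {A} _ → ∑-*ˡ (good A) (allVecs m Ms) _) ⟩
    ∑ Ms (λ A → good A * ∑ (allVecs m Ms) (λ As → good (∏M As)))
      ≡⟨ ∑-*ʳ (∑ (allVecs m Ms) (λ As → good (∏M As))) Ms good ⟩
    #regular p n * ∑ (allVecs m Ms) (λ As → good (∏M As))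
      ≤⟨ *-monoʳ-≤ (#regular p n) (regular-products n m) ⟩
    #regular p n ^ suc m ∎
    where
    open ≤-Reasoning
    Ms = matrices p n n
    good : Mat n → ℕ
    good X = 𝟙 (¬? (singular? p X))

-- The sieve

-- Splitting off the 4 S ≤ G + S slack as G = 3 S + d leaves only nonnegative coefficients.
uniform-polynomial : ∀ S d → let G = 3 * S + d ; N = S + G in
  4 * (2 * (N * N) * S + G * G * G) + N * N * S + (4 * (S * S * S) + 12 * (S * S * d) + 3 * (S * d * d))
    ≡ 4 * (N * N * N)
uniform-polynomial = expand
  where
  expand : ∀ S d →
    4 * (2 * ((S + (3 * S + d)) * (S + (3 * S + d))) * S + (3 * S + d) * (3 * S + d) * (3 * S + d))
      + (S + (3 * S + d)) * (S + (3 * S + d)) * S + (4 * (S * S * S) + 12 * (S * S * d) + 3 * (S * d * d))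
      ≡ 4 * ((S + (3 * S + d)) * (S + (3 * S + d)) * (S + (3 * S + d)))
  expand = solve-∀

-- The estimate behind the mean of 1/g for six factors, as an identity whose third summand is the
-- slack. With N = S + G, the form G² + 4GS + 2S² is 2N² - G², the excess weight of a regular over a
-- singular product.
product-polynomial : ∀ S G →
  2 * ((G * G + 4 * G * S + 2 * S * S) * (G * G * G * G))
    + S * ((S + G) * (S + G) * (S + G) * (S + G) * (S + G))
    + (3 * (G * G * G * G * G * S) + 21 * (G * G * G * G * S * S) + 30 * (G * G * G * S * S * S)
       + 20 * (G * G * S * S * S * S) + 7 * (G * S * S * S * S * S) + S * S * S * S * S * S)
    ≡ 2 * ((S + G) * (S + G) * (S + G) * (S + G) * (S + G) * (S + G))
product-polynomial = solve-∀

-- The hypothesis is X ≤ (1 - 1/(4p)) Y with the subtraction moved across, the form in which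
-- polynomial identities deliver it.
saving : ∀ p {X Y} → 4 * p * X + Y ≤ 4 * p * Y → 4 * p * X ≤ (4 * p ∸ 1) * Y
saving p {X} {Y} le = begin
  4 * p * X               ≡⟨ m+n∸n≡m (4 * p * X) Y ⟨
  4 * p * X + Y ∸ Y       ≤⟨ ∸-monoˡ-≤ Y le ⟩
  4 * p * Y ∸ Y           ≡⟨ cong (4 * p * Y ∸_) (+-identityʳ Y) ⟨
  4 * p * Y ∸ 1 * Y       ≡⟨ *-distribʳ-∸ Y (4 * p) 1 ⟨
  (4 * p ∸ 1) * Y         ∎
  where open ≤-Reasoning

-- With π = S/N the claim is 2π + (1 - π)³ ≤ 1 - 1/(4p). The left side is 1 - π + 3π² - π³; for π ≤
-- 1/4 the term 3π² costs at most 3π/4, and a quarter of π ≥ 1/p survives. This is the origin of the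
-- 4 in 4 p.
uniform-saving : ∀ p S G → let N = S + G in N ≤ p * S → 4 * S ≤ N →
  4 * p * (2 * (N * N) * S + G * G * G) ≤ (4 * p ∸ 1) * (N * N * N)
uniform-saving p S G N≤pS 4S≤N with m≤n⇒∃[o]m+o≡n (+-cancelˡ-≤ S (3 * S) G 4S≤N)
... | d , refl = saving p (begin
  4 * p * X + N * N * N           ≤⟨ +-monoʳ-≤ (4 * p * X) (*-monoʳ-≤ (N * N) N≤pS) ⟩
  4 * p * X + N * N * (p * S)     ≡⟨ shuffle₁ p X (N * N) S ⟩
  p * (4 * X + N * N * S)         ≤⟨ *-monoʳ-≤ p (≤-trans (m≤m+n _ _) (≤-reflexive (uniform-polynomial S d))) ⟩
  p * (4 * (N * N * N))           ≡⟨ shuffle₂ p (N * N * N) ⟩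
  4 * p * (N * N * N)             ∎)
  where
  open ≤-Reasoning
  N = S + (3 * S + d)
  X = 2 * (N * N) * S + (3 * S + d) * (3 * S + d) * (3 * S + d)
  shuffle₁ : ∀ p X M S → 4 * p * X + M * (p * S) ≡ p * (4 * X + M * S)
  shuffle₁ = solve-∀
  shuffle₂ : ∀ p Y → p * (4 * Y) ≡ 4 * p * Y
  shuffle₂ = solve-∀

-- Here `s` and `t` count the tuples with singular and with regular product. Eliminating `s` leaves
-- (2N² - G²) t, and t ≤ G^m ≤ G⁶ N^(m-6). After removing the common factor 2 N G² N^(m-6),
-- `product-polynomial` is what remains.
product-saving : ∀ p S G s t m → let N = S + G in 6 ≤ m → 0 < N → N ≤ p * S →
  s + t ≡ N ^ m → t ≤ G ^ m →
  4 * p * (G * G * s + 2 * (N * N) * t) ≤ (4 * p ∸ 1) * (2 * (G * G) * N ^ m)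
product-saving p S G s t m 6≤m 0<N N≤pS s+t t≤ with m≤n⇒∃[o]m+o≡n 6≤m
... | j , refl = saving p (*-cancelʳ-≤ _ _ N {{>-nonZero 0<N}} (begin
  (4 * p * X + Y) * N                       ≡⟨ *-distribʳ-+ N (4 * p * X) Y ⟩
  4 * p * X * N + Y * N                     ≤⟨ +-monoʳ-≤ (4 * p * X * N) (*-monoʳ-≤ Y N≤pS) ⟩
  4 * p * X * N + Y * (p * S)               ≡⟨ shuffle₁ p X N Y S ⟩
  p * (4 * N * X + Y * S)                   ≤⟨ *-monoʳ-≤ p key ⟩
  p * (4 * N * Y)                           ≡⟨ shuffle₂ p N Y ⟩
  4 * p * Y * N                             ∎))
  where
  open ≤-Reasoning
  N = S + G
  R = N ^ (6 + j)
  X = G * G * s + 2 * (N * N) * t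
  Y = 2 * (G * G) * R
  D = G * G + 4 * G * S + 2 * S * S
  e = N ^ j
  shuffle₁ : ∀ p X N Y S → 4 * p * X * N + Y * (p * S) ≡ p * (4 * N * X + Y * S)
  shuffle₁ = solve-∀
  shuffle₂ : ∀ p N Y → p * (4 * N * Y) ≡ 4 * p * Y * N
  shuffle₂ = solve-∀
  expand-X : ∀ S G s t → G * G * s + 2 * ((S + G) * (S + G)) * t
    ≡ G * G * (s + t) + (G * G + 4 * G * S + 2 * S * S) * t
  expand-X = solve-∀
  power₆ : ∀ a → a ^ (6 + j) ≡ a * a * a * a * a * a * a ^ j
  power₆ a = assoc₆ a (a ^ j)
    where
    assoc₆ : ∀ a b → a * (a * (a * (a * (a * (a * b))))) ≡ a * a * a * a * a * a * b
    assoc₆ = solve-∀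
  t≤′ : t ≤ G * G * G * G * G * G * e
  t≤′ = begin
    t                                 ≤⟨ t≤ ⟩
    G ^ (6 + j)                       ≡⟨ power₆ G ⟩
    G * G * G * G * G * G * G ^ j     ≤⟨ *-monoʳ-≤ (G * G * G * G * G * G) (^-monoˡ-≤ j (m≤n+m G S)) ⟩
    G * G * G * G * G * G * e         ∎
  regroup₁ : ∀ N G R D t S → 4 * N * (G * G * R + D * t) + 2 * (G * G) * R * S
    ≡ 4 * N * (G * G) * R + (4 * N * D * t + 2 * (G * G) * R * S)
  regroup₁ = solve-∀
  regroup₂ : ∀ N G D e S →
    4 * N * D * (G * G * G * G * G * G * e) + 2 * (G * G) * (N * N * N * N * N * N * e) * S
    ≡ 2 * N * (G * G) * e * (2 * (D * (G * G * G * G)) + S * (N * N * N * N * N))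
  regroup₂ = solve-∀
  regroup₃ : ∀ N G e → 2 * N * (G * G) * e * (2 * (N * N * N * N * N * N))
    ≡ 4 * N * (G * G) * (N * N * N * N * N * N * e)
  regroup₃ = solve-∀
  regroup₄ : ∀ N G R → 4 * N * (G * G) * R + 4 * N * (G * G) * R ≡ 4 * N * (2 * (G * G) * R)
  regroup₄ = solve-∀
  key : 4 * N * X + Y * S ≤ 4 * N * Y
  key = begin
    4 * N * X + Y * S
      ≡⟨ cong (λ x → 4 * N * x + Y * S) (trans (expand-X S G s t) (cong (λ r → G * G * r + D * t) s+t)) ⟩
    4 * N * (G * G * R + D * t) + Y * S
      ≡⟨ regroup₁ N G R D t S ⟩
    4 * N * (G * G) * R + (4 * N * D * t + 2 * (G * G) * R * S)
      ≤⟨ +-monoʳ-≤ (4 * N * (G * G) * R) (begin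
        4 * N * D * t + 2 * (G * G) * R * S
          ≤⟨ +-mono-≤ (*-monoʳ-≤ (4 * N * D) t≤′)
               (≤-reflexive (cong (λ r → 2 * (G * G) * r * S) (power₆ N))) ⟩
        4 * N * D * (G * G * G * G * G * G * e) + 2 * (G * G) * (N * N * N * N * N * N * e) * S
          ≡⟨ regroup₂ N G D e S ⟩
        2 * N * (G * G) * e * (2 * (D * (G * G * G * G)) + S * (N * N * N * N * N))
          ≤⟨ *-monoʳ-≤ (2 * N * (G * G) * e) (≤-trans (m≤m+n _ _) (≤-reflexive (product-polynomial S G))) ⟩
        2 * N * (G * G) * e * (2 * (N * N * N * N * N * N))
          ≡⟨ regroup₃ N G e ⟩
        4 * N * (G * G) * (N * N * N * N * N * N * e)
          ≡⟨ cong (4 * N * (G * G) *_) (power₆ N) ⟨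
        4 * N * (G * G) * R ∎) ⟩
    4 * N * (G * G) * R + 4 * N * (G * G) * R
      ≡⟨ regroup₄ N G R ⟩
    4 * N * Y ∎

-- Markov's inequality for the weight ∏ w p / D p, each factor having mean at most 1 - 1/(4p) over
-- the residues `rs p`. The map `q` stands for the quotient by the product of the primes and `r p`
-- for reduction modulo p; keeping them abstract lets one argument serve matrices and tuples of
-- matrices.
module Sieve
  (ps : List ℕ) (K : ℕ) (K≤ : K * ∏ ps (λ p → 4 * p ∸ 1) ≤ ∏ ps (4 *_)) (0<p : ∀ {p} → p ∈ ps → 0 < p)
  (q : A → B) (r : ℕ → A → A)
  (separate : ∀ x y → q x ≡ q y → (∀ {p} → p ∈ ps → r p x ≡ r p y) → x ≡ y)
  (xs : List A) (xs-unique : Unique xs) (cs : List B) (q∈ : ∀ {x} → x ∈ xs → q x ∈ cs)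
  (rs : ℕ → List A) (r∈ : ∀ {p} → p ∈ ps → ∀ x → r p x ∈ rs p)
  (w : ℕ → A → ℕ) (periodic : ∀ {p} → p ∈ ps → ∀ x → w p (r p x) ≡ w p x)
  (D : ℕ → ℕ) (0<D : ∀ {p} → p ∈ ps → 0 < D p)
  (local : ∀ {p} → p ∈ ps → 4 * p * ∑ (rs p) (w p) ≤ (4 * p ∸ 1) * (D p * length (rs p)))
  where

  weight : A → ℕ
  weight x = ∏ ps (λ p → w p x)

  heavy? : Decidable (λ x → ∏ ps D ≤ weight x)
  heavy? x = ∏ ps D ≤? weight x

  private
    codes : List ℕ → List (List A)
    codes [] = [] ∷ []
    codes (p ∷ ps) = concatMap (λ y → map (y ∷_) (codes ps)) (rs p)

    code : List ℕ → A → List A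
    code ps x = map (λ p → r p x) ps

    codeWeight : List ℕ → List A → ℕ
    codeWeight (p ∷ ps) (y ∷ ys) = w p y * codeWeight ps ys
    codeWeight _ _ = 1

    ∑-codes : ∀ ps → ∑ (codes ps) (codeWeight ps) ≡ ∏ ps (λ p → ∑ (rs p) (w p))
    ∑-codes [] = refl
    ∑-codes (p ∷ ps) = begin
      ∑ (codes (p ∷ ps)) (codeWeight (p ∷ ps))
        ≡⟨ ∑-pairs _∷_ (rs p) (codes ps) _ ⟩
      ∑ (rs p) (λ y → ∑ (codes ps) (λ ys → w p y * codeWeight ps ys))
        ≡⟨ ∑-cong (rs p) (λ {y} _ → ∑-*ˡ (w p y) (codes ps) (codeWeight ps)) ⟩
      ∑ (rs p) (λ y → w p y * ∑ (codes ps) (codeWeight ps))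
        ≡⟨ ∑-*ʳ (∑ (codes ps) (codeWeight ps)) (rs p) (w p) ⟩
      ∑ (rs p) (w p) * ∑ (codes ps) (codeWeight ps)
        ≡⟨ cong (∑ (rs p) (w p) *_) (∑-codes ps) ⟩
      ∑ (rs p) (w p) * ∏ ps (λ p → ∑ (rs p) (w p)) ∎
      where open ≡-Reasoning

    code∈ : ∀ qs → (∀ {p} → p ∈ qs → p ∈ ps) → ∀ x → code qs x ∈ codes qs
    code∈ [] sub x = here refl
    code∈ (p ∷ qs) sub x = ∈-pairs⁺ _∷_ (r∈ (sub (here refl)) x) (code∈ qs (sub ∘ there) x)

    codeWeight-code : ∀ qs → (∀ {p} → p ∈ qs → p ∈ ps) → ∀ x →
      ∏ qs (λ p → w p x) ≡ codeWeight qs (code qs x)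
    codeWeight-code [] sub x = refl
    codeWeight-code (p ∷ qs) sub x =
      cong₂ _*_ (sym (periodic (sub (here refl)) x)) (codeWeight-code qs (sub ∘ there) x)

    code-injective : ∀ qs x y → code qs x ≡ code qs y → ∀ {p} → p ∈ qs → r p x ≡ r p y
    code-injective (p ∷ qs) x y eq (here refl) = ListP.∷-injectiveˡ eq
    code-injective (p ∷ qs) x y eq (there p∈) = code-injective qs x y (ListP.∷-injectiveʳ eq) p∈

    -- Quotient and residues inject `xs` into the pairs of a member of `cs` and a residue code.
    -- Extending the sum to all such pairs can only increase it, and there it factors over the
    -- primes, so no equidistribution of `xs` has to be shown.
    ∑-weight : ∑ xs weight ≤ length cs * ∏ ps (λ p → ∑ (rs p) (w p))
    ∑-weight = begin
      ∑ xs weight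
        ≡⟨ ∑-cong xs (λ {x} _ → codeWeight-code ps id x) ⟩
      ∑ xs (h ∘ f)
        ≤⟨ ∑-injection f h xs-unique
             (λ {x} {y} _ _ eq → separate x y (cong proj₁ eq) (code-injective ps x y (cong proj₂ eq)))
             (λ {x} x∈ → ∈-pairs⁺ _,_ (q∈ x∈) (code∈ ps id x)) ⟩
      ∑ (concatMap (λ c → map (c ,_) (codes ps)) cs) h
        ≡⟨ ∑-pairs _,_ cs (codes ps) h ⟩
      ∑ cs (λ _ → ∑ (codes ps) (codeWeight ps))
        ≡⟨ ∑-const cs _ ⟩
      length cs * ∑ (codes ps) (codeWeight ps)
        ≡⟨ cong (length cs *_) (∑-codes ps) ⟩
      length cs * ∏ ps (λ p → ∑ (rs p) (w p)) ∎
      where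
      open ≤-Reasoning
      f : A → B × List A
      f x = q x , code ps x
      h : B × List A → ℕ
      h (_ , ys) = codeWeight ps ys

    markov : ∏ ps D * # heavy? xs ≤ ∑ xs weight
    markov = ≤-trans (≤-reflexive (sym (∑-*ˡ (∏ ps D) xs _))) (∑-mono xs (λ {x} _ → pointwise x (heavy? x)))
      where
      pointwise : ∀ x (d : Dec (∏ ps D ≤ weight x)) → ∏ ps D * 𝟙 d ≤ weight x
      pointwise x (yes le) = ≤-trans (≤-reflexive (*-identityʳ (∏ ps D))) le
      pointwise x (no _) = ≤-trans (≤-reflexive (*-zeroʳ (∏ ps D))) z≤n

  -- The product of the local means, relative to the threshold, is at most ∏ (1 - 1/(4p)) ≤ 1/K.
  -- Multiplying by ∏ 4p and ∏ D p keeps everything in the natural numbers.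
  heavy-rare : K * # heavy? xs ≤ length cs * ∏ ps (λ p → length (rs p))
  heavy-rare = *-cancelʳ-≤ _ _ (∏ ps (4 *_) * ∏ ps D) {{>-nonZero 0<denominator}} (begin
    K * # heavy? xs * (Π4 * ΠD)
      ≡⟨ shuffle₁ K (# heavy? xs) Π4 ΠD ⟩
    K * (Π4 * (ΠD * # heavy? xs))
      ≤⟨ *-monoʳ-≤ K (*-monoʳ-≤ Π4 (≤-trans markov ∑-weight)) ⟩
    K * (Π4 * (length cs * ∏ ps (λ p → ∑ (rs p) (w p))))
      ≡⟨ shuffle₂ K Π4 (length cs) _ ⟩
    length cs * K * (Π4 * ∏ ps (λ p → ∑ (rs p) (w p)))
      ≡⟨ cong (length cs * K *_) (∏-* ps (4 *_) _) ⟨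
    length cs * K * ∏ ps (λ p → 4 * p * ∑ (rs p) (w p))
      ≤⟨ *-monoʳ-≤ (length cs * K) (∏-mono ps local) ⟩
    length cs * K * ∏ ps (λ p → (4 * p ∸ 1) * (D p * length (rs p)))
      ≡⟨ cong (length cs * K *_) (trans (∏-* ps _ _)
           (cong (∏ ps (λ p → 4 * p ∸ 1) *_) (∏-* ps D _))) ⟩
    length cs * K * (∏ ps (λ p → 4 * p ∸ 1) * (ΠD * L))
      ≡⟨ shuffle₃ (length cs) K (∏ ps (λ p → 4 * p ∸ 1)) ΠD L ⟩
    length cs * L * (K * ∏ ps (λ p → 4 * p ∸ 1) * ΠD)
      ≤⟨ *-monoʳ-≤ (length cs * L) (*-monoˡ-≤ ΠD K≤) ⟩
    length cs * L * (Π4 * ΠD) ∎)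
    where
    open ≤-Reasoning
    Π4 = ∏ ps (4 *_)
    ΠD = ∏ ps D
    L = ∏ ps (λ p → length (rs p))
    0<denominator : 0 < Π4 * ΠD
    0<denominator = *-mono-< (∏-pos ps (λ p∈ → *-mono-< (z<s {3}) (0<p p∈))) (∏-pos ps 0<D)
    shuffle₁ : ∀ K a b c → K * a * (b * c) ≡ K * (b * (c * a))
    shuffle₁ = solve-∀
    shuffle₂ : ∀ K a b c → K * (a * (b * c)) ≡ b * K * (a * c)
    shuffle₂ = solve-∀
    shuffle₃ : ∀ l K a d L → l * K * (a * (d * L)) ≡ l * L * (K * a * d)
    shuffle₃ = solve-∀

-- Integer matrices of bounded height

kronecker : ∀ {k} → Fin k → Fin k → ℤ
kronecker zero zero = pos 1
kronecker zero (suc j) = pos 0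
kronecker (suc i) zero = pos 0
kronecker (suc i) (suc j) = kronecker i j

identity-entry : ∀ n (i j : Fin n) → lookup (lookup (identity n) i) j ≡ kronecker i j
-- The function δ local to identity cannot be named here: the underscore stands for δ, lifted over
-- the size N of the ambient matrix, and is solved from its use in step, where N and k are distinct.
δ≡kronecker : ∀ N k (i j : Fin k) → _ ≡ kronecker i j

identity-entry (suc n) zero zero = refl
identity-entry (suc n) zero (suc j) = lookup∘tabulate _ j
identity-entry (suc n) (suc i) zero = cong (λ r → lookup r zero) (lookup∘tabulate _ i)
identity-entry (suc n) (suc i) (suc j) = trans (cong (λ r → lookup r (suc j)) (lookup∘tabulate _ i)) (trans (lookup∘tabulate _ j) (step n i j))
  where
  step : ∀ n (i j : Fin n) → _ ≡ kronecker i j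
  step n i j with N ← suc n = δ≡kronecker N n i j

δ≡kronecker N (suc k) zero zero = refl
δ≡kronecker N (suc k) zero (suc j) = refl
δ≡kronecker N (suc k) (suc i) zero = refl
δ≡kronecker N (suc k) (suc i) (suc j) = δ≡kronecker N k i j

-- Chinese remaindering for integers, vectors and matrices

prime∣∏⇒∈ : ∀ {p ps} → Prime p → (∀ {q} → q ∈ ps → Prime q) → p ∣ ∏ ps id → p ∈ ps
prime∣∏⇒∈ {ps = []} isPrime _ p∣1 = ⊥-elim (¬prime[1] (subst Prime (∣1⇒≡1 p∣1) isPrime))
prime∣∏⇒∈ {p} {q ∷ ps} isPrime primes p∣ with euclidsLemma q (∏ ps id) isPrime p∣
... | inj₂ p∣∏ = there (prime∣∏⇒∈ isPrime (primes ∘ there) p∣∏)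
... | inj₁ p∣q with prime⇒irreducible (primes (here refl)) p∣q
...   | inj₁ refl = ⊥-elim (¬prime[1] isPrime)
...   | inj₂ p≡q = here p≡q

∏-∣ : ∀ {ps z} → Unique ps → (∀ {p} → p ∈ ps → Prime p) → (∀ {p} → p ∈ ps → p ∣ z) → ∏ ps id ∣ z
∏-∣ {[]} {z} _ _ _ = divides z (sym (*-identityʳ z))
∏-∣ {p ∷ ps} (p∉ ∷ uniq) primes divs with ∏-∣ uniq (primes ∘ there) (divs ∘ there)
... | divides k refl with euclidsLemma k (∏ ps id) (primes (here refl)) (divs (here refl))
...   | inj₁ (divides l refl) = divides l (*-assoc l p (∏ ps id))
...   | inj₂ p∣∏ = contradiction refl
  (All.lookup p∉ (prime∣∏⇒∈ (primes (here refl)) (primes ∘ there) p∣∏))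

Separating : (A → B) → (ℕ → A → A) → List ℕ → Set
Separating q r ps = ∀ x y → q x ≡ q y → (∀ {p} → p ∈ ps → r p x ≡ r p y) → x ≡ y

-- The uniqueness half: the product Q of the primes divides x - y, while equal quotients by Q force
-- |x - y| < Q.
chinese-remainder : ∀ {ps} → Unique ps → (∀ {p} → p ∈ ps → Prime p) →
  Separating (quo (∏ ps id)) rem ps
chinese-remainder {ps} uniq primes x y same-quo same-rem =
  ℤP.i-j≡0⇒i≡j x y (∣ᶻ-small {Q} (ℤ∣.∣ᵤ⇒∣ (∏-∣ uniq primes (λ p∈ → ℤ∣.∣⇒∣ᵤ (rem-≡⇒≈ x y (same-rem p∈)))))
    (subst (λ z → ∣ z ∣ < Q) (sym difference) (residues-small (rem∈residues 0<Q x) (rem∈residues 0<Q y))))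
  where
  Q = ∏ ps id
  0<Q : 0 < Q
  0<Q = ∏-pos ps (λ p∈ → prime-pos (primes p∈))
  cancel : ∀ a b t → (a ℤ.+ t) ℤ.- (b ℤ.+ t) ≡ a ℤ.- b
  cancel = ℤR.solve-∀
  difference : x ℤ.- y ≡ rem Q x ℤ.- rem Q y
  difference = trans (cong₂ ℤ._-_ (rem+quo Q x)
      (trans (rem+quo Q y) (cong (λ c → rem Q y ℤ.+ c ℤ.* pos Q) (sym same-quo))))
    (cancel (rem Q x) (rem Q y) (quo Q x ℤ.* pos Q))

separating-map : ∀ {q : A → B} {r ps} → Separating q r ps →
  ∀ {n} → Separating {Vec A n} (Vec.map q) (λ p → Vec.map (r p)) ps
separating-map sep [] [] _ _ = refl
separating-map sep (x ∷ u) (y ∷ v) same-q same-r = cong₂ _∷_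
  (sep x y (VecP.∷-injectiveˡ same-q) (λ p∈ → VecP.∷-injectiveˡ (same-r p∈)))
  (separating-map sep u v (VecP.∷-injectiveʳ same-q) (λ p∈ → VecP.∷-injectiveʳ (same-r p∈)))

map∈allVecs : ∀ {f : A → B} {n xs ys} → (∀ {x} → x ∈ xs → f x ∈ ys) →
  ∀ {v} → v ∈ allVecs n xs → Vec.map f v ∈ allVecs n ys
map∈allVecs f∈ v∈ = ∈-allVecs⁺ (VAllP.map⁺ (VAll.map f∈ (∈-allVecs⁻ v∈)))

map∈allVecs′ : ∀ {f : A → B} {ys} → (∀ x → f x ∈ ys) → ∀ {n} (v : Vec A n) → Vec.map f v ∈ allVecs n ys
map∈allVecs′ f∈ v = ∈-allVecs⁺ (VAllP.map⁺ (VAll.universal f∈ v))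

map-pointwise : ∀ {_~_ : A → A → Set} {f : A → A} → (∀ x → f x ~ x) →
  ∀ {n} (v : Vec A n) → Pointwise _~_ (Vec.map f v) v
map-pointwise f~ [] = []
map-pointwise f~ (x ∷ v) = f~ x ∷ map-pointwise f~ v

-- Boxes of integers and matrices, their quotients and products

range-unique : ∀ H → Unique (range H)
range-unique H = UniqueP.map⁺ (λ {k} {l} eq → ℤP.+-injective (cancel (pos k) (pos l) eq))
    (UniqueP.upTo⁺ (suc (H + H)))
  where
  restore : ∀ x h → x ℤ.- h ℤ.+ h ≡ x
  restore = ℤR.solve-∀
  cancel : ∀ x y → x ℤ.- pos H ≡ y ℤ.- pos H → x ≡ y
  cancel x y eq = trans (sym (restore x (pos H))) (trans (cong (ℤ._+ pos H) eq) (restore y (pos H)))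

length-range : ∀ H → length (range H) ≡ suc (H + H)
length-range H = trans (length-map _ (upTo (suc (H + H)))) (length-upTo (suc (H + H)))

∈-range⁻ : ∀ {H z} → z ∈ range H → ∣ z ∣ ≤ H
∈-range⁻ {H} z∈ with k , k∈ , refl ← ∈-map⁻ (λ k → pos k ℤ.- pos H) z∈ =
  subst (λ z → ∣ z ∣ ≤ H) (sym (ℤP.m-n≡m⊖n k H)) (bound (≤-total H k))
  where
  bound : H ≤ k ⊎ k ≤ H → ∣ k ℤ.⊖ H ∣ ≤ H
  bound (inj₁ H≤k) = begin
    ∣ k ℤ.⊖ H ∣     ≡⟨ cong ∣_∣ (ℤP.⊖-≥ H≤k) ⟩
    k ∸ H           ≤⟨ ∸-monoˡ-≤ H (≤-pred (∈-upTo⁻ k∈)) ⟩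
    H + H ∸ H       ≡⟨ m+n∸n≡m H H ⟩
    H               ∎
    where open ≤-Reasoning
  bound (inj₂ k≤H) = ≤-trans (≤-reflexive (ℤP.∣⊖∣-≤ k≤H)) (m∸n≤m H k)

∈-range⁺ : ∀ {H z} → ∣ z ∣ ≤ H → z ∈ range H
∈-range⁺ {H} {z} z≤H =
  let k , k≤ , eq = shifted z z≤H in
  subst (_∈ range H) (trans (cong (ℤ._- pos H) eq) (cancel z (pos H)))
    (∈-map⁺ (λ k → pos k ℤ.- pos H) (∈-upTo⁺ (s≤s k≤)))
  where
  cancel : ∀ z h → z ℤ.+ h ℤ.- h ≡ z
  cancel = ℤR.solve-∀
  shifted : ∀ z → ∣ z ∣ ≤ H → ∃ λ k → k ≤ H + H × pos k ≡ z ℤ.+ pos H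
  shifted (pos a) a≤H = a + H , +-monoˡ-≤ H a≤H , ℤP.pos-+ a H
  shifted -[1+ a ] a<H = H ∸ suc a , ≤-trans (m∸n≤m H (suc a)) (m≤m+n H H) , sym (ℤP.⊖-≥ a<H)

quo∈range : ∀ {Q H z} → 0 < Q → z ∈ range H → quo Q z ∈ range ((H + Q) ÷ Q)
quo∈range {Q} {H} {z} 0<Q z∈ = ∈-range⁺ (≤-÷ 0<Q (begin
  ∣ quo Q z ∣ * Q               ≡⟨ ℤP.abs-* (quo Q z) (pos Q) ⟨
  ∣ quo Q z ℤ.* pos Q ∣         ≡⟨ cong ∣_∣ (trans (sym (cancel (rem Q z) (quo Q z ℤ.* pos Q)))
                                     (cong (ℤ._- rem Q z) (sym (rem+quo Q z)))) ⟩
  ∣ z ℤ.- rem Q z ∣             ≤⟨ ℤP.∣i-j∣≤∣i∣+∣j∣ z (rem Q z) ⟩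
  ∣ z ∣ + ∣ rem Q z ∣           ≤⟨ +-mono-≤ (∈-range⁻ z∈) (residue-≤ (rem∈residues 0<Q z)) ⟩
  H + Q                         ∎))
  where
  open ≤-Reasoning
  cancel : ∀ r t → r ℤ.+ t ℤ.- r ≡ t
  cancel = ℤR.solve-∀
  residue-≤ : ∀ {x} → x ∈ residues Q → ∣ x ∣ ≤ Q
  residue-≤ x∈ with a , a∈ , refl ← ∈-map⁻ pos x∈ = <⇒≤ (∈-upTo⁻ a∈)

-- Pairs of a quotient and a residue exceed the box by a bounded factor only: c Q ≤ H + Q and Q ≤ H
-- give (2c + 1) Q ≤ 5 H. As 5 does not depend on Q, the primes may be chosen after the saving K.
length-quotients : ∀ {Q H} → 0 < Q → Q ≤ H → length (range ((H + Q) ÷ Q)) * Q ≤ 5 * H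
length-quotients {Q} {H} 0<Q Q≤H = begin
  length (range c) * Q           ≡⟨ cong (_* Q) (length-range c) ⟩
  suc (c + c) * Q                ≡⟨ shuffle₁ c Q ⟩
  2 * (c * Q) + Q                ≤⟨ +-mono-≤ (*-monoʳ-≤ 2 (≤-trans (÷-*-≤ (H + Q) Q) (+-monoʳ-≤ H Q≤H))) Q≤H ⟩
  2 * (H + H) + H                ≡⟨ shuffle₂ H ⟩
  5 * H                          ∎
  where
  open ≤-Reasoning
  c = (H + Q) ÷ Q
  shuffle₁ : ∀ c Q → suc (c + c) * Q ≡ 2 * (c * Q) + Q
  shuffle₁ = solve-∀
  shuffle₂ : ∀ H → 2 * (H + H) + H ≡ 5 * H
  shuffle₂ = solve-∀

Bounded : ℕ → ∀ {k n} → Vec (Vec ℤ n) k → Set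
Bounded b = VecAll (VecAll (λ x → ∣ x ∣ ≤ b))

M⇒bounded : ∀ {n H A} → A ∈ M n H → Bounded H A
M⇒bounded A∈ = VAll.map (VAll.map ∈-range⁻ ∘ ∈-allVecs⁻) (∈-allVecs⁻ A∈)

bounded⇒M : ∀ {n H A} → Bounded H A → A ∈ M n H
bounded⇒M A≤ = ∈-allVecs⁺ (VAll.map (∈-allVecs⁺ ∘ VAll.map ∈-range⁺) A≤)

M-unique : ∀ n H → Unique (M n H)
M-unique n H = allVecs-unique n (allVecs-unique n (range-unique H))

⊛-bounded : ∀ {H b k n} {a : Vec ℤ k} {B : Vec (Vec ℤ n) k} → VecAll (λ x → ∣ x ∣ ≤ H) a →
  Bounded b B → VecAll (λ x → ∣ x ∣ ≤ k * H * b) (a ⊛ B)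
⊛-bounded {n = n} [] [] = zeros n
  where
  zeros : ∀ n → VecAll (λ x → ∣ x ∣ ≤ 0) (replicate n (pos 0))
  zeros zero = []
  zeros (suc n) = z≤n ∷ zeros n
⊛-bounded {H} {b} {suc k} {a = x ∷ a} {y ∷ B} (x≤ ∷ a≤) (y≤ ∷ B≤) = go y≤ (⊛-bounded a≤ B≤)
  where
  open ≤-Reasoning
  go : ∀ {n} {u v : Vec ℤ n} → VecAll (λ y → ∣ y ∣ ≤ b) u → VecAll (λ z → ∣ z ∣ ≤ k * H * b) v →
    VecAll (λ t → ∣ t ∣ ≤ suc k * H * b) (zipWith (λ y z → x ℤ.* y ℤ.+ z) u v)
  go [] [] = []
  go {u = y ∷ _} {z ∷ _} (y≤ ∷ u≤) (z≤ ∷ v≤) = (begin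
    ∣ x ℤ.* y ℤ.+ z ∣      ≤⟨ ℤP.∣i+j∣≤∣i∣+∣j∣ (x ℤ.* y) z ⟩
    ∣ x ℤ.* y ∣ + ∣ z ∣    ≡⟨ cong (_+ ∣ z ∣) (ℤP.abs-* x y) ⟩
    ∣ x ∣ * ∣ y ∣ + ∣ z ∣  ≤⟨ +-mono-≤ (*-mono-≤ x≤ y≤) z≤ ⟩
    H * b + k * H * b      ≡⟨ *-distribʳ-+ b H (k * H) ⟨
    suc k * H * b          ∎) ∷ go u≤ v≤

·-bounded : ∀ {n H b} {A B : Mat n} → Bounded H A → Bounded b B → Bounded (n * H * b) (A · B)
·-bounded {A = A} {B} A≤ B≤ = subst (Bounded _) (sym (·≡map A B))
  (VAllP.map⁺ (VAll.map (λ a≤ → ⊛-bounded a≤ B≤) A≤))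

identity≡kronecker : ∀ n → identity n ≡ tabulate (λ i → tabulate (λ j → kronecker i j))
identity≡kronecker n = begin
  identity n
    ≡⟨ tabulate∘lookup (identity n) ⟨
  tabulate (lookup (identity n))
    ≡⟨ tabulate-cong (λ i → tabulate∘lookup (lookup (identity n) i)) ⟨
  tabulate (λ i → tabulate (lookup (lookup (identity n) i)))
    ≡⟨ tabulate-cong (λ i → tabulate-cong (identity-entry n i)) ⟩
  tabulate (λ i → tabulate (λ j → kronecker i j)) ∎
  where open ≡-Reasoning

identity-bounded : ∀ n → Bounded 1 (identity n)
identity-bounded n = subst (Bounded 1) (sym (identity≡kronecker n))
  (VAllP.tabulate⁺ (λ i → VAllP.tabulate⁺ (kronecker-≤1 i)))
  where
  kronecker-≤1 : ∀ {k} (i j : Fin k) → ∣ kronecker i j ∣ ≤ 1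
  kronecker-≤1 zero zero = ≤-refl
  kronecker-≤1 zero (suc j) = z≤n
  kronecker-≤1 (suc i) zero = z≤n
  kronecker-≤1 (suc i) (suc j) = kronecker-≤1 i j

∏M-bounded : ∀ {n H m} {As : Vec (Mat n) m} → VecAll (Bounded H) As → Bounded ((n * H) ^ m) (∏M As)
∏M-bounded {n} [] = identity-bounded n
∏M-bounded (A≤ ∷ As≤) = ·-bounded A≤ (∏M-bounded As≤)

tuples : ∀ m n H → List (Vec (Mat n) m)
tuples m n H = allVecs m (M n H)

∈-products⁻ : ∀ m {n H X} → X ∈ products m n H → ∃ λ As → As ∈ tuples m n H × X ≡ ∏M As
∈-products⁻ zero (here refl) = [] , here refl , refl
∈-products⁻ (suc m) {n} {H} X∈
  with A , Y , A∈ , Y∈ , refl ← ∈-pairs⁻ _·_ (M n H) (products m n H) X∈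
  with As , As∈ , refl ← ∈-products⁻ m Y∈ = A ∷ As , ∈-pairs⁺ _∷_ A∈ As∈ , refl

-- Upper bound

select : ∀ {P : Set} → Dec P → ℕ → ℕ → ℕ
select (yes _) a b = a
select (no _) a b = b

select-cong : ∀ {P Q : Set} (P? : Dec P) (Q? : Dec Q) → (P → Q) → (Q → P) →
  ∀ {a b} → select P? a b ≡ select Q? a b
select-cong (yes _) (yes _) _ _ = refl
select-cong (no _) (no _) _ _ = refl
select-cong (yes p) (no ¬q) P⇒Q _ = contradiction (P⇒Q p) ¬q
select-cong (no ¬p) (yes q) _ Q⇒P = contradiction (Q⇒P q) ¬p

select-* : ∀ {P : Set} (P? : Dec P) a b c d → a * c ≡ b * d → select P? a b * select P? c d ≡ a * c
select-* (yes _) a b c d eq = refl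
select-* (no _) a b c d eq = sym eq

∑-select : ∀ {P : A → Set} (P? : Decidable P) xs a b →
  ∑ xs (λ x → select (P? x) a b) ≡ a * # P? xs + b * # (λ x → ¬? (P? x)) xs
∑-select P? xs a b = begin
  ∑ xs (λ x → select (P? x) a b)                         ≡⟨ ∑-cong xs (λ {x} _ → split (P? x)) ⟩
  ∑ xs (λ x → a * 𝟙 (P? x) + b * 𝟙 (¬? (P? x)))          ≡⟨ ∑-+ xs _ _ ⟩
  ∑ xs (λ x → a * 𝟙 (P? x)) + ∑ xs (λ x → b * 𝟙 (¬? (P? x)))
                                                         ≡⟨ cong₂ _+_ (∑-*ˡ a xs _) (∑-*ˡ b xs _) ⟩
  a * # P? xs + b * # (λ x → ¬? (P? x)) xs               ∎
  where
  open ≡-Reasoning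
  split : ∀ {P : Set} (P? : Dec P) → select P? a b ≡ a * 𝟙 P? + b * 𝟙 (¬? P?)
  split (yes _) = sym (trans (cong₂ _+_ (*-identityʳ a) (*-zeroʳ b)) (+-identityʳ a))
  split (no _) = sym (trans (cong₂ _+_ (*-zeroʳ a) (*-identityʳ b)) refl)

module ProductDensity
  (m n K : ℕ) (6≤m : 6 ≤ m) (0<n : 0 < n) (ps : List ℕ) (ps-unique : Unique ps)
  (big : ∀ {p} → p ∈ ps → Prime p × 8 < p) (K≤ : K * ∏ ps (λ p → 4 * p ∸ 1) ≤ ∏ ps (4 *_))
  where

  Q = ∏ ps id

  S G N : ℕ → ℕ
  S p = #singular p n
  G p = #regular p n
  N p = S p + G p

  N≡ : ∀ p → N p ≡ (p ^ n) ^ n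
  N≡ p = singular+regular p n

  length-matrices : ∀ p → length (matrices p n n) ≡ N p
  length-matrices p = sym (#-complement (singular? p) (matrices p n n))

  primes : ∀ {p} → p ∈ ps → Prime p
  primes p∈ = proj₁ (big p∈)

  0<p : ∀ {p} → p ∈ ps → 0 < p
  0<p p∈ = prime-pos (primes p∈)

  0<Q : 0 < Q
  0<Q = ∏-pos ps 0<p

  0<N : ∀ {p} → p ∈ ps → 0 < N p
  0<N {p} p∈ = subst (0 <_) (sym (N≡ p))
    (m^n>0 (p ^ n) {{>-nonZero (m^n>0 p {{>-nonZero (0<p p∈)}} n)}} n)

  N≤pS : ∀ {p} → p ∈ ps → N p ≤ p * S p
  N≤pS {p} p∈ = subst (_≤ p * S p) (sym (N≡ p)) (singular-lower (primes p∈) 0<n)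

  -- This is the purpose of p > 8: then π ≤ 2/p ≤ 1/4, as `uniform-saving` requires, and regular
  -- matrices exist.
  4S≤N : ∀ {p} → p ∈ ps → 4 * S p ≤ N p
  4S≤N {p} p∈ = *-cancelˡ-≤ 2 (begin
    2 * (4 * S p)         ≡⟨ *-assoc 2 4 (S p) ⟨
    8 * S p               ≤⟨ *-monoˡ-≤ (S p) (<⇒≤ (proj₂ (big p∈))) ⟩
    p * S p               ≤⟨ singular-upper (primes p∈) 0<n ⟩
    2 * (p ^ n) ^ n       ≡⟨ cong (2 *_) (N≡ p) ⟨
    2 * N p               ∎)
    where open ≤-Reasoning

  0<G : ∀ {p} → p ∈ ps → 0 < G p
  0<G {p} p∈ = positive (S p) (G p) (4S≤N p∈) (0<N p∈)
    where
    positive : ∀ s g → 4 * s ≤ s + g → 0 < s + g → 0 < g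
    positive s (suc g) _ _ = z<s
    positive zero zero _ ()
    positive (suc s) zero le _ = contradiction (+-cancelˡ-≤ (suc s) _ _ le) (λ ())

  -- Up to the denominators D₁ and D₂, w₁ is the weight g_p and w₂ its inverse.
  w₁ w₂ : ℕ → Mat n → ℕ
  w₁ p X = select (singular? p X) (2 * (N p * N p)) (G p * G p)
  w₂ p X = select (singular? p X) (G p * G p) (2 * (N p * N p))

  D₁ D₂ : ℕ → ℕ
  D₁ p = N p * N p
  D₂ p = 2 * (G p * G p)

  w₁*w₂ : ∀ p X → w₁ p X * w₂ p X ≡ D₁ p * D₂ p
  w₁*w₂ p X = trans
    (select-* (singular? p X) (2 * (N p * N p)) (G p * G p) (G p * G p) (2 * (N p * N p))
      (*-comm (2 * (N p * N p)) (G p * G p)))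
    (shuffle (N p * N p) (G p * G p))
    where
    shuffle : ∀ a b → 2 * a * b ≡ a * (2 * b)
    shuffle = solve-∀

  local₁ : ∀ {p} → p ∈ ps →
    4 * p * ∑ (matrices p n n) (w₁ p) ≤ (4 * p ∸ 1) * (D₁ p * length (matrices p n n))
  local₁ {p} p∈ = begin
    4 * p * ∑ (matrices p n n) (w₁ p)
      ≡⟨ cong (4 * p *_) (∑-select (singular? p) (matrices p n n) (2 * (N p * N p)) (G p * G p)) ⟩
    4 * p * (2 * (N p * N p) * S p + G p * G p * G p)
      ≤⟨ uniform-saving p (S p) (G p) (N≤pS p∈) (4S≤N p∈) ⟩
    (4 * p ∸ 1) * (N p * N p * N p)
      ≡⟨ cong (λ l → (4 * p ∸ 1) * (D₁ p * l)) (length-matrices p) ⟨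
    (4 * p ∸ 1) * (D₁ p * length (matrices p n n)) ∎
    where open ≤-Reasoning

  local₂ : ∀ {p} → p ∈ ps → 4 * p * ∑ (allVecs m (matrices p n n)) (w₂ p ∘ ∏M)
    ≤ (4 * p ∸ 1) * (D₂ p * length (allVecs m (matrices p n n)))
  local₂ {p} p∈ = begin
    4 * p * ∑ As (w₂ p ∘ ∏M)
      ≡⟨ cong (4 * p *_) (∑-select (singular? p ∘ ∏M) As (G p * G p) (2 * (N p * N p))) ⟩
    4 * p * (G p * G p * s + 2 * (N p * N p) * t)
      ≤⟨ product-saving p (S p) (G p) s t m 6≤m (0<N p∈) (N≤pS p∈)
           (trans (#-complement (singular? p ∘ ∏M) As) length-As) (regular-products (primes p∈) n m) ⟩
    (4 * p ∸ 1) * (D₂ p * N p ^ m)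
      ≡⟨ cong (λ l → (4 * p ∸ 1) * (D₂ p * l)) length-As ⟨
    (4 * p ∸ 1) * (D₂ p * length As) ∎
    where
    open ≤-Reasoning
    As = allVecs m (matrices p n n)
    s = # (singular? p ∘ ∏M) As
    t = # (λ A → ¬? (singular? p (∏M A))) As
    length-As : length As ≡ N p ^ m
    length-As = trans (length-allVecs m (matrices p n n)) (cong (_^ m) (length-matrices p))

  remM : ℕ → Mat n → Mat n
  remM p = Vec.map (Vec.map (rem p))

  quoM : Mat n → Mat n
  quoM = Vec.map (Vec.map (quo Q))

  separateM : Separating quoM remM ps
  separateM = separating-map (separating-map (chinese-remainder ps-unique primes))

  remM∈ : ∀ {p} → p ∈ ps → ∀ X → remM p X ∈ matrices p n n
  remM∈ p∈ = map∈allVecs′ (map∈allVecs′ (rem∈residues (0<p p∈)))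

  remM-≋ : ∀ p X → remM p X ≋M[ p ] X
  remM-≋ p = map-pointwise (map-pointwise (λ x → ≈-sym x (rem p x) (rem-≈ p x)))

  ≋M-sym : ∀ {p k l} {X Y : Vec (Vec ℤ l) k} → X ≋M[ p ] Y → Y ≋M[ p ] X
  ≋M-sym = PW.sym (PW.sym (λ {x} {y} → ≈-sym x y))

  quoM∈ : ∀ {R X} → X ∈ M n R → quoM X ∈ M n ((R + Q) ÷ Q)
  quoM∈ {R} = map∈allVecs {xs = allVecs n (range R)} (map∈allVecs {xs = range R} (quo∈range 0<Q))

  periodic₁ : ∀ {p} → p ∈ ps → ∀ X → w₁ p (remM p X) ≡ w₁ p X
  periodic₁ {p} _ X = select-cong (singular? p (remM p X)) (singular? p X)
    (singular-≋ (remM-≋ p X)) (singular-≋ (≋M-sym (remM-≋ p X)))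

  periodic₂ : ∀ {p} → p ∈ ps → ∀ (As : Vec (Mat n) m) → w₂ p (∏M (Vec.map (remM p) As)) ≡ w₂ p (∏M As)
  periodic₂ {p} _ As = select-cong (singular? p (∏M (Vec.map (remM p) As))) (singular? p (∏M As))
    (singular-≋ congruent) (singular-≋ (≋M-sym congruent))
    where
    congruent : ∏M (Vec.map (remM p) As) ≋M[ p ] ∏M As
    congruent = ∏M-≋ (map-pointwise (remM-≋ p) As)

  0<D₁ : ∀ {p} → p ∈ ps → 0 < D₁ p
  0<D₁ p∈ = *-mono-< (0<N p∈) (0<N p∈)

  0<D₂ : ∀ {p} → p ∈ ps → 0 < D₂ p
  0<D₂ p∈ = *-mono-< (z<s {1}) (*-mono-< (0<G p∈) (0<G p∈))

  quoMs∈ : ∀ {H As} → As ∈ tuples m n H → Vec.map quoM As ∈ tuples m n ((H + Q) ÷ Q)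
  quoMs∈ {H} = map∈allVecs {xs = M n H} quoM∈

  remMs∈ : ∀ {p} → p ∈ ps → ∀ (As : Vec (Mat n) m) → Vec.map (remM p) As ∈ allVecs m (matrices p n n)
  remMs∈ p∈ = map∈allVecs′ (remM∈ p∈)

  module Uniform (R : ℕ) = Sieve ps K K≤ 0<p quoM remM separateM
    (M n R) (M-unique n R) (M n ((R + Q) ÷ Q)) quoM∈
    (λ p → matrices p n n) remM∈ w₁ periodic₁ D₁ 0<D₁ local₁

  -- A tuple is weighed by its product; reducing all factors modulo p changes the product only
  -- modulo p, so this weight is periodic too.
  module Tuple (H : ℕ) = Sieve ps K K≤ 0<p (Vec.map quoM) (λ p → Vec.map (remM p)) (separating-map separateM)
    (tuples m n H) (allVecs-unique m (M-unique n H)) (tuples m n ((H + Q) ÷ Q)) quoMs∈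
    (λ p → allVecs m (matrices p n n)) remMs∈ (λ p → w₂ p ∘ ∏M) periodic₂ D₂ 0<D₂ local₂

  length-M : ∀ c → length (M n c) ≡ (length (range c) ^ n) ^ n
  length-M c = trans (length-allVecs n (allVecs n (range c))) (cong (_^ n) (length-allVecs n (range c)))

  ∏-length-matrices : ∏ ps (λ p → length (matrices p n n)) ≡ (Q ^ n) ^ n
  ∏-length-matrices = trans (∏-cong ps (λ {p} _ → trans (length-matrices p) (N≡ p)))
    (trans (∏-^ ps (_^ n) n) (cong (_^ n) (∏-^ ps id n)))

  quotient-volume : ∀ {B} → Q ≤ B →
    length (M n ((B + Q) ÷ Q)) * ∏ ps (λ p → length (matrices p n n)) ≤ ((5 * B) ^ n) ^ n
  quotient-volume {B} Q≤B = begin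
    length (M n c) * ∏ ps (λ p → length (matrices p n n))
      ≡⟨ cong₂ _*_ (length-M c) ∏-length-matrices ⟩
    (length (range c) ^ n) ^ n * (Q ^ n) ^ n
      ≡⟨ trans (cong (_^ n) (^-distribʳ-* n (length (range c)) Q)) (^-distribʳ-* n (length (range c) ^ n) (Q ^ n)) ⟨
    ((length (range c) * Q) ^ n) ^ n
      ≤⟨ ^-monoˡ-≤ n (^-monoˡ-≤ n (length-quotients 0<Q Q≤B)) ⟩
    ((5 * B) ^ n) ^ n ∎
    where
    open ≤-Reasoning
    c = (B + Q) ÷ Q

  quotient-volumeᵐ : ∀ {H} → Q ≤ H →
    length (tuples m n ((H + Q) ÷ Q)) * ∏ ps (λ p → length (allVecs m (matrices p n n)))
      ≤ (((5 * H) ^ n) ^ n) ^ m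
  quotient-volumeᵐ {H} Q≤H = begin
    length (tuples m n c) * ∏ ps (λ p → length (allVecs m (matrices p n n)))
      ≡⟨ cong₂ _*_ (length-allVecs m (M n c))
           (trans (∏-cong ps (λ {p} _ → length-allVecs m (matrices p n n))) (∏-^ ps _ m)) ⟩
    length (M n c) ^ m * ∏ ps (λ p → length (matrices p n n)) ^ m
      ≡⟨ ^-distribʳ-* m (length (M n c)) _ ⟨
    (length (M n c) * ∏ ps (λ p → length (matrices p n n))) ^ m
      ≤⟨ ^-monoˡ-≤ m (quotient-volume Q≤H) ⟩
    (((5 * H) ^ n) ^ n) ^ m ∎
    where
    open ≤-Reasoning
    c = (H + Q) ÷ Q

  module _ (H : ℕ) where

    private
      R = (n * H) ^ m
      module U = Uniform R
      module T = Tuple H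

    -- By `w₁*w₂` the two weights multiply to exactly the product of their thresholds, so they
    -- cannot both lie below.
    heavy : ∀ As → ∏ ps D₁ ≤ U.weight (∏M As) ⊎ ∏ ps D₂ ≤ T.weight As
    heavy As with ∏ ps D₁ ≤? U.weight (∏M As) | ∏ ps D₂ ≤? T.weight As
    ... | yes le | _ = inj₁ le
    ... | no _ | yes le = inj₂ le
    ... | no ≰₁ | no ≰₂ = contradiction (begin-equality
      U.weight (∏M As) * T.weight As                    ≡⟨ ∏-* ps _ _ ⟨
      ∏ ps (λ p → w₁ p (∏M As) * w₂ p (∏M As))          ≡⟨ ∏-cong ps (λ {p} _ → w₁*w₂ p (∏M As)) ⟩
      ∏ ps (λ p → D₁ p * D₂ p)                          ≡⟨ ∏-* ps D₁ D₂ ⟩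
      ∏ ps D₁ * ∏ ps D₂                                 ∎) (<⇒≢ (*-mono-< (≰⇒> ≰₁) (≰⇒> ≰₂)))
      where open ≤-Reasoning

    -- Products with g ≥ 1 are counted as matrices in the box of height `R`, the others through a
    -- tuple producing them.
    #W-split : #W m n H ≤ # U.heavy? (M n R) + # T.heavy? (tuples m n H)
    #W-split = begin
      #W m n H
        ≤⟨ length-⊆ (UniqueDP.deduplicate-! _≟M_ (products m n H)) covered ⟩
      length (filter U.heavy? (M n R) ++ map ∏M (filter T.heavy? (tuples m n H)))
        ≡⟨ length-++ (filter U.heavy? (M n R)) ⟩
      length (filter U.heavy? (M n R)) + length (map ∏M (filter T.heavy? (tuples m n H)))
        ≡⟨ cong₂ _+_ (length-filter-# U.heavy? (M n R))
             (trans (length-map ∏M (filter T.heavy? (tuples m n H))) (length-filter-# T.heavy? (tuples m n H))) ⟩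
      # U.heavy? (M n R) + # T.heavy? (tuples m n H) ∎
      where
      open ≤-Reasoning
      covered : ∀ {X} → X ∈ deduplicate _≟M_ (products m n H) →
        X ∈ filter U.heavy? (M n R) ++ map ∏M (filter T.heavy? (tuples m n H))
      covered X∈ with As , As∈ , refl ← ∈-products⁻ m (∈-deduplicate⁻ _≟M_ (products m n H) X∈)
        with heavy As
      ... | inj₁ le = ∈-++⁺ˡ (∈-filter⁺ U.heavy?
              (bounded⇒M (∏M-bounded (VAll.map M⇒bounded (∈-allVecs⁻ As∈)))) le)
      ... | inj₂ le = ∈-++⁺ʳ (filter U.heavy? (M n R)) (∈-map⁺ ∏M (∈-filter⁺ T.heavy? As∈ le))

    #W-bound : Q ≤ H → Q ≤ R → K * #W m n H ≤ ((5 * R) ^ n) ^ n + (((5 * H) ^ n) ^ n) ^ m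
    #W-bound Q≤H Q≤B = begin
      K * #W m n H
        ≤⟨ *-monoʳ-≤ K #W-split ⟩
      K * (# U.heavy? (M n R) + # T.heavy? (tuples m n H))
        ≡⟨ *-distribˡ-+ K (# U.heavy? (M n R)) _ ⟩
      K * # U.heavy? (M n R) + K * # T.heavy? (tuples m n H)
        ≤⟨ +-mono-≤ (≤-trans U.heavy-rare (quotient-volume Q≤B)) (≤-trans T.heavy-rare (quotient-volumeᵐ Q≤H)) ⟩
      ((5 * R) ^ n) ^ n + (((5 * H) ^ n) ^ n) ^ m ∎
      where open ≤-Reasoning

base≤power : ∀ a {e} → 0 < e → a ≤ a ^ e
base≤power zero _ = z≤n
base≤power (suc a) {suc e} _ = m≤m*n (suc a) (suc a ^ e) {{>-nonZero (m^n>0 (suc a) e)}}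

-- The two summands are the coefficients of H^(m n²) in the bounds for the box of height (n H)^m and
-- for the m-tuples.
scaleConstant : ℕ → ℕ → ℕ
scaleConstant m n = ((5 * n ^ m) ^ n) ^ n + ((5 ^ n) ^ n) ^ m

module _ (m n : ℕ) (6≤m : 6 ≤ m) (0<n : 0 < n) (p q : ℕ)
  (ps : List ℕ) (uniq : Unique ps) (big : ∀ {p} → p ∈ ps → Prime p × 8 < p)
  (K≤ : 2 * suc q * scaleConstant m n * ∏ ps (λ p → 4 * p ∸ 1) ≤ ∏ ps (4 *_))
  where

  private
    open module PD = ProductDensity m n (2 * suc q * scaleConstant m n) 6≤m 0<n ps uniq big K≤
      using (Q; 0<Q; #W-bound)
    C₁ = ((5 * n ^ m) ^ n) ^ n
    C₂ = ((5 ^ n) ^ n) ^ m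

  -- With C = `scaleConstant m n`, a saving of 2 (q + 1) C against the volume C H^(m n²) gives 2 (q
  -- + 1) #W ≤ H^(m n²). The factor 2 makes the inequality strict, and reaching 1/(q + 1) settles
  -- every (p + 1)/(q + 1).
  #W-sparse-beyond : ∀ H → ∏ ps id ≤ H → suc q * #W m n H < suc p * H ^ (m * (n * n))
  #W-sparse-beyond H Q≤H = begin-strict
    suc q * #W m n H              <⟨ half<whole (suc q * #W m n H) V 0<V half ⟩
    V                             ≤⟨ m≤n*m V (suc p) ⟩
    suc p * V                     ∎
    where
    open ≤-Reasoning
    V = H ^ (m * (n * n))
    0<H = ≤-trans 0<Q Q≤H
    0<V : 0 < V
    0<V = m^n>0 H {{>-nonZero 0<H}} (m * (n * n))
    half<whole : ∀ a b → 0 < b → 2 * a ≤ b → a < b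
    half<whole zero b 0<b _ = 0<b
    half<whole (suc a) b _ le = ≤-trans (s≤s (m≤n+m (suc a) a)) (≤-trans (≤-reflexive (cong (λ t → suc (a + t)) (sym (+-identityʳ (suc a))))) le)
    Q≤B : Q ≤ (n * H) ^ m
    Q≤B = ≤-trans Q≤H (≤-trans (m≤n*m H n {{>-nonZero 0<n}}) (base≤power (n * H) (≤-trans (s≤s z≤n) 6≤m)))
    volume₁ : ((5 * (n * H) ^ m) ^ n) ^ n ≡ C₁ * V
    volume₁ = begin-equality
      ((5 * (n * H) ^ m) ^ n) ^ n            ≡⟨ cong (λ t → ((5 * t) ^ n) ^ n) (^-distribʳ-* m n H) ⟩
      ((5 * (n ^ m * H ^ m)) ^ n) ^ n        ≡⟨ cong (λ t → (t ^ n) ^ n) (*-assoc 5 (n ^ m) (H ^ m)) ⟨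
      ((5 * n ^ m * H ^ m) ^ n) ^ n          ≡⟨ cong (_^ n) (^-distribʳ-* n (5 * n ^ m) (H ^ m)) ⟩
      ((5 * n ^ m) ^ n * (H ^ m) ^ n) ^ n    ≡⟨ ^-distribʳ-* n ((5 * n ^ m) ^ n) ((H ^ m) ^ n) ⟩
      C₁ * ((H ^ m) ^ n) ^ n                 ≡⟨ cong (C₁ *_) (trans (^-*-assoc (H ^ m) n n) (^-*-assoc H m (n * n))) ⟩
      C₁ * V                                 ∎
    volume₂ : (((5 * H) ^ n) ^ n) ^ m ≡ C₂ * V
    volume₂ = begin-equality
      (((5 * H) ^ n) ^ n) ^ m                ≡⟨ cong (λ t → (t ^ n) ^ m) (^-distribʳ-* n 5 H) ⟩
      ((5 ^ n * H ^ n) ^ n) ^ m              ≡⟨ cong (_^ m) (^-distribʳ-* n (5 ^ n) (H ^ n)) ⟩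
      ((5 ^ n) ^ n * (H ^ n) ^ n) ^ m        ≡⟨ ^-distribʳ-* m ((5 ^ n) ^ n) ((H ^ n) ^ n) ⟩
      C₂ * ((H ^ n) ^ n) ^ m                 ≡⟨ cong (λ t → C₂ * t ^ m) (^-*-assoc H n n) ⟩
      C₂ * (H ^ (n * n)) ^ m                 ≡⟨ cong (C₂ *_) (trans (^-*-assoc H (n * n) m) (cong (H ^_) (*-comm (n * n) m))) ⟩
      C₂ * V                                 ∎
    shuffle : ∀ C a w → C * (2 * (a * w)) ≡ 2 * a * C * w
    shuffle = solve-∀
    0<C : 0 < C₁ + C₂
    0<C = ≤-trans (m^n>0 ((5 ^ n) ^ n) {{>-nonZero (m^n>0 (5 ^ n) {{>-nonZero (m^n>0 5 n)}} n)}} m) (m≤n+m C₂ C₁)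
    half : 2 * (suc q * #W m n H) ≤ V
    half = *-cancelˡ-≤ (C₁ + C₂) {{>-nonZero 0<C}} (begin
      (C₁ + C₂) * (2 * (suc q * #W m n H))   ≡⟨ shuffle (C₁ + C₂) (suc q) (#W m n H) ⟩
      2 * suc q * (C₁ + C₂) * #W m n H       ≤⟨ #W-bound H Q≤H Q≤B ⟩
      ((5 * (n * H) ^ m) ^ n) ^ n + (((5 * H) ^ n) ^ n) ^ m
                                             ≡⟨ cong₂ _+_ volume₁ volume₂ ⟩
      C₁ * V + C₂ * V                        ≡⟨ *-distribʳ-+ V C₁ C₂ ⟨
      (C₁ + C₂) * V                          ∎)

#W-sparse : ∀ m n → 6 ≤ m → 0 < n → (p q : ℕ) → ∃ λ H₀ → (H : ℕ) → H₀ ≤ H →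
  suc q * #W m n H < suc p * H ^ (m * (n * n))
#W-sparse m n 6≤m 0<n p q =
  let ps , uniq , big , K≤ = manyPrimes (2 * suc q * scaleConstant m n) 8
  in ∏ ps id , #W-sparse-beyond m n 6≤m 0<n p q ps uniq big K≤

-- Divisors of rough numbers, and diagonal matrices

Rough : ℕ → ℕ → Set
Rough b x = ∀ {p} → Prime p → p ∣ x → b ≤ p

divisors : ℕ → List ℕ
divisors x = filter (_∣? x) [1⋯ x ]

∈-divisors⁺ : ∀ {d x} → 0 < x → d ∣ x → d ∈ divisors x
∈-divisors⁺ {d} {x} 0<x d∣x@(divides c refl) =
  ∈-filter⁺ (_∣? x) (∈-[1⋯]⁺ (factor-pos {d} {c} (subst (0 <_) (*-comm c d) 0<x)) (∣⇒≤ {{>-nonZero 0<x}} d∣x)) d∣x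

prime-∤⇒coprime : ∀ {p d} → Prime p → ¬ p ∣ d → Coprime d p
prime-∤⇒coprime isPrime p∤d (e∣d , e∣p) with prime⇒irreducible isPrime e∣p
... | inj₁ e≡1 = e≡1
... | inj₂ refl = contradiction e∣d p∤d

-- Each prime factor at most doubles the number of divisors while multiplying x by at least 2 ^ k.
rough-divisorList : ∀ k x → 0 < x → Rough (2 ^ k) x →
  ∃ λ ds → (∀ {d} → d ∣ x → d ∈ ds) × length ds ^ k ≤ x
rough-divisorList k x = go x (<-wellFounded x)
  where
  go : ∀ x → Acc _<_ x → 0 < x → Rough (2 ^ k) x →
    ∃ λ ds → (∀ {d} → d ∣ x → d ∈ ds) × length ds ^ k ≤ x
  go x (acc rec) 0<x rough with m≤n⇒m<n∨m≡n 0<x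
  ... | inj₂ refl = 1 ∷ [] , (λ d∣1 → here (∣1⇒≡1 d∣1)) , ≤-reflexive (^-zeroˡ k)
  ... | inj₁ 1<x with p , isPrime , divides y refl ← primeDivisor 1<x
    with ds , complete , small ← go y
      (rec (m<m*n y p {{>-nonZero (factor-pos {y} 0<x)}} (nonTrivial⇒n>1 p {{prime⇒nonTrivial isPrime}})))
      (factor-pos {y} 0<x) (λ isPrime′ p∣y → rough isPrime′ (∣m⇒∣m*n p p∣y)) =
    ds ++ map (p *_) ds , complete′ , (begin
      length (ds ++ map (p *_) ds) ^ k       ≡⟨ cong (_^ k) doubled ⟩
      (2 * length ds) ^ k                    ≡⟨ ^-distribʳ-* k 2 (length ds) ⟩
      2 ^ k * length ds ^ k                  ≤⟨ *-mono-≤ (rough isPrime (n∣m*n y)) small ⟩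
      p * y                                  ≡⟨ *-comm p y ⟩
      y * p                                  ∎)
    where
    open ≤-Reasoning
    doubled : length (ds ++ map (p *_) ds) ≡ 2 * length ds
    doubled = trans (length-++ ds) (cong (length ds +_)
      (trans (length-map (p *_) ds) (sym (+-identityʳ (length ds)))))
    complete′ : ∀ {d} → d ∣ y * p → d ∈ ds ++ map (p *_) ds
    complete′ {d} d∣yp with p ∣? d
    ... | yes (divides e refl) = ∈-++⁺ʳ ds (subst (_∈ map (p *_) ds) (*-comm p e)
      (∈-map⁺ (p *_) (complete (*-cancelʳ-∣ p {{prime⇒nonZero isPrime}} d∣yp))))
    ... | no p∤d = ∈-++⁺ˡ (complete
      (coprime-divisor (prime-∤⇒coprime isPrime p∤d) (subst (d ∣_) (*-comm y p) d∣yp)))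

rough-divisors : ∀ k x → 0 < x → Rough (2 ^ k) x → length (divisors x) ^ k ≤ x
rough-divisors k x 0<x rough =
  let ds , complete , small = rough-divisorList k x 0<x rough
  in ≤-trans (^-monoˡ-≤ k (length-⊆ (UniqueP.filter⁺ (_∣? x) ([1⋯]-unique x))
       (λ d∈ → complete (proj₂ (∈-filter⁻ (_∣? x) {xs = [1⋯ x ]} d∈))))) small

^-cancelʳ-≤ : ∀ {a b} e → 0 < e → a ^ e ≤ b ^ e → a ≤ b
^-cancelʳ-≤ {a} {b} e 0<e le with a ≤? b
... | yes a≤b = a≤b
... | no a≰b = contradiction le (<⇒≱ (^-monoˡ-< e {{>-nonZero 0<e}} (≰⇒> a≰b)))

-- Converts a bound on the k-th power of a divisor number into a natural number bounding the divisor
-- number itself.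
integerRoot : ∀ k → 0 < k → ∀ b → ∃ λ r → r ^ k ≤ b × (∀ {t} → t ^ k ≤ b → t ≤ r)
integerRoot k@(suc _) 0<k zero = 0 , z≤n , λ {t} le → ^-cancelʳ-≤ k 0<k le
integerRoot k 0<k (suc b) with r , r^k≤ , max ← integerRoot k 0<k b with suc r ^ k ≤? suc b
... | yes le = suc r , le , λ {t} t^k≤ → ^-cancelʳ-≤ k 0<k (next t t^k≤)
  where
  next : ∀ t → t ^ k ≤ suc b → t ^ k ≤ suc r ^ k
  next t t^k≤ with m≤n⇒m<n∨m≡n t^k≤
  ... | inj₁ t^k< = ^-monoˡ-≤ k (m≤n⇒m≤1+n (max (≤-pred t^k<)))
  ... | inj₂ t^k≡ with suc r ^ k ≤? b
  ...   | yes le′ = contradiction (max le′) (<⇒≱ (n<1+n r))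
  ...   | no ≰b = ≤-trans (≤-reflexive t^k≡) (≰⇒> ≰b)
... | no ≰ = r , m≤n⇒m≤1+n r^k≤ , λ {t} t^k≤ → ≤-pred (≰⇒> (λ r<t → ≰ (≤-trans (^-monoˡ-≤ k r<t) t^k≤)))

<-÷ : ∀ N {q} → 0 < q → N < suc (N ÷ q) * q
<-÷ N {suc q} _ = begin-strict
  N                                        ≡⟨ m≡m%n+[m/n]*n N (suc q) ⟩
  N % suc q + N / suc q * suc q            <⟨ +-monoˡ-< (N / suc q * suc q) (m%n<n N (suc q)) ⟩
  suc q + N / suc q * suc q                ∎
  where open ≤-Reasoning

-- Products of diagonal matrices

diag : ∀ {n} → Vec ℤ n → Vec (Vec ℤ n) n
diag [] = []
diag (d ∷ ds) = (d ∷ replicate _ (pos 0)) ∷ Vec.map (pos 0 ∷_) (diag ds)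

⊛-zeroColumn : ∀ {k n} (a : Vec ℤ k) (B : Vec (Vec ℤ n) k) →
  a ⊛ Vec.map (pos 0 ∷_) B ≡ pos 0 ∷ (a ⊛ B)
⊛-zeroColumn [] [] = refl
⊛-zeroColumn (x ∷ a) (b ∷ B) rewrite ⊛-zeroColumn a B =
  cong (_∷ zipWith (λ y z → x ℤ.* y ℤ.+ z) b (a ⊛ B)) (trans (ℤP.+-identityʳ _) (ℤP.*-zeroʳ x))

⊛-diag : ∀ {n} (a d : Vec ℤ n) → a ⊛ diag d ≡ zipWith ℤ._*_ a d
⊛-diag [] [] = refl
⊛-diag (x ∷ a) (y ∷ d) rewrite ⊛-zeroColumn a (diag d) = cong₂ _∷_ (ℤP.+-identityʳ (x ℤ.* y))
  (trans (absorb (a ⊛ diag d)) (⊛-diag a d))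
  where
  absorb : ∀ {n} (v : Vec ℤ n) → zipWith (λ y z → x ℤ.* y ℤ.+ z) (replicate n (pos 0)) v ≡ v
  absorb [] = refl
  absorb (z ∷ v) = cong₂ _∷_ (trans (cong (ℤ._+ z) (ℤP.*-zeroʳ x)) (ℤP.+-identityˡ z)) (absorb v)

identity≡diag : ∀ n → identity n ≡ diag (replicate n (pos 1))
identity≡diag n = trans (identity≡kronecker n) (go n)
  where
  zeros : ∀ n → tabulate {n = n} (λ _ → pos 0) ≡ replicate n (pos 0)
  zeros zero = refl
  zeros (suc n) = cong (pos 0 ∷_) (zeros n)
  go : ∀ n → tabulate (λ i → tabulate (λ j → kronecker i j)) ≡ diag (replicate n (pos 1))
  go zero = refl
  go (suc n) = cong₂ _∷_ (cong (pos 1 ∷_) (zeros n))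
    (trans (tabulate-∘ (pos 0 ∷_) (λ i → tabulate (λ j → kronecker i j))) (cong (Vec.map (pos 0 ∷_)) (go n)))

_⊙_ : ∀ {n} → Vec ℕ n → Vec ℕ n → Vec ℕ n
_⊙_ = zipWith _*_

posV : ∀ {n} → Vec ℕ n → Vec ℤ n
posV = Vec.map pos

diagℕ : ∀ {n} → Vec ℕ n → Mat n
diagℕ d = diag (posV d)

posV-⊙ : ∀ {n} (u v : Vec ℕ n) → zipWith ℤ._*_ (posV u) (posV v) ≡ posV (u ⊙ v)
posV-⊙ [] [] = refl
posV-⊙ (x ∷ u) (y ∷ v) = cong₂ _∷_ (sym (ℤP.pos-* x y)) (posV-⊙ u v)

·-diag : ∀ {k n} (A : Vec (Vec ℕ n) k) (g : Vec ℕ n) →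
  Vec.map (_⊛ diagℕ g) (Vec.map posV A) ≡ Vec.map posV (Vec.map (_⊙ g) A)
·-diag [] g = refl
·-diag (a ∷ A) g = cong₂ _∷_ (trans (⊛-diag (posV a) (posV g)) (posV-⊙ a g)) (·-diag A g)

-- `diag` with natural entries, so that the column scaling rule `·-diag` also multiplies diagonal
-- matrices with each other.
diagMatrix : ∀ {n} → Vec ℕ n → Vec (Vec ℕ n) n
diagMatrix [] = []
diagMatrix (d ∷ ds) = (d ∷ replicate _ 0) ∷ Vec.map (0 ∷_) (diagMatrix ds)

posV-replicate : ∀ n x → posV (replicate n x) ≡ replicate n (pos x)
posV-replicate n x = VecP.map-replicate pos x n

diagℕ≡ : ∀ {n} (d : Vec ℕ n) → diagℕ d ≡ Vec.map posV (diagMatrix d)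
diagℕ≡ [] = refl
diagℕ≡ (x ∷ d) = cong₂ _∷_ (cong (pos x ∷_) (sym (posV-replicate _ 0))) (begin
  Vec.map (pos 0 ∷_) (diag (posV d))                ≡⟨ cong (Vec.map (pos 0 ∷_)) (diagℕ≡ d) ⟩
  Vec.map (pos 0 ∷_) (Vec.map posV (diagMatrix d))  ≡⟨ VecP.map-∘ (pos 0 ∷_) posV (diagMatrix d) ⟨
  Vec.map (posV ∘ (0 ∷_)) (diagMatrix d)            ≡⟨ VecP.map-∘ posV (0 ∷_) (diagMatrix d) ⟩
  Vec.map posV (Vec.map (0 ∷_) (diagMatrix d))      ∎)
  where open ≡-Reasoning

diagMatrix-⊙ : ∀ {n} (d g : Vec ℕ n) → Vec.map (_⊙ g) (diagMatrix d) ≡ diagMatrix (d ⊙ g)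
diagMatrix-⊙ [] [] = refl
diagMatrix-⊙ (x ∷ d) (y ∷ g) = cong₂ _∷_ (cong (x * y ∷_) (zeros g)) (begin
  Vec.map (_⊙ (y ∷ g)) (Vec.map (0 ∷_) (diagMatrix d))  ≡⟨ VecP.map-∘ (_⊙ (y ∷ g)) (0 ∷_) (diagMatrix d) ⟨
  Vec.map ((0 ∷_) ∘ (_⊙ g)) (diagMatrix d)              ≡⟨ VecP.map-∘ (0 ∷_) (_⊙ g) (diagMatrix d) ⟩
  Vec.map (0 ∷_) (Vec.map (_⊙ g) (diagMatrix d))        ≡⟨ cong (Vec.map (0 ∷_)) (diagMatrix-⊙ d g) ⟩
  Vec.map (0 ∷_) (diagMatrix (d ⊙ g))                   ∎)
  where
  open ≡-Reasoning
  zeros : ∀ {n} (g : Vec ℕ n) → replicate n 0 ⊙ g ≡ replicate n 0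
  zeros [] = refl
  zeros (_ ∷ g) = cong (0 ∷_) (zeros g)

-- Entry j is the factor by which the diagonal matrices together scale column j of the matrix in
-- front of them.
columnProducts : ∀ {m n} → Vec (Vec ℕ n) m → Vec ℕ n
columnProducts [] = replicate _ 1
columnProducts (d ∷ ds) = d ⊙ columnProducts ds

∏M-diag : ∀ {m n} (ds : Vec (Vec ℕ n) m) → ∏M (Vec.map diagℕ ds) ≡ diagℕ (columnProducts ds)
∏M-diag {n = n} [] = trans (identity≡diag n) (cong diag (sym (posV-replicate n 1)))
∏M-diag (d ∷ ds) = begin
  diagℕ d · ∏M (Vec.map diagℕ ds)                            ≡⟨ ·≡map (diagℕ d) (∏M (Vec.map diagℕ ds)) ⟩
  Vec.map (_⊛ ∏M (Vec.map diagℕ ds)) (diagℕ d)               ≡⟨ cong₂ (λ X D → Vec.map (_⊛ X) D) (∏M-diag ds) (diagℕ≡ d) ⟩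
  Vec.map (_⊛ diagℕ g) (Vec.map posV (diagMatrix d))         ≡⟨ ·-diag (diagMatrix d) g ⟩
  Vec.map posV (Vec.map (_⊙ g) (diagMatrix d))               ≡⟨ cong (Vec.map posV) (diagMatrix-⊙ d g) ⟩
  Vec.map posV (diagMatrix (d ⊙ g))                          ≡⟨ diagℕ≡ (d ⊙ g) ⟨
  diagℕ (d ⊙ g)                                              ∎
  where
  open ≡-Reasoning
  g = columnProducts ds

scaled : ∀ {m n} → Vec (Vec ℕ n) m → Vec (Vec ℕ n) n → Mat n
scaled ds A = Vec.map posV (Vec.map (_⊙ columnProducts ds) A)

∏M-scaled : ∀ {m n} (ds : Vec (Vec ℕ n) m) (A : Vec (Vec ℕ n) n) →
  ∏M (Vec.map posV A ∷ Vec.map diagℕ ds) ≡ scaled ds A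
∏M-scaled ds A = begin
  Vec.map posV A · ∏M (Vec.map diagℕ ds)
    ≡⟨ ·≡map (Vec.map posV A) (∏M (Vec.map diagℕ ds)) ⟩
  Vec.map (_⊛ ∏M (Vec.map diagℕ ds)) (Vec.map posV A)
    ≡⟨ cong (λ X → Vec.map (_⊛ X) (Vec.map posV A)) (∏M-diag ds) ⟩
  Vec.map (_⊛ diagℕ (columnProducts ds)) (Vec.map posV A)
    ≡⟨ ·-diag A (columnProducts ds) ⟩
  scaled ds A ∎
  where open ≡-Reasoning

∈-products⁺ : ∀ {m n H} {As : Vec (Mat n) m} → VecAll (_∈ M n H) As → ∏M As ∈ products m n H
∈-products⁺ [] = here refl
∈-products⁺ (A∈ ∷ As∈) = ∈-pairs⁺ _·_ A∈ (∈-products⁺ As∈)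

-- Lower bound

∏V : ∀ {n} → Vec ℕ n → ℕ
∏V [] = 1
∏V (x ∷ v) = x * ∏V v

∣∏V : ∀ {n} (v : Vec ℕ n) → VecAll (_∣ ∏V v) v
∣∏V [] = []
∣∏V (x ∷ v) = m∣m*n (∏V v) ∷ VAll.map (∣n⇒∣m*n x) (∣∏V v)

∣⊙ʳ : ∀ {n} {u v : Vec ℕ n} (a : Vec ℕ n) → Pointwise _∣_ u v → Pointwise _∣_ u (a ⊙ v)
∣⊙ʳ [] [] = []
∣⊙ʳ (x ∷ a) (x∣ ∷ u∣) = ∣n⇒∣m*n x x∣ ∷ ∣⊙ʳ a u∣

∣⊙ˡ : ∀ {n} (u v : Vec ℕ n) → Pointwise _∣_ u (u ⊙ v)
∣⊙ˡ [] [] = []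
∣⊙ˡ (x ∷ u) (y ∷ v) = m∣m*n y ∷ ∣⊙ˡ u v

∣columnProducts : ∀ {m n} (ds : Vec (Vec ℕ n) m) → VecAll (λ d → Pointwise _∣_ d (columnProducts ds)) ds
∣columnProducts [] = []
∣columnProducts (d ∷ ds) = ∣⊙ˡ d (columnProducts ds) ∷ VAll.map (∣⊙ʳ d) (∣columnProducts ds)

pointwise∣⇒all∣ : ∀ {n z} {u v : Vec ℕ n} → Pointwise _∣_ u v → VecAll (_∣ z) v → VecAll (_∣ z) u
pointwise∣⇒all∣ [] [] = []
pointwise∣⇒all∣ (x∣ ∷ u∣) (y∣ ∷ v∣) = ∣-trans x∣ y∣ ∷ pointwise∣⇒all∣ u∣ v∣

-- Every diagonal entry of the factors of a product X divides firstRowNorm X.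
firstRowNorm : ∀ {k n} → Vec (Vec ℤ n) k → ℕ
firstRowNorm [] = 1
firstRowNorm (r ∷ _) = ∏V (Vec.map ∣_∣ r)

abs-posV : ∀ {n} (v : Vec ℕ n) → Vec.map ∣_∣ (posV v) ≡ v
abs-posV v = trans (sym (VecP.map-∘ ∣_∣ pos v)) (VecP.map-id v)

module RoughBox (b H : ℕ) where

  -- The index `e` counts how many numbers of height at most `H` have been multiplied; it adds up to
  -- n (m + 1) for the product of a first row.
  record Nice (e x : ℕ) : Set where
    constructor nice
    field
      positive : 0 < x
      bounded : x ≤ H ^ e
      isRough : Rough b x

  nice-1 : Nice 0 1
  nice-1 = nice z<s ≤-refl (λ isPrime p∣1 → ⊥-elim (¬prime[1] (subst Prime (∣1⇒≡1 p∣1) isPrime)))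

  nice-* : ∀ {e f x y} → Nice e x → Nice f y → Nice (e + f) (x * y)
  nice-* {e} {f} {x} {y} (nice 0<x x≤ rx) (nice 0<y y≤ ry) = nice
    (*-mono-< 0<x 0<y)
    (≤-trans (*-mono-≤ x≤ y≤) (≤-reflexive (sym (^-distribˡ-+-* H e f))))
    (λ isPrime p∣xy → [ rx isPrime , ry isPrime ]′ (euclidsLemma x y isPrime p∣xy))

  nice-⊙ : ∀ {e f n} {u v : Vec ℕ n} → VecAll (Nice e) u → VecAll (Nice f) v → VecAll (Nice (e + f)) (u ⊙ v)
  nice-⊙ [] [] = []
  nice-⊙ (x ∷ u) (y ∷ v) = nice-* x y ∷ nice-⊙ u v

  nice-columnProducts : ∀ {m n} {ds : Vec (Vec ℕ n) m} → VecAll (VecAll (Nice 1)) ds →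
    VecAll (Nice m) (columnProducts ds)
  nice-columnProducts {n = n} [] = ones n
    where
    ones : ∀ n → VecAll (Nice 0) (replicate n 1)
    ones zero = []
    ones (suc n) = nice-1 ∷ ones n
  nice-columnProducts (d ∷ ds) = nice-⊙ d (nice-columnProducts ds)

  nice-∏V : ∀ {e n} {v : Vec ℕ n} → VecAll (Nice e) v → Nice (n * e) (∏V v)
  nice-∏V [] = nice-1
  nice-∏V (x ∷ v) = nice-* x (nice-∏V v)

⊙-cancelʳ : ∀ {n} {g u v : Vec ℕ n} → VecAll (0 <_) g → u ⊙ g ≡ v ⊙ g → u ≡ v
⊙-cancelʳ {u = []} {[]} [] _ = refl
⊙-cancelʳ {g = z ∷ g} {x ∷ u} {y ∷ v} (0<z ∷ 0<g) eq =
  cong₂ _∷_ (*-cancelʳ-≡ x y z {{>-nonZero 0<z}} (VecP.∷-injectiveˡ eq)) (⊙-cancelʳ 0<g (VecP.∷-injectiveʳ eq))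

map-injective : ∀ {f : A → B} → (∀ {x y} → f x ≡ f y → x ≡ y) →
  ∀ {n} {u v : Vec A n} → Vec.map f u ≡ Vec.map f v → u ≡ v
map-injective inj {u = []} {[]} _ = refl
map-injective inj {u = x ∷ u} {y ∷ v} eq =
  cong₂ _∷_ (inj (VecP.∷-injectiveˡ eq)) (map-injective inj (VecP.∷-injectiveʳ eq))

scaled-injective : ∀ {m n} (ds : Vec (Vec ℕ n) m) {A A′} → VecAll (0 <_) (columnProducts ds) →
  scaled ds A ≡ scaled ds A′ → A ≡ A′
scaled-injective ds 0<g eq =
  map-injective (⊙-cancelʳ 0<g) (map-injective (map-injective ℤP.+-injective) eq)

length-concatMap-≤ : ∀ (f : A → List B) xs {c} → (∀ x → length (f x) ≤ c) →
  length (concatMap f xs) ≤ length xs * c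
length-concatMap-≤ f [] f≤ = z≤n
length-concatMap-≤ f (x ∷ xs) f≤ =
  ≤-trans (≤-reflexive (length-++ (f x))) (+-mono-≤ (f≤ x) (length-concatMap-≤ f xs f≤))

pairs-unique : ∀ {xs : List A} {ys : List B} → Unique xs → Unique ys →
  Unique (concatMap (λ x → map (x ,_) ys) xs)
pairs-unique {xs = xs} {ys} uxs uys =
  subst Unique (sym (concatMap-map _,_ xs ys)) (UniqueP.cartesianProduct⁺ uxs uys)

-- Here `m` is the number of diagonal matrices, one less than the number of factors. Each entry of
-- the first row is a product of m + 1 members of `P`, so the product of that row is positive, rough
-- and at most H^(n (m + 1)); `F` bounds its number of divisors.
module DiagonalProducts
  (m n k H F : ℕ) (0<n : 0 < n)
  (F-max : ∀ {t} → t ^ k ≤ H ^ (n * suc m) → t ≤ F)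
  (P : List ℕ) (P-unique : Unique P) (P-nice : ∀ {x} → x ∈ P → RoughBox.Nice (2 ^ k) H 1 x)
  where

  open RoughBox (2 ^ k) H

  diagonals : List (Vec (Vec ℕ n) m)
  diagonals = allVecs m (allVecs n P)

  heads : List (Vec (Vec ℕ n) n)
  heads = allVecs n (allVecs n P)

  parameters : List (Vec (Vec ℕ n) m × Vec (Vec ℕ n) n)
  parameters = concatMap (λ ds → map (ds ,_) heads) diagonals

  length-parameters : length parameters ≡ (length P ^ n) ^ m * (length P ^ n) ^ n
  length-parameters = trans (length-pairs _,_ diagonals heads) (cong₂ _*_ (count m) (count n))
    where
    count : ∀ j → length (allVecs j (allVecs n P)) ≡ (length P ^ n) ^ j
    count j = trans (length-allVecs j (allVecs n P)) (cong (_^ j) (length-allVecs n P))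

  W : List (Mat n)
  W = deduplicate _≟M_ (products (suc m) n H)

  -- Cutting off at `F` gives a uniform length for every `X`. Nothing is lost when `X` is a `scaled`
  -- matrix from the parameters, since its first row product has at most `F` divisors.
  candidates : Mat n → List (Vec (Vec ℕ n) m)
  candidates X = allVecs m (allVecs n (take F (divisors (firstRowNorm X))))

  targets : List (Mat n × Vec (Vec ℕ n) m)
  targets = concatMap (λ X → map (X ,_) (candidates X)) W

  length-targets : length targets ≤ #W (suc m) n H * (F ^ n) ^ m
  length-targets = length-concatMap-≤ (λ X → map (X ,_) (candidates X)) W (λ X → begin
    length (map (X ,_) (candidates X))    ≡⟨ length-map (X ,_) (candidates X) ⟩
    length (candidates X)                 ≡⟨ length-allVecs m _ ⟩
    length (allVecs n (ds X)) ^ m         ≡⟨ cong (_^ m) (length-allVecs n (ds X)) ⟩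
    (length (ds X) ^ n) ^ m               ≤⟨ ^-monoˡ-≤ m (^-monoˡ-≤ n (≤-trans
                                               (≤-reflexive (length-take F (divisors (firstRowNorm X))))
                                               (m⊓n≤m F _))) ⟩
    (F ^ n) ^ m                           ∎)
    where
    open ≤-Reasoning
    ds : Mat n → List ℕ
    ds X = take F (divisors (firstRowNorm X))

  nice-rows : ∀ {j} {A : Vec (Vec ℕ n) j} → A ∈ allVecs j (allVecs n P) → VecAll (VecAll (Nice 1)) A
  nice-rows A∈ = VAll.map (VAll.map P-nice ∘ ∈-allVecs⁻) (∈-allVecs⁻ A∈)

  nice-≤ : ∀ {x} → Nice 1 x → x ≤ H
  nice-≤ (nice _ x≤ _) = subst (_ ≤_) (^-identityʳ H) x≤

  posV-bounded : ∀ {j} {d : Vec ℕ j} → VecAll (Nice 1) d → VecAll (λ x → ∣ x ∣ ≤ H) (posV d)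
  posV-bounded d-nice = VAllP.map⁺ (VAll.map nice-≤ d-nice)

  diag-bounded : ∀ {j} {d : Vec ℤ j} → VecAll (λ x → ∣ x ∣ ≤ H) d → Bounded H (diag d)
  diag-bounded [] = []
  diag-bounded {suc j} (x≤ ∷ d≤) =
    (x≤ ∷ zeros j) ∷ VAllP.map⁺ (VAll.map (z≤n ∷_) (diag-bounded d≤))
    where
    zeros : ∀ j → VecAll (λ x → ∣ x ∣ ≤ H) (replicate j (pos 0))
    zeros zero = []
    zeros (suc j) = z≤n ∷ zeros j

  scaled∈W : ∀ {ds A} → ds ∈ diagonals → A ∈ heads → scaled ds A ∈ W
  scaled∈W {ds} {A} ds∈ A∈ = ∈-deduplicate⁺ _≟M_ (subst (_∈ products (suc m) n H) (∏M-scaled ds A)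
    (∈-products⁺ (bounded⇒M (VAllP.map⁺ (VAll.map posV-bounded (nice-rows A∈))) ∷
      VAllP.map⁺ (VAll.map (bounded⇒M ∘ diag-bounded ∘ posV-bounded) (nice-rows ds∈)))))

  norm : ∀ {j ds} {A : Vec (Vec ℕ n) j} → 0 < j → ds ∈ diagonals → A ∈ allVecs j (allVecs n P) →
    let z = firstRowNorm (Vec.map posV (Vec.map (_⊙ columnProducts ds) A))
    in Nice (n * suc m) z × VecAll (VecAll (_∣ z)) ds
  norm {ds = ds} {a ∷ A} _ ds∈ A∈ =
    subst (λ v → Nice (n * suc m) (∏V v) × VecAll (VecAll (_∣ ∏V v)) ds) (sym (abs-posV (a ⊙ g)))
      (nice-∏V (nice-⊙ (VAll.head (nice-rows A∈)) (nice-columnProducts (nice-rows ds∈))) ,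
       VAll.map (λ d∣g → pointwise∣⇒all∣ (∣⊙ʳ a d∣g) (∣∏V (a ⊙ g))) (∣columnProducts ds))
    where
    g = columnProducts ds

  diagonals∈candidates : ∀ {ds A} → ds ∈ diagonals → A ∈ heads → ds ∈ candidates (scaled ds A)
  diagonals∈candidates {ds} {A} ds∈ A∈ = let nice 0<z z≤ rough , ds∣z = norm 0<n ds∈ A∈ in
    ∈-allVecs⁺ (VAll.map (∈-allVecs⁺ ∘ VAll.map (λ {d} d∣z →
      subst (d ∈_) (sym (take-all F (divisors z) (F-max (≤-trans (rough-divisors k z 0<z rough) z≤))))
        (∈-divisors⁺ 0<z d∣z))) ds∣z)
    where
    z = firstRowNorm (scaled ds A)

  -- Given the product and the diagonals, cancelling the positive column factors recovers the head.
  -- The product leaves at most F^(n m) possibilities for the diagonals, so it arises from at most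
  -- that many parameters.
  count-≤ : (length P ^ n) ^ m * (length P ^ n) ^ n ≤ #W (suc m) n H * (F ^ n) ^ m
  count-≤ = begin
    (length P ^ n) ^ m * (length P ^ n) ^ n   ≡⟨ length-parameters ⟨
    length parameters                          ≤⟨ length-injection (λ (ds , A) → scaled ds A , ds)
                                                   (pairs-unique (allVecs-unique m rows-unique′) (allVecs-unique n rows-unique′))
                                                   injective target ⟩
    length targets                            ≤⟨ length-targets ⟩
    #W (suc m) n H * (F ^ n) ^ m              ∎
    where
    open ≤-Reasoning
    rows-unique′ = allVecs-unique n P-unique
    injective : ∀ {x y} → x ∈ parameters → y ∈ parameters →
      (scaled (proj₁ x) (proj₂ x) , proj₁ x) ≡ (scaled (proj₁ y) (proj₂ y) , proj₁ y) → x ≡ y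
    injective {ds , A} {_ , A′} x∈ _ eq with cong proj₂ eq
    ... | refl with _ , _ , ds∈ , _ , refl ← ∈-pairs⁻ _,_ diagonals heads x∈ =
      cong (ds ,_) (scaled-injective ds
        (VAll.map Nice.positive (nice-columnProducts (nice-rows ds∈))) (cong proj₁ eq))
    target : ∀ {x} → x ∈ parameters → (scaled (proj₁ x) (proj₂ x) , proj₁ x) ∈ targets
    target x∈ with ds , A , ds∈ , A∈ , refl ← ∈-pairs⁻ _,_ diagonals heads x∈ =
      ∈-concatMap⁺ _ (lose (scaled∈W ds∈ A∈) (∈-map⁺ (scaled ds A ,_) (diagonals∈candidates ds∈ A∈)))

roughNumbers : ℕ → ℕ → List ℕ
roughNumbers Q K = map (λ i → 1 + i * Q) (upTo K)

-- A prime below `b` divides b!, so if it also divided 1 + i b! it would divide 1.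
rough-1+iQ : ∀ b i → Rough b (1 + i * b !)
rough-1+iQ b i {p} isPrime p∣ with b ≤? p
... | yes b≤p = b≤p
... | no b≰p = ⊥-elim (¬prime[1] (subst Prime (∣1⇒≡1
  (∣m+n∣m⇒∣n (subst (p ∣_) (+-comm 1 (i * b !)) p∣) (∣n⇒∣m*n i p∣b!))) isPrime))
  where
  n∣n! : ∀ {n} → 0 < n → n ∣ n !
  n∣n! {suc n} _ = m∣m*n (n !)
  p∣b! : p ∣ b !
  p∣b! = ∣-trans (n∣n! (prime-pos isPrime)) (m≤n⇒m!∣n! (<⇒≤ (≰⇒> b≰p)))

square-cancel-≤ : ∀ {a b} → a * a ≤ b * b → a ≤ b
square-cancel-≤ {a} {b} le with a ≤? b
... | yes a≤b = a≤b
... | no a≰b = contradiction le (<⇒≱ (*-mono-< (≰⇒> a≰b) (≰⇒> a≰b)))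

-- The value of `k` is such that taking n (m + 1)-th roots in F^k ≤ H^(n (m + 1)) leaves (F^(n m))^r
-- ≤ H: the multiplicity is at most H^(1/r). Having only K = ⌊H/Q⌋ instead of H choices per entry
-- costs the constant factor 2 Q each time.
#W-lower : ∀ m n k r → 0 < n → k ≡ n * m * r * (n * suc m) → 0 < k → ∀ {H} → (2 ^ k) ! ≤ H →
  (H ^ (n * n + m * n)) ^ r ≤ ((2 * (2 ^ k) !) ^ (n * n + m * n)) ^ r * (#W (suc m) n H ^ r * H)
#W-lower m n k r 0<n k≡ 0<k {H} Q≤H
  with F , F^k≤ , F-max ← integerRoot k 0<k (H ^ (n * suc m)) = begin
    (H ^ E) ^ r                             ≤⟨ ^-monoˡ-≤ r (^-monoˡ-≤ E H≤2QK) ⟩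
    ((2 * Q * K) ^ E) ^ r                   ≡⟨ cong (_^ r) (^-distribʳ-* E (2 * Q) K) ⟩
    ((2 * Q) ^ E * K ^ E) ^ r               ≡⟨ ^-distribʳ-* r ((2 * Q) ^ E) (K ^ E) ⟩
    ((2 * Q) ^ E) ^ r * (K ^ E) ^ r         ≤⟨ *-monoʳ-≤ (((2 * Q) ^ E) ^ r) (^-monoˡ-≤ r (K^E≤ F F-max)) ⟩
    ((2 * Q) ^ E) ^ r * (w * (F ^ n) ^ m) ^ r
                                            ≡⟨ cong (((2 * Q) ^ E) ^ r *_) (^-distribʳ-* r w ((F ^ n) ^ m)) ⟩
    ((2 * Q) ^ E) ^ r * (w ^ r * ((F ^ n) ^ m) ^ r)
                                            ≤⟨ *-monoʳ-≤ (((2 * Q) ^ E) ^ r) (*-monoʳ-≤ (w ^ r) (Z^r≤H F F^k≤)) ⟩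
    ((2 * Q) ^ E) ^ r * (w ^ r * H)         ∎
  where
  open ≤-Reasoning
  Q = (2 ^ k) !
  K = H ÷ Q
  E = n * n + m * n
  w = #W (suc m) n H
  P = roughNumbers Q K
  0<Q : 0 < Q
  0<Q = 1≤n! (2 ^ k)
  0<K : 0 < K
  0<K = ≤-÷ 0<Q (≤-trans (≤-reflexive (*-identityˡ Q)) Q≤H)
  H≤2QK : H ≤ 2 * Q * K
  H≤2QK = begin
    H                ≤⟨ <⇒≤ (<-÷ H 0<Q) ⟩
    suc K * Q        ≤⟨ *-monoˡ-≤ Q (+-monoˡ-≤ K 0<K) ⟩
    (K + K) * Q      ≡⟨ shuffle K Q ⟩
    2 * Q * K        ∎
    where
    shuffle : ∀ K Q → (K + K) * Q ≡ 2 * Q * K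
    shuffle = solve-∀
  P-unique : Unique P
  P-unique = UniqueP.map⁺ (λ {i} {j} eq → *-cancelʳ-≡ i j Q {{>-nonZero 0<Q}} (suc-injective eq)) (UniqueP.upTo⁺ K)
  P-nice : ∀ {x} → x ∈ P → RoughBox.Nice (2 ^ k) H 1 x
  P-nice x∈ with i , i∈ , refl ← ∈-map⁻ (λ i → 1 + i * Q) x∈ = RoughBox.nice z<s (begin
    1 + i * Q        ≤⟨ +-monoˡ-≤ (i * Q) 0<Q ⟩
    suc i * Q        ≤⟨ *-monoˡ-≤ Q (∈-upTo⁻ i∈) ⟩
    K * Q            ≤⟨ ÷-*-≤ H Q ⟩
    H                ≡⟨ ^-identityʳ H ⟨
    H ^ 1            ∎) (rough-1+iQ (2 ^ k) i)
  length-P : length P ≡ K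
  length-P = trans (length-map _ (upTo K)) (length-upTo K)
  K^E≤ : ∀ F → (∀ {t} → t ^ k ≤ H ^ (n * suc m) → t ≤ F) → K ^ E ≤ w * (F ^ n) ^ m
  K^E≤ F F-max = begin
    K ^ E                                     ≡⟨ ^-distribˡ-+-* K (n * n) (m * n) ⟩
    K ^ (n * n) * K ^ (m * n)                 ≡⟨ *-comm (K ^ (n * n)) (K ^ (m * n)) ⟩
    K ^ (m * n) * K ^ (n * n)                 ≡⟨ cong₂ _*_ (trans (cong (K ^_) (*-comm m n)) (sym (^-*-assoc K n m))) (sym (^-*-assoc K n n)) ⟩
    (K ^ n) ^ m * (K ^ n) ^ n                 ≡⟨ cong (λ l → (l ^ n) ^ m * (l ^ n) ^ n) length-P ⟨
    (length P ^ n) ^ m * (length P ^ n) ^ n   ≤⟨ DiagonalProducts.count-≤ m n k H F 0<n F-max P P-unique P-nice ⟩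
    w * (F ^ n) ^ m                           ∎
  Z^r≤H : ∀ F → F ^ k ≤ H ^ (n * suc m) → ((F ^ n) ^ m) ^ r ≤ H
  Z^r≤H F F^k≤ = ^-cancelʳ-≤ (n * suc m) (*-mono-< 0<n z<s) (begin
    (((F ^ n) ^ m) ^ r) ^ (n * suc m)   ≡⟨ cong (λ t → (t ^ r) ^ (n * suc m)) (^-*-assoc F n m) ⟩
    ((F ^ (n * m)) ^ r) ^ (n * suc m)   ≡⟨ cong (_^ (n * suc m)) (^-*-assoc F (n * m) r) ⟩
    (F ^ (n * m * r)) ^ (n * suc m)     ≡⟨ ^-*-assoc F (n * m * r) (n * suc m) ⟩
    F ^ (n * m * r * (n * suc m))       ≡⟨ cong (F ^_) k≡ ⟨
    F ^ k                               ≤⟨ F^k≤ ⟩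
    H ^ (n * suc m)                     ∎)

-- This is H^(E - ε) ≤ #W raised to the power q + 1, for ε = (p + 1)/(q + 1) and E = n² + m n. The
-- argument reaches ε = 1/(q + 1), which implies it.
#W-dense : ∀ m n → 0 < m → 0 < n → (p q : ℕ) → ∃ λ H₀ → (H : ℕ) → H₀ ≤ H →
  H ^ ((n * n + m * n) * suc q) ≤ #W (suc m) n H ^ suc q * H ^ suc p
#W-dense m n 0<m 0<n p q = Q + T , bound
  where
  s = suc q
  -- Twice `s`, because two factors H are lost: one absorbs the constant `T`, the other the
  -- multiplicity. The square root of w^r H² is then w^s H.
  r = 2 * s
  k = n * m * r * (n * suc m)
  Q = (2 ^ k) !
  E = n * n + m * n
  T = ((2 * Q) ^ E) ^ r
  0<k : 0 < k
  0<k = *-mono-< (*-mono-< (*-mono-< 0<n 0<m) (z<s {q + (s + 0)})) (*-mono-< 0<n (z<s {m}))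
  bound : ∀ H → Q + T ≤ H → H ^ (E * s) ≤ #W (suc m) n H ^ s * H ^ suc p
  bound H Q+T≤H = begin
    H ^ (E * s)            ≡⟨ ^-*-assoc H E s ⟨
    (H ^ E) ^ s            ≤⟨ square-cancel-≤ squares ⟩
    w ^ s * H              ≤⟨ *-monoʳ-≤ (w ^ s) (base≤power H {suc p} z<s) ⟩
    w ^ s * H ^ suc p      ∎
    where
    open ≤-Reasoning
    w = #W (suc m) n H
    double : ∀ a → a ^ r ≡ a ^ s * a ^ s
    double a = trans (^-distribˡ-+-* a s (s + 0)) (cong (λ t → a ^ s * a ^ t) (+-identityʳ s))
    shuffle : ∀ H v → H * (v * v * H) ≡ v * H * (v * H)
    shuffle = solve-∀
    squares : (H ^ E) ^ s * (H ^ E) ^ s ≤ w ^ s * H * (w ^ s * H)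
    squares = begin
      (H ^ E) ^ s * (H ^ E) ^ s    ≡⟨ double (H ^ E) ⟨
      (H ^ E) ^ r                  ≤⟨ #W-lower m n k r 0<n refl 0<k (m+n≤o⇒m≤o Q Q+T≤H) ⟩
      T * (w ^ r * H)              ≤⟨ *-monoˡ-≤ (w ^ r * H) (m+n≤o⇒n≤o Q Q+T≤H) ⟩
      H * (w ^ r * H)              ≡⟨ cong (λ t → H * (t * H)) (double w) ⟩
      H * (w ^ s * w ^ s * H)      ≡⟨ shuffle H (w ^ s) ⟩
      w ^ s * H * (w ^ s * H)      ∎

theorem2p3 : (m n : ℕ) → 2 ≤ m → 2 ≤ n →
    ((p q : ℕ) → ∃ λ H₀ → (H : ℕ) → H₀ ≤ H →
    H ^ ((n * n + m * n ∸ n) * suc q) ≤ #W m n H ^ suc q * H ^ suc p)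
    × (6 ≤ m → (p q : ℕ) → ∃ λ H₀ → (H : ℕ) → H₀ ≤ H →
    suc q * #W m n H < suc p * H ^ (m * (n * n)))
-- One factor is the head and the other `m` are diagonal, giving n² + m n free entries, which is n²
-- + (m + 1) n - n.
theorem2p3 (suc m) n (s≤s 0<m) 2≤n =
  (λ p q → subst (λ E → ∃ λ H₀ → (H : ℕ) → H₀ ≤ H →
      H ^ (E * suc q) ≤ #W (suc m) n H ^ suc q * H ^ suc p) exponent (#W-dense m n 0<m 0<n p q)) ,
  (λ 6≤m → #W-sparse (suc m) n 6≤m 0<n)
  where
  0<n : 0 < n
  0<n = <⇒≤ 2≤n
  shuffle : ∀ n m → n * n + (n + m * n) ≡ n * n + m * n + n
  shuffle = solve-∀
  exponent : n * n + m * n ≡ n * n + suc m * n ∸ n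
  exponent = sym (trans (cong (_∸ n) (shuffle n m)) (m+n∸n≡m (n * n + m * n) n))
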